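{- For every integer $k\ge 3$, let $T_k$ be the minimal $t\in\mathbb{N}$ such that for every $n\in\mathbb{N}$, every equinumerous $t$-coloring of $[tn]=\{1,2,\dots,tn\}$ contains a rainbow arithmetic progression of length $k$. Then $$T_k\le k^2\, e^{(1+o(1))(\ln\ln k)^2}\qquad\text{as } k\to\infty,$$ i.e., there is a function $\varepsilon(k)$ with $\varepsilon(k)\to 0$ as $k\to\infty$ such that $T_k\le k^2 \exp\big((1+\varepsilon(k))(\ln\ln k)^2\big)$ for all sufficiently large $k$.
   Context: An equinumerous $t$-coloring of a finite set is a coloring with $t$ colors in which each color is used exactly the same number of times (so in an equinumerous $t$-coloring of $[tn]$ each color class has exactly $n$ elements). Given a coloring of $[N]$, an arithmetic progression $a, a+d, \dots, a+(k-1)d$ (with $d\ge 1$) contained in $[N]$ is rainbow if its $k$ terms all receive distinct colors. $\ln$ denotes the natural logarithm. -}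

module Defs where

open import Data.Fin.Base using (Fin; toℕ)
open import Data.Fin.Properties using () renaming (_≟_ to _≟F_)
open import Data.Integer.Base using (+_; -[1+_])
import Data.Integer.Base as ℤ
import Data.Integer.Properties as ℤ
open import Data.List.Base using (allFin; filter; length)
open import Data.Nat.Base as ℕ using (ℕ; zero; suc)
import Data.Nat.Properties as ℕ
open import Data.Product.Base using (_×_; _,_; ∃-syntax; proj₁; proj₂)
open import Data.Rational.Base
open import Data.Rational.Literals using (fromℤ)
open import Data.Rational.Properties
open import Data.Rational.Solver using (module +-*-Solver)
import Data.Rational.Unnormalised.Base as ℚᵘ
import Data.Rational.Unnormalised.Properties as ℚᵘ
open import Data.Sum.Base using ([_,_]′)
open import Function.Base using (_∘_)
open import Function.Definitions using (Injective)
open import Relation.Binary.PropositionalEquality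
open import Relation.Nullary.Decidable.Core using (yes; no)
open import Relation.Nullary.Negation.Core using (contradiction)
open +-*-Solver using (solve; _:+_; _:*_; _:-_; :-_; _:=_; con)

-- x : Fin N stands for the element toℕ x + 1 of [N] = {1, …, N}.
element : ∀ {N} → Fin N → ℕ
element x = suc (toℕ x)

Coloring : ℕ → ℕ → Set
Coloring N t = Fin N → Fin t

classSize : ∀ {N t} → Coloring N t → Fin t → ℕ
classSize {N} c j = length (filter (λ x → c x ≟F j) (allFin N))

Equinumerous : ∀ {N t} → Coloring N t → Set
Equinumerous c = ∀ i j → classSize c i ≡ classSize c j

record RainbowAP {N t : ℕ} (c : Coloring N t) (k : ℕ) : Set where
  field
    start      : ℕ
    difference : ℕ
    difference≥1 : 1 ℕ.≤ difference
    term       : Fin k → Fin N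
    term-eq    : ∀ i → element (term i) ≡ start ℕ.+ toℕ i ℕ.* difference
    rainbow    : Injective _≡_ _≡_ (c ∘ term)

-- n ranges over the positive integers: for n = 0 there is nothing to color
-- and, for k ≥ 1, the property would fail for every t.
ForcesRainbowAP : ℕ → ℕ → Set
ForcesRainbowAP k t =
  ∀ n → 1 ℕ.≤ n → (c : Coloring (t ℕ.* n) t) → Equinumerous c → RainbowAP c k

IsMinimum : (ℕ → Set) → ℕ → Set
IsMinimum P m = P m × (∀ n → P n → m ℕ.≤ n)

-- IsT k T says that T is the number T_k.  It is a relation because the minimum of
-- a nonempty subset of ℕ need not exist constructively.
IsT : ℕ → ℕ → Set
IsT k T = IsMinimum (ForcesRainbowAP k) T

fromℕ : ℕ → ℚ
fromℕ n = fromℤ (+ n)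

fromℕ-mono : ∀ {m n} → m ℕ.≤ n → fromℕ m ≤ fromℕ n
fromℕ-mono {m} {n} m≤n = *≤* (subst₂ ℤ._≤_ (sym (ℤ.*-identityʳ (+ m)))
  (sym (ℤ.*-identityʳ (+ n))) (ℤ.+≤+ m≤n))

fromℕ-suc : ∀ n → fromℕ n + 1ℚ ≡ fromℕ (suc n)
fromℕ-suc n = toℚᵘ-injective (ℚᵘ.≃-trans (toℚᵘ-homo-+ (fromℕ n) 1ℚ)
  (ℚᵘ.*≡* (cong (ℤ._* + 1) lemma)))
  where
  lemma : + n ℤ.* + 1 ℤ.+ + 1 ≡ + suc n
  lemma = trans (cong (ℤ._+ + 1) (ℤ.*-identityʳ (+ n))) (cong +_ (ℕ.+-comm n 1))

≤-fromℕ : ∀ p → ∃[ n ] p ≤ fromℕ n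
≤-fromℕ (mkℚ (+ a) d _) =
  a , *≤* (ℤ.*-monoˡ-≤-nonNeg (+ a) {+ 1} {+ suc d} (ℤ.+≤+ (ℕ.s≤s ℕ.z≤n)))
≤-fromℕ (mkℚ -[1+ a ] d _) = 0 , *≤* ℤ.-≤+

0≤fromℕ : ∀ n → 0ℚ ≤ fromℕ n
0≤fromℕ n = fromℕ-mono ℕ.z≤n

*-mono-≤ : ∀ {a b c d} → 0ℚ ≤ c → 0ℚ ≤ b → a ≤ b → c ≤ d → a * c ≤ b * d
*-mono-≤ {a} {b} {c} {d} 0≤c 0≤b a≤b c≤d = ≤-trans
  (*-monoʳ-≤-nonNeg c {{nonNegative 0≤c}} a≤b)
  (*-monoˡ-≤-nonNeg b {{nonNegative 0≤b}} c≤d)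

0≤* : ∀ {a b} → 0ℚ ≤ a → 0ℚ ≤ b → 0ℚ ≤ a * b
0≤* {a} {b} 0≤a 0≤b = nonNegative⁻¹ (a * b)
  {{nonNeg*nonNeg⇒nonNeg a {{nonNegative 0≤a}} b {{nonNegative 0≤b}}}}

0<* : ∀ {a b} → 0ℚ < a → 0ℚ < b → 0ℚ < a * b
0<* {a} {b} 0<a 0<b = positive⁻¹ (a * b)
  {{pos*pos⇒pos a {{positive 0<a}} b {{positive 0<b}}}}

0≤+ : ∀ {a b} → 0ℚ ≤ a → 0ℚ ≤ b → 0ℚ ≤ a + b
0≤+ = +-mono-≤ {0ℚ} {_} {0ℚ}

≤+ʳ : ∀ a {b} → 0ℚ ≤ b → a ≤ a + b
≤+ʳ a {b} 0≤b = subst (_≤ a + b) (+-identityʳ a) (+-monoʳ-≤ a 0≤b)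

inv : ℕ → ℚ
inv n = 1/ fromℕ (suc n)

0<inv : ∀ n → 0ℚ < inv n
0<inv n = positive⁻¹ (inv n)

inv*suc : ∀ n → inv n * fromℕ (suc n) ≡ 1ℚ
inv*suc n = *-inverseˡ (fromℕ (suc n))

0<½ : 0ℚ < ½
0<½ = positive⁻¹ ½

half : ∀ δ → δ * ½ + δ * ½ ≡ δ
half δ = trans (sym (*-distribˡ-+ δ ½ ½)) (*-identityʳ δ)

cancel-inv : ∀ n b → fromℕ (suc n) * (b * inv n) ≡ b
cancel-inv n b = begin
  fromℕ (suc n) * (b * inv n) ≡⟨ *-comm (fromℕ (suc n)) (b * inv n) ⟩
  b * inv n * fromℕ (suc n)   ≡⟨ *-assoc b (inv n) (fromℕ (suc n)) ⟩
  b * (inv n * fromℕ (suc n)) ≡⟨ cong (b *_) (inv*suc n) ⟩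
  b * 1ℚ                      ≡⟨ *-identityʳ b ⟩
  b                           ∎
  where open ≡-Reasoning

≤-÷suc : ∀ {a b} n → a ≤ b * inv n → fromℕ (suc n) * a ≤ b
≤-÷suc {a} {b} n a≤ = subst (fromℕ (suc n) * a ≤_) (cancel-inv n b)
  (*-monoˡ-≤-nonNeg (fromℕ (suc n)) a≤)

archimedean : ∀ a {δ} → 0ℚ < δ → ∃[ n ] a ≤ δ * fromℕ n
archimedean a {δ} 0<δ = n , subst (_≤ δ * fromℕ n) eq
  (*-monoˡ-≤-nonNeg δ {{pos⇒nonNeg δ {{δ⁺}}}} a/δ≤n)
  where
  δ⁺ = positive 0<δ
  instance δ≢0 = pos⇒nonZero δ {{δ⁺}}
  n = proj₁ (≤-fromℕ (a * 1/ δ))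
  a/δ≤n = proj₂ (≤-fromℕ (a * 1/ δ))
  eq : δ * (a * 1/ δ) ≡ a
  eq = trans (solve 3 (λ d a i → d :* (a :* i) := a :* (d :* i)) refl δ a (1/ δ))
    (trans (cong (a *_) (*-inverseʳ δ)) (*-identityʳ a))

∣-∣-swap : ∀ p q → ∣ p - q ∣ ≡ ∣ q - p ∣
∣-∣-swap p q = trans (sym (∣-p∣≡∣p∣ (p - q)))
  (cong ∣_∣ (solve 2 (λ p q → :- (p :- q) := q :- p) refl p q))

∣-∣-via : ∀ p q r → ∣ p - r ∣ ≤ ∣ p - q ∣ + ∣ q - r ∣
∣-∣-via p q r = subst (λ z → ∣ z ∣ ≤ ∣ p - q ∣ + ∣ q - r ∣)
  (solve 3 (λ p q r → (p :- q) :+ (q :- r) := p :- r) refl p q r)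
  (∣p+q∣≤∣p∣+∣q∣ (p - q) (q - r))

IsCauchy : (ℕ → ℚ) → Set
IsCauchy s = ∀ δ → 0ℚ < δ →
  ∃[ N ] (∀ m n → N ℕ.≤ m → N ℕ.≤ n → ∣ s m - s n ∣ ≤ δ)

record ℝ : Set where
  constructor mkℝ
  field
    seq    : ℕ → ℚ
    cauchy : IsCauchy seq

open ℝ public

infix 4 _≤ℝ_ _≈ℝ_

_≤ℝ_ : ℝ → ℝ → Set
x ≤ℝ y = ∀ δ → 0ℚ < δ → ∃[ N ] (∀ n → N ℕ.≤ n → seq x n ≤ seq y n + δ)

_≈ℝ_ : ℝ → ℝ → Set
x ≈ℝ y = x ≤ℝ y × y ≤ℝ x

cauchy-from : ∀ {s} →
  (∀ δ → 0ℚ < δ → ∃[ N ] (∀ m → N ℕ.≤ m → ∣ s m - s N ∣ ≤ δ)) → IsCauchy s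
cauchy-from {s} h δ 0<δ with h (δ * ½) (0<* 0<δ 0<½)
... | N , close = N , λ m n N≤m N≤n → ≤-trans (∣-∣-via (s m) (s N) (s n))
  (subst (∣ s m - s N ∣ + ∣ s N - s n ∣ ≤_) (half δ)
    (+-mono-≤ (close m N≤m)
      (subst (_≤ δ * ½) (∣-∣-swap (s n) (s N)) (close n N≤n))))

eventually-bounded : ∀ {s} → IsCauchy s →
  ∃[ M ] ∃[ N ] (∀ n → N ℕ.≤ n → ∣ s n ∣ ≤ fromℕ (suc M))
eventually-bounded {s} c with c 1ℚ (positive⁻¹ 1ℚ)
... | N , close with ≤-fromℕ (1ℚ + ∣ s N ∣)
... | M , ≤M = M , N , λ n N≤n → begin
  ∣ s n ∣                   ≡⟨ cong ∣_∣ (solve 2 (λ a b → a := (a :- b) :+ b) refl (s n) (s N)) ⟩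
  ∣ (s n - s N) + s N ∣     ≤⟨ ∣p+q∣≤∣p∣+∣q∣ (s n - s N) (s N) ⟩
  ∣ s n - s N ∣ + ∣ s N ∣   ≤⟨ +-monoˡ-≤ ∣ s N ∣ (close n N N≤n ℕ.≤-refl) ⟩
  1ℚ + ∣ s N ∣              ≤⟨ ≤M ⟩
  fromℕ M                   ≤⟨ fromℕ-mono (ℕ.n≤1+n M) ⟩
  fromℕ (suc M)             ∎
  where open ≤-Reasoning

fromℚ : ℚ → ℝ
fromℚ q = mkℝ (λ _ → q) λ δ 0<δ → 0 , λ _ _ _ _ →
  subst (_≤ δ) (sym (cong ∣_∣ (+-inverseʳ q))) (<⇒≤ 0<δ)

infixl 6 _+ℝ_
infixl 7 _*ℝ_

_+ℝ_ : ℝ → ℝ → ℝ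
x +ℝ y = mkℝ (λ n → seq x n + seq y n) cauchy-+
  where
  cauchy-+ : IsCauchy (λ n → seq x n + seq y n)
  cauchy-+ δ 0<δ with cauchy x (δ * ½) (0<* 0<δ 0<½) | cauchy y (δ * ½) (0<* 0<δ 0<½)
  ... | N₁ , h₁ | N₂ , h₂ = N₁ ℕ.⊔ N₂ , λ m n N≤m N≤n → begin
    ∣ (seq x m + seq y m) - (seq x n + seq y n) ∣
      ≡⟨ cong ∣_∣ (solve 4 (λ a b c d → (a :+ b) :- (c :+ d) := (a :- c) :+ (b :- d)) refl
           (seq x m) (seq y m) (seq x n) (seq y n)) ⟩
    ∣ (seq x m - seq x n) + (seq y m - seq y n) ∣
      ≤⟨ ∣p+q∣≤∣p∣+∣q∣ (seq x m - seq x n) (seq y m - seq y n) ⟩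
    ∣ seq x m - seq x n ∣ + ∣ seq y m - seq y n ∣
      ≤⟨ +-mono-≤
           (h₁ m n (ℕ.≤-trans (ℕ.m≤m⊔n N₁ N₂) N≤m) (ℕ.≤-trans (ℕ.m≤m⊔n N₁ N₂) N≤n))
           (h₂ m n (ℕ.≤-trans (ℕ.m≤n⊔m N₁ N₂) N≤m) (ℕ.≤-trans (ℕ.m≤n⊔m N₁ N₂) N≤n)) ⟩
    δ * ½ + δ * ½ ≡⟨ half δ ⟩
    δ ∎
    where open ≤-Reasoning

∣*-*∣ : ∀ {A B α β} a b c d → 0ℚ ≤ A → 0ℚ ≤ B →
  ∣ a ∣ ≤ A → ∣ b - d ∣ ≤ β → ∣ d ∣ ≤ B → ∣ a - c ∣ ≤ α →
  ∣ a * b - c * d ∣ ≤ A * β + B * α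
∣*-*∣ {A} {B} {α} {β} a b c d 0≤A 0≤B a≤A b-d≤β d≤B a-c≤α = begin
  ∣ a * b - c * d ∣
    ≡⟨ cong ∣_∣ (solve 4 (λ a b c d → a :* b :- c :* d := a :* (b :- d) :+ d :* (a :- c)) refl a b c d) ⟩
  ∣ a * (b - d) + d * (a - c) ∣
    ≤⟨ ∣p+q∣≤∣p∣+∣q∣ (a * (b - d)) (d * (a - c)) ⟩
  ∣ a * (b - d) ∣ + ∣ d * (a - c) ∣
    ≡⟨ cong₂ _+_ (∣p*q∣≡∣p∣*∣q∣ a (b - d)) (∣p*q∣≡∣p∣*∣q∣ d (a - c)) ⟩
  ∣ a ∣ * ∣ b - d ∣ + ∣ d ∣ * ∣ a - c ∣
    ≤⟨ +-mono-≤ (*-mono-≤ (0≤∣p∣ (b - d)) 0≤A a≤A b-d≤β) (*-mono-≤ (0≤∣p∣ (a - c)) 0≤B d≤B a-c≤α) ⟩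
  A * β + B * α ∎
  where open ≤-Reasoning

*-cauchy : ∀ {s t} → IsCauchy s → IsCauchy t → IsCauchy (λ n → s n * t n)
*-cauchy {s} {t} cs ct δ 0<δ = N , close
  where
  M₁ B₁ M₂ B₂ N₁ N₂ N : ℕ
  M₁ = proj₁ (eventually-bounded {s} cs)
  B₁ = proj₁ (proj₂ (eventually-bounded {s} cs))
  M₂ = proj₁ (eventually-bounded {t} ct)
  B₂ = proj₁ (proj₂ (eventually-bounded {t} ct))
  δ₁ δ₂ : ℚ
  δ₁ = δ * ½ * inv M₂
  δ₂ = δ * ½ * inv M₁
  0<δ₁ : 0ℚ < δ₁
  0<δ₁ = 0<* (0<* 0<δ 0<½) (0<inv M₂)
  0<δ₂ : 0ℚ < δ₂
  0<δ₂ = 0<* (0<* 0<δ 0<½) (0<inv M₁)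
  N₁ = proj₁ (cs δ₁ 0<δ₁)
  N₂ = proj₁ (ct δ₂ 0<δ₂)
  N = (B₁ ℕ.⊔ B₂) ℕ.⊔ (N₁ ℕ.⊔ N₂)
  B₁≤ : ∀ {n} → N ℕ.≤ n → B₁ ℕ.≤ n
  B₁≤ N≤n = ℕ.m⊔n≤o⇒m≤o B₁ B₂ (ℕ.m⊔n≤o⇒m≤o (B₁ ℕ.⊔ B₂) (N₁ ℕ.⊔ N₂) N≤n)
  B₂≤ : ∀ {n} → N ℕ.≤ n → B₂ ℕ.≤ n
  B₂≤ N≤n = ℕ.m⊔n≤o⇒n≤o B₁ B₂ (ℕ.m⊔n≤o⇒m≤o (B₁ ℕ.⊔ B₂) (N₁ ℕ.⊔ N₂) N≤n)
  N₁≤ : ∀ {n} → N ℕ.≤ n → N₁ ℕ.≤ n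
  N₁≤ N≤n = ℕ.m⊔n≤o⇒m≤o N₁ N₂ (ℕ.m⊔n≤o⇒n≤o (B₁ ℕ.⊔ B₂) (N₁ ℕ.⊔ N₂) N≤n)
  N₂≤ : ∀ {n} → N ℕ.≤ n → N₂ ℕ.≤ n
  N₂≤ N≤n = ℕ.m⊔n≤o⇒n≤o N₁ N₂ (ℕ.m⊔n≤o⇒n≤o (B₁ ℕ.⊔ B₂) (N₁ ℕ.⊔ N₂) N≤n)
  total : fromℕ (suc M₁) * δ₂ + fromℕ (suc M₂) * δ₁ ≡ δ
  total = trans (cong₂ _+_ (cancel-inv M₁ (δ * ½)) (cancel-inv M₂ (δ * ½))) (half δ)
  close : ∀ m n → N ℕ.≤ m → N ℕ.≤ n → ∣ s m * t m - s n * t n ∣ ≤ δ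
  close m n N≤m N≤n = subst (∣ s m * t m - s n * t n ∣ ≤_) total
    (∣*-*∣ {fromℕ (suc M₁)} {fromℕ (suc M₂)} {δ₁} {δ₂}
      (s m) (t m) (s n) (t n) (0≤fromℕ (suc M₁)) (0≤fromℕ (suc M₂))
      (proj₂ (proj₂ (eventually-bounded {s} cs)) m (B₁≤ N≤m))
      (proj₂ (ct δ₂ 0<δ₂) m n (N₂≤ N≤m) (N₂≤ N≤n))
      (proj₂ (proj₂ (eventually-bounded {t} ct)) n (B₂≤ N≤n))
      (proj₂ (cs δ₁ 0<δ₁) m n (N₁≤ N≤m) (N₁≤ N≤n)))

_*ℝ_ : ℝ → ℝ → ℝ
x *ℝ y = mkℝ (λ n → seq x n * seq y n) (*-cauchy {seq x} {seq y} (cauchy x) (cauchy y))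

-- expTerm q i = q^i / i!
expTerm : ℚ → ℕ → ℚ
expTerm q zero    = 1ℚ
expTerm q (suc i) = expTerm q i * q ÷ fromℕ (suc i)

-- expSum q n = Σ_{i ≤ n} q^i / i!
expSum : ℚ → ℕ → ℚ
expSum q zero    = expTerm q zero
expSum q (suc n) = expSum q n + expTerm q (suc n)

expTerm-suc : ∀ q i → expTerm q (suc i) * fromℕ (suc i) ≡ expTerm q i * q
expTerm-suc q i = trans (*-assoc (expTerm q i * q) (inv i) (fromℕ (suc i)))
  (trans (cong (expTerm q i * q *_) (inv*suc i)) (*-identityʳ (expTerm q i * q)))

0≤expTerm : ∀ {r} → 0ℚ ≤ r → ∀ i → 0ℚ ≤ expTerm r i
0≤expTerm 0≤r zero    = nonNegative⁻¹ 1ℚ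
0≤expTerm 0≤r (suc i) = 0≤* (0≤* (0≤expTerm 0≤r i) 0≤r) (<⇒≤ (0<inv i))

∣inv∣ : ∀ i → ∣ inv i ∣ ≡ inv i
∣inv∣ i = 0≤p⇒∣p∣≡p (<⇒≤ (0<inv i))

∣expTerm∣ : ∀ {q r} → 0ℚ ≤ r → ∣ q ∣ ≤ r → ∀ i → ∣ expTerm q i ∣ ≤ expTerm r i
∣expTerm∣ 0≤r q≤r zero = ≤-refl
∣expTerm∣ {q} {r} 0≤r q≤r (suc i) = begin
  ∣ expTerm q i * q * inv i ∣
    ≡⟨ trans (∣p*q∣≡∣p∣*∣q∣ (expTerm q i * q) (inv i))
         (cong₂ _*_ (∣p*q∣≡∣p∣*∣q∣ (expTerm q i) q) (∣inv∣ i)) ⟩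
  ∣ expTerm q i ∣ * ∣ q ∣ * inv i
    ≤⟨ *-monoʳ-≤-nonNeg (inv i)
         (*-mono-≤ (0≤∣p∣ q) (0≤expTerm 0≤r i) (∣expTerm∣ 0≤r q≤r i) q≤r) ⟩
  expTerm r i * r * inv i ∎
  where open ≤-Reasoning

∣expSum-tail∣ : ∀ {q r} → 0ℚ ≤ r → ∣ q ∣ ≤ r → ∀ n j →
  ∣ expSum q (j ℕ.+ n) - expSum q n ∣ ≤ expSum r (j ℕ.+ n) - expSum r n
∣expSum-tail∣ {q} {r} 0≤r q≤r n zero = ≤-reflexive
  (trans (cong ∣_∣ (+-inverseʳ (expSum q n))) (sym (+-inverseʳ (expSum r n))))
∣expSum-tail∣ {q} {r} 0≤r q≤r n (suc j) = begin
  ∣ (expSum q (j ℕ.+ n) + t q) - expSum q n ∣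
    ≡⟨ cong ∣_∣ (swap (expSum q (j ℕ.+ n)) (t q) (expSum q n)) ⟩
  ∣ (expSum q (j ℕ.+ n) - expSum q n) + t q ∣
    ≤⟨ ∣p+q∣≤∣p∣+∣q∣ (expSum q (j ℕ.+ n) - expSum q n) (t q) ⟩
  ∣ expSum q (j ℕ.+ n) - expSum q n ∣ + ∣ t q ∣
    ≤⟨ +-mono-≤ (∣expSum-tail∣ 0≤r q≤r n j) (∣expTerm∣ 0≤r q≤r (suc (j ℕ.+ n))) ⟩
  (expSum r (j ℕ.+ n) - expSum r n) + t r
    ≡⟨ swap (expSum r (j ℕ.+ n)) (t r) (expSum r n) ⟨
  (expSum r (j ℕ.+ n) + t r) - expSum r n ∎
  where
  open ≤-Reasoning
  t : ℚ → ℚ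
  t z = expTerm z (suc (j ℕ.+ n))
  swap : ∀ a b c → (a + b) - c ≡ (a - c) + b
  swap = solve 3 (λ a b c → (a :+ b) :- c := (a :- c) :+ b) refl

∣expTerm-lip∣ : ∀ {p q r} → 0ℚ ≤ r → ∣ p ∣ ≤ r → ∣ q ∣ ≤ r → ∀ i →
  ∣ expTerm p (suc i) - expTerm q (suc i) ∣ ≤ ∣ p - q ∣ * expTerm r i
∣expTerm-lip∣ {p} {q} {r} 0≤r p≤r q≤r i = begin
  ∣ expTerm p i * p * inv i - expTerm q i * q * inv i ∣
    ≡⟨ cong ∣_∣ (solve 5 (λ a p b q v →
         a :* p :* v :- b :* q :* v := ((a :- b) :* p :+ b :* (p :- q)) :* v) refl
         (expTerm p i) p (expTerm q i) q (inv i)) ⟩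
  ∣ ((expTerm p i - expTerm q i) * p + expTerm q i * (p - q)) * inv i ∣
    ≡⟨ trans (∣p*q∣≡∣p∣*∣q∣ D (inv i)) (cong (∣ D ∣ *_) (∣inv∣ i)) ⟩
  ∣ (expTerm p i - expTerm q i) * p + expTerm q i * (p - q) ∣ * inv i
    ≤⟨ *-monoʳ-≤-nonNeg (inv i) (∣p+q∣≤∣p∣+∣q∣ ((expTerm p i - expTerm q i) * p) (expTerm q i * (p - q))) ⟩
  (∣ (expTerm p i - expTerm q i) * p ∣ + ∣ expTerm q i * (p - q) ∣) * inv i
    ≡⟨ cong (_* inv i) (cong₂ _+_ (∣p*q∣≡∣p∣*∣q∣ (expTerm p i - expTerm q i) p) (∣p*q∣≡∣p∣*∣q∣ (expTerm q i) (p - q))) ⟩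
  (∣ expTerm p i - expTerm q i ∣ * ∣ p ∣ + ∣ expTerm q i ∣ * ∣ p - q ∣) * inv i
    ≤⟨ *-monoʳ-≤-nonNeg (inv i) (+-mono-≤ (first i)
         (*-monoʳ-≤-nonNeg ∣ p - q ∣ {{∣-∣-nonNeg (p - q)}} (∣expTerm∣ 0≤r q≤r i))) ⟩
  (∣ p - q ∣ * (fromℕ i * expTerm r i) + expTerm r i * ∣ p - q ∣) * inv i
    ≡⟨ solve 4 (λ d n t v → (d :* (n :* t) :+ t :* d) :* v := d :* t :* (v :* (n :+ con 1ℚ))) refl
         ∣ p - q ∣ (fromℕ i) (expTerm r i) (inv i) ⟩
  ∣ p - q ∣ * expTerm r i * (inv i * (fromℕ i + 1ℚ))
    ≡⟨ cong (∣ p - q ∣ * expTerm r i *_) (trans (cong (inv i *_) (fromℕ-suc i)) (inv*suc i)) ⟩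
  ∣ p - q ∣ * expTerm r i * 1ℚ
    ≡⟨ *-identityʳ (∣ p - q ∣ * expTerm r i) ⟩
  ∣ p - q ∣ * expTerm r i ∎
  where
  open ≤-Reasoning
  D : ℚ
  D = (expTerm p i - expTerm q i) * p + expTerm q i * (p - q)
  first : ∀ i → ∣ expTerm p i - expTerm q i ∣ * ∣ p ∣ ≤ ∣ p - q ∣ * (fromℕ i * expTerm r i)
  first zero = ≤-reflexive (trans (*-zeroˡ ∣ p ∣)
    (sym (solve 1 (λ d → d :* (con 0ℚ :* con 1ℚ) := con 0ℚ) refl ∣ p - q ∣)))
  first (suc i) = ≤-trans
    (*-mono-≤ (0≤∣p∣ p) (0≤* (0≤∣p∣ (p - q)) (0≤expTerm 0≤r i))
      (∣expTerm-lip∣ 0≤r p≤r q≤r i) p≤r)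
    (≤-reflexive (trans (*-assoc ∣ p - q ∣ (expTerm r i) r)
      (cong (∣ p - q ∣ *_) (trans (sym (expTerm-suc r i)) (*-comm (expTerm r (suc i)) (fromℕ (suc i)))))))

∣expSum-lip∣ : ∀ {p q r} → 0ℚ ≤ r → ∣ p ∣ ≤ r → ∣ q ∣ ≤ r → ∀ n →
  ∣ expSum p n - expSum q n ∣ ≤ ∣ p - q ∣ * expSum r n
∣expSum-lip∣ {p} {q} {r} 0≤r p≤r q≤r zero = 0≤* (0≤∣p∣ (p - q)) (0≤expTerm 0≤r 0)
∣expSum-lip∣ {p} {q} {r} 0≤r p≤r q≤r (suc n) = ≤-trans (shifted n)
  (*-monoˡ-≤-nonNeg ∣ p - q ∣ {{∣-∣-nonNeg (p - q)}}
    (≤+ʳ (expSum r n) (0≤expTerm 0≤r (suc n))))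
  where
  open ≤-Reasoning
  shifted : ∀ n → ∣ expSum p (suc n) - expSum q (suc n) ∣ ≤ ∣ p - q ∣ * expSum r n
  step : ∀ n {a b e} → ∣ a - b ∣ ≤ ∣ p - q ∣ * e →
    ∣ (a + expTerm p (suc n)) - (b + expTerm q (suc n)) ∣ ≤ ∣ p - q ∣ * (e + expTerm r n)
  step n {a} {b} {e} h = begin
    ∣ (a + expTerm p (suc n)) - (b + expTerm q (suc n)) ∣
      ≡⟨ cong ∣_∣ (solve 4 (λ a b c d → (a :+ b) :- (c :+ d) := (a :- c) :+ (b :- d)) refl
           a (expTerm p (suc n)) b (expTerm q (suc n))) ⟩
    ∣ (a - b) + (expTerm p (suc n) - expTerm q (suc n)) ∣
      ≤⟨ ∣p+q∣≤∣p∣+∣q∣ (a - b) (expTerm p (suc n) - expTerm q (suc n)) ⟩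
    ∣ a - b ∣ + ∣ expTerm p (suc n) - expTerm q (suc n) ∣
      ≤⟨ +-mono-≤ h (∣expTerm-lip∣ 0≤r p≤r q≤r n) ⟩
    ∣ p - q ∣ * e + ∣ p - q ∣ * expTerm r n
      ≡⟨ *-distribˡ-+ ∣ p - q ∣ e (expTerm r n) ⟨
    ∣ p - q ∣ * (e + expTerm r n) ∎
  shifted zero = subst (λ z → ∣ expSum p 1 - expSum q 1 ∣ ≤ ∣ p - q ∣ * z) (+-identityˡ 1ℚ)
    (step 0 {1ℚ} {1ℚ} {0ℚ} (≤-reflexive (sym (*-zeroʳ ∣ p - q ∣))))
  shifted (suc n) = step (suc n) {expSum p (suc n)} {expSum q (suc n)} {expSum r n} (shifted n)

module _ (M : ℕ) where
  private
    r : ℚ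
    r = fromℕ (suc M)
    0≤r = 0≤fromℕ (suc M)

  -- From index N₀ ≥ 2r on, consecutive terms of the series for exp r at least halve.
  N₀ : ℕ
  N₀ = proj₁ (≤-fromℕ (r + r))

  expTerm-halves : ∀ n → N₀ ℕ.≤ n → expTerm r (suc n) + expTerm r (suc n) ≤ expTerm r n
  expTerm-halves n N₀≤n = *-cancelʳ-≤-pos r (begin
    (expTerm r (suc n) + expTerm r (suc n)) * r
      ≡⟨ solve 2 (λ t r → (t :+ t) :* r := t :* (r :+ r)) refl (expTerm r (suc n)) r ⟩
    expTerm r (suc n) * (r + r)
      ≤⟨ *-monoˡ-≤-nonNeg (expTerm r (suc n)) {{nonNegative (0≤expTerm 0≤r (suc n))}}
           (≤-trans (proj₂ (≤-fromℕ (r + r))) (fromℕ-mono (ℕ.m≤n⇒m≤1+n N₀≤n))) ⟩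
    expTerm r (suc n) * fromℕ (suc n)
      ≡⟨ expTerm-suc r n ⟩
    expTerm r n * r ∎)
    where open ≤-Reasoning

  expSum+expTerm : ∀ n j → N₀ ℕ.≤ n →
    expSum r (j ℕ.+ n) + expTerm r (j ℕ.+ n) ≤ expSum r n + expTerm r n
  expSum+expTerm n zero    N₀≤n = ≤-refl
  expSum+expTerm n (suc j) N₀≤n = ≤-trans
    (subst (_≤ expSum r (j ℕ.+ n) + expTerm r (j ℕ.+ n))
      (sym (+-assoc (expSum r (j ℕ.+ n)) (expTerm r (suc (j ℕ.+ n))) (expTerm r (suc (j ℕ.+ n)))))
      (+-monoʳ-≤ (expSum r (j ℕ.+ n))
        (expTerm-halves (j ℕ.+ n) (ℕ.≤-trans N₀≤n (ℕ.m≤n+m n j)))))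
    (expSum+expTerm n j N₀≤n)

  expSum-tail≤expTerm : ∀ n j → N₀ ℕ.≤ n → expSum r (j ℕ.+ n) - expSum r n ≤ expTerm r n
  expSum-tail≤expTerm n j N₀≤n = begin
    expSum r (j ℕ.+ n) - expSum r n
      ≤⟨ +-monoˡ-≤ (- expSum r n) (≤-trans (≤+ʳ (expSum r (j ℕ.+ n)) (0≤expTerm 0≤r (j ℕ.+ n))) (expSum+expTerm n j N₀≤n)) ⟩
    (expSum r n + expTerm r n) - expSum r n
      ≡⟨ solve 2 (λ s t → (s :+ t) :- s := t) refl (expSum r n) (expTerm r n) ⟩
    expTerm r n ∎
    where open ≤-Reasoning

  expTerm-bound : ∀ j → expTerm r (j ℕ.+ N₀) ≤ expTerm r N₀
  expTerm-bound zero    = ≤-refl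
  expTerm-bound (suc j) = ≤-trans (≤+ʳ (expTerm r (suc j ℕ.+ N₀)) (0≤expTerm 0≤r (suc j ℕ.+ N₀)))
    (≤-trans (expTerm-halves (j ℕ.+ N₀) (ℕ.m≤n+m N₀ j)) (expTerm-bound j))

  expSum-bound : ∀ n → N₀ ℕ.≤ n → expSum r n ≤ expSum r N₀ + expTerm r N₀
  expSum-bound n N₀≤n = ≤-trans (≤+ʳ (expSum r n) (0≤expTerm 0≤r n))
    (subst (λ m → expSum r m + expTerm r m ≤ expSum r N₀ + expTerm r N₀)
      (ℕ.m∸n+n≡m N₀≤n) (expSum+expTerm N₀ (n ℕ.∸ N₀) ℕ.≤-refl))

  expTerm-small : ∀ δ → 0ℚ < δ → ∃[ N ] (∀ n → N ℕ.≤ n → expTerm r n ≤ δ)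
  expTerm-small δ 0<δ = suc (N₀ ℕ.⊔ A) , small
    where
    open ≤-Reasoning
    C = expTerm r N₀ * r
    A = proj₁ (archimedean C 0<δ)
    small : ∀ n → suc (N₀ ℕ.⊔ A) ℕ.≤ n → expTerm r n ≤ δ
    small (suc n) (ℕ.s≤s ≤n) = *-cancelʳ-≤-pos (fromℕ (suc n)) (begin
      expTerm r (suc n) * fromℕ (suc n)
        ≡⟨ expTerm-suc r n ⟩
      expTerm r n * r
        ≤⟨ *-monoʳ-≤-nonNeg r (subst (λ m → expTerm r m ≤ expTerm r N₀)
             (ℕ.m∸n+n≡m (ℕ.≤-trans (ℕ.m≤m⊔n N₀ A) ≤n)) (expTerm-bound (n ℕ.∸ N₀))) ⟩
      C
        ≤⟨ proj₂ (archimedean C 0<δ) ⟩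
      δ * fromℕ A
        ≤⟨ *-monoˡ-≤-nonNeg δ {{nonNegative (<⇒≤ 0<δ)}}
             (fromℕ-mono (ℕ.≤-trans (ℕ.m≤n⊔m N₀ A) (ℕ.m≤n⇒m≤1+n ≤n))) ⟩
      δ * fromℕ (suc n) ∎)

expSeq-cauchy : ∀ {s} → IsCauchy s → IsCauchy (λ n → expSum (s n) n)
expSeq-cauchy {s} c = cauchy-from {λ n → expSum (s n) n} base
  where
  M B L : ℕ
  M = proj₁ (eventually-bounded {s} c)
  B = proj₁ (proj₂ (eventually-bounded {s} c))
  bounded = proj₂ (proj₂ (eventually-bounded {s} c))
  r : ℚ
  r = fromℕ (suc M)
  0≤r = 0≤fromℕ (suc M)
  L = proj₁ (≤-fromℕ (expSum r (N₀ M) + expTerm r (N₀ M)))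
  expSum≤L : ∀ n → N₀ M ℕ.≤ n → expSum r n ≤ fromℕ (suc L)
  expSum≤L n N₀≤n = ≤-trans (expSum-bound M n N₀≤n)
    (≤-trans (proj₂ (≤-fromℕ (expSum r (N₀ M) + expTerm r (N₀ M)))) (fromℕ-mono (ℕ.n≤1+n L)))

  base : ∀ δ → 0ℚ < δ → ∃[ N ] (∀ m → N ℕ.≤ m → ∣ expSum (s m) m - expSum (s N) N ∣ ≤ δ)
  base δ 0<δ = N , close
    where
    open ≤-Reasoning
    0<δ½ : 0ℚ < δ * ½
    0<δ½ = 0<* 0<δ 0<½
    close-args = c (δ * ½ * inv L) (0<* 0<δ½ (0<inv L))
    N₁ = proj₁ close-args
    h₁ = proj₂ close-args
    N₂ = proj₁ (expTerm-small M (δ * ½) 0<δ½)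
    h₂ = proj₂ (expTerm-small M (δ * ½) 0<δ½)
    N : ℕ
    N = (B ℕ.⊔ N₀ M) ℕ.⊔ (N₁ ℕ.⊔ N₂)
    B≤N = ℕ.≤-trans (ℕ.m≤m⊔n B (N₀ M)) (ℕ.m≤m⊔n _ (N₁ ℕ.⊔ N₂))
    N₀≤N = ℕ.≤-trans (ℕ.m≤n⊔m B (N₀ M)) (ℕ.m≤m⊔n _ (N₁ ℕ.⊔ N₂))
    N₁≤N = ℕ.≤-trans (ℕ.m≤m⊔n N₁ N₂) (ℕ.m≤n⊔m (B ℕ.⊔ N₀ M) _)
    N₂≤N = ℕ.≤-trans (ℕ.m≤n⊔m N₁ N₂) (ℕ.m≤n⊔m (B ℕ.⊔ N₀ M) _)
    close : ∀ m → N ℕ.≤ m → ∣ expSum (s m) m - expSum (s N) N ∣ ≤ δ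
    close m N≤m = begin
      ∣ expSum (s m) m - expSum (s N) N ∣
        ≤⟨ ∣-∣-via (expSum (s m) m) (expSum (s N) m) (expSum (s N) N) ⟩
      ∣ expSum (s m) m - expSum (s N) m ∣ + ∣ expSum (s N) m - expSum (s N) N ∣
        ≤⟨ +-mono-≤ argument tail ⟩
      δ * ½ + δ * ½ ≡⟨ half δ ⟩
      δ ∎
      where
      argument : ∣ expSum (s m) m - expSum (s N) m ∣ ≤ δ * ½
      argument = begin
        ∣ expSum (s m) m - expSum (s N) m ∣
          ≤⟨ ∣expSum-lip∣ 0≤r (bounded m (ℕ.≤-trans B≤N N≤m)) (bounded N B≤N) m ⟩
        ∣ s m - s N ∣ * expSum r m
          ≤⟨ *-monoˡ-≤-nonNeg ∣ s m - s N ∣ {{∣-∣-nonNeg (s m - s N)}}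
               (expSum≤L m (ℕ.≤-trans N₀≤N N≤m)) ⟩
        ∣ s m - s N ∣ * fromℕ (suc L)
          ≡⟨ *-comm ∣ s m - s N ∣ (fromℕ (suc L)) ⟩
        fromℕ (suc L) * ∣ s m - s N ∣
          ≤⟨ ≤-÷suc L (h₁ m N (ℕ.≤-trans N₁≤N N≤m) N₁≤N) ⟩
        δ * ½ ∎
      tail : ∣ expSum (s N) m - expSum (s N) N ∣ ≤ δ * ½
      tail = subst (λ k → ∣ expSum (s N) k - expSum (s N) N ∣ ≤ δ * ½) (ℕ.m∸n+n≡m N≤m)
        (≤-trans (∣expSum-tail∣ 0≤r (bounded N B≤N) N (m ℕ.∸ N))
          (≤-trans (expSum-tail≤expTerm M N (m ℕ.∸ N) N₀≤N) (h₂ N N₂≤N)))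

exp : ℝ → ℝ
exp x = mkℝ (λ n → expSum (seq x n) n) (expSeq-cauchy {seq x} (cauchy x))

-- ln is the inverse of exp, so ℓ = ln x means exp ℓ = x.
_IsLogOf_ : ℝ → ℝ → Set
ℓ IsLogOf x = exp ℓ ≈ℝ x

-- log-exists below shows that every x ≥ 1 has a logarithm.  Its n-th
-- approximation is a multiple a of 1/n with expSum a n ≤ y < expSum (a + 1/n) n,
-- where y = max (xₙ, 1).

∣-∣-≤ : ∀ p q d → p ≤ q + d → q ≤ p + d → ∣ p - q ∣ ≤ d
∣-∣-≤ p q d p≤ q≤ = [ (λ e → subst (_≤ d) (sym e) (sub p q p≤))
                    , (λ e → subst (_≤ d) (sym (trans e (swap p q))) (sub q p q≤)) ]′
                    (∣p∣≡p∨∣p∣≡-p (p - q))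
  where
  swap : ∀ p q → - (p - q) ≡ q - p
  swap = solve 2 (λ p q → :- (p :- q) := q :- p) refl
  sub : ∀ p q → p ≤ q + d → p - q ≤ d
  sub p q h = subst (p - q ≤_) (solve 2 (λ q d → (q :+ d) :- q := d) refl q d)
    (+-monoˡ-≤ (- q) h)

p≤∣p∣ : ∀ p → p ≤ ∣ p ∣
p≤∣p∣ p = [ (λ 0≤p → ≤-reflexive (sym (0≤p⇒∣p∣≡p 0≤p))) , (λ p≤0 → ≤-trans p≤0 (0≤∣p∣ p)) ]′
  (≤-total 0ℚ p)

≤-from-∣-∣ : ∀ p q {d} → ∣ p - q ∣ ≤ d → p ≤ q + d
≤-from-∣-∣ p q {d} h = subst (_≤ q + d)
  (solve 2 (λ p q → q :+ (p :- q) := p) refl p q)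
  (+-monoʳ-≤ q (≤-trans (p≤∣p∣ (p - q)) h))

⊔1-cauchy : ∀ {s} → IsCauchy s → IsCauchy (λ n → s n ⊔ 1ℚ)
⊔1-cauchy {s} c δ 0<δ = proj₁ (c δ 0<δ) , λ m n N≤m N≤n →
  ∣-∣-≤ (s m ⊔ 1ℚ) (s n ⊔ 1ℚ) δ
    (bound (s m) (s n) (proj₂ (c δ 0<δ) m n N≤m N≤n))
    (bound (s n) (s m) (proj₂ (c δ 0<δ) n m N≤n N≤m))
  where
  bound : ∀ p q → ∣ p - q ∣ ≤ δ → p ⊔ 1ℚ ≤ q ⊔ 1ℚ + δ
  bound p q h = ⊔-lub
    (≤-trans (≤-from-∣-∣ p q h) (+-monoˡ-≤ δ (p≤p⊔q q 1ℚ)))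
    (≤-trans (≤+ʳ 1ℚ (<⇒≤ 0<δ)) (+-monoˡ-≤ δ (p≤q⊔p q 1ℚ)))

expTerm-mono : ∀ {p q} → 0ℚ ≤ p → p ≤ q → ∀ i → expTerm p i ≤ expTerm q i
expTerm-mono 0≤p p≤q zero = ≤-refl
expTerm-mono 0≤p p≤q (suc i) = *-monoʳ-≤-nonNeg (inv i)
  (*-mono-≤ 0≤p (0≤expTerm (≤-trans 0≤p p≤q) i) (expTerm-mono 0≤p p≤q i) p≤q)

expSum-expands : ∀ {p q} → 0ℚ ≤ p → p ≤ q → ∀ n →
  expSum p (suc n) + q ≤ expSum q (suc n) + p
expSum-expands {p} {q} 0≤p p≤q zero = ≤-reflexive
  (solve 2 (λ p q → (con 1ℚ :+ con 1ℚ :* p :* con 1ℚ) :+ q :=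
    (con 1ℚ :+ con 1ℚ :* q :* con 1ℚ) :+ p) refl p q)
expSum-expands {p} {q} 0≤p p≤q (suc n) = begin
  (expSum p (suc n) + expTerm p (suc (suc n))) + q
    ≡⟨ swap (expSum p (suc n)) (expTerm p (suc (suc n))) q ⟩
  (expSum p (suc n) + q) + expTerm p (suc (suc n))
    ≤⟨ +-mono-≤ (expSum-expands 0≤p p≤q n) (expTerm-mono 0≤p p≤q (suc (suc n))) ⟩
  (expSum q (suc n) + p) + expTerm q (suc (suc n))
    ≡⟨ swap (expSum q (suc n)) p (expTerm q (suc (suc n))) ⟩
  (expSum q (suc n) + expTerm q (suc (suc n))) + p ∎
  where
  open ≤-Reasoning
  swap : ∀ a b c → (a + b) + c ≡ (a + c) + b
  swap = solve 3 (λ a b c → (a :+ b) :+ c := (a :+ c) :+ b) refl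

expSum-0 : ∀ n → expSum 0ℚ n ≡ 1ℚ
expSum-0 zero    = refl
expSum-0 (suc n) = trans (cong (λ z → expSum 0ℚ n + z) term≡0) (trans (+-identityʳ (expSum 0ℚ n)) (expSum-0 n))
  where
  term≡0 : expTerm 0ℚ (suc n) ≡ 0ℚ
  term≡0 = trans (cong (_* inv n) (*-zeroʳ (expTerm 0ℚ n))) (*-zeroˡ (inv n))

≤expSum : ∀ {q} → 0ℚ ≤ q → ∀ n → 1ℚ + q ≤ expSum q (suc n)
≤expSum {q} 0≤q n = subst₂ _≤_ (cong (_+ q) (expSum-0 (suc n))) (+-identityʳ (expSum q (suc n)))
  (expSum-expands {0ℚ} {q} ≤-refl 0≤q n)

inv≤1 : ∀ n → inv n ≤ 1ℚ
inv≤1 n = subst₂ _≤_ (*-identityʳ (inv n)) (inv*suc n)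
  (*-monoˡ-≤-nonNeg (inv n) (fromℕ-mono (ℕ.s≤s (ℕ.z≤n {n}))))

inv-small : ∀ δ → 0ℚ < δ → ∃[ N ] (∀ n → N ℕ.≤ n → inv n ≤ δ)
inv-small δ 0<δ = A , λ n A≤n → *-cancelʳ-≤-pos (fromℕ (suc n))
  (≤-trans (≤-reflexive (inv*suc n)) (≤-trans (proj₂ (archimedean 1ℚ 0<δ))
    (*-monoˡ-≤-nonNeg δ {{nonNegative (<⇒≤ 0<δ)}} (fromℕ-mono (ℕ.m≤n⇒m≤1+n A≤n)))))
  where
  A : ℕ
  A = proj₁ (archimedean 1ℚ 0<δ)

expSum-uniform : ∀ M δ → 0ℚ < δ → ∃[ N ] (∀ m n q → N ℕ.≤ m → N ℕ.≤ n →
  ∣ q ∣ ≤ fromℕ (suc M) → expSum q m ≤ expSum q n + δ)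
expSum-uniform M δ 0<δ = N , close
  where
  open ≤-Reasoning
  0<δ½ : 0ℚ < δ * ½
  0<δ½ = 0<* 0<δ 0<½
  N₁ N : ℕ
  N₁ = proj₁ (expTerm-small M (δ * ½) 0<δ½)
  N = N₀ M ℕ.⊔ N₁
  base : ∀ m q → N ℕ.≤ m → ∣ q ∣ ≤ fromℕ (suc M) → ∣ expSum q m - expSum q N ∣ ≤ δ * ½
  base m q N≤m q≤r = subst (λ k → ∣ expSum q k - expSum q N ∣ ≤ δ * ½) (ℕ.m∸n+n≡m N≤m)
    (≤-trans (∣expSum-tail∣ (0≤fromℕ (suc M)) q≤r N (m ℕ.∸ N))
      (≤-trans (expSum-tail≤expTerm M N (m ℕ.∸ N) (ℕ.m≤m⊔n (N₀ M) N₁))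
        (proj₂ (expTerm-small M (δ * ½) 0<δ½) N (ℕ.m≤n⊔m (N₀ M) N₁))))
  close : ∀ m n q → N ℕ.≤ m → N ℕ.≤ n → ∣ q ∣ ≤ fromℕ (suc M) → expSum q m ≤ expSum q n + δ
  close m n q N≤m N≤n q≤r = ≤-from-∣-∣ (expSum q m) (expSum q n)
    (≤-trans (∣-∣-via (expSum q m) (expSum q N) (expSum q n))
      (subst (∣ expSum q m - expSum q N ∣ + ∣ expSum q N - expSum q n ∣ ≤_) (half δ)
        (+-mono-≤ (base m q N≤m q≤r)
          (subst (_≤ δ * ½) (∣-∣-swap (expSum q n) (expSum q N)) (base n q N≤n q≤r)))))

crossing : (f : ℕ → ℚ) (y : ℚ) → ∀ b → f 0 ≤ y → y < f b →
  ∃[ j ] (f j ≤ y × y < f (suc j))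
crossing f y zero    f0≤y y<fb = contradiction (<-≤-trans y<fb f0≤y) (<-irrefl refl)
crossing f y (suc b) f0≤y y<fb with f b ≤? y
... | yes fb≤y = b , fb≤y , y<fb
... | no  fb≰y = crossing f y b f0≤y (≰⇒> fb≰y)

module LogApproximation {s : ℕ → ℚ} (1≤s : ∀ n → 1ℚ ≤ s n) (s-cauchy : IsCauchy s) where

  grid : ℕ → ℕ → ℚ
  grid n j = inv n * fromℕ j

  0≤grid : ∀ n j → 0ℚ ≤ grid n j
  0≤grid n j = 0≤* (<⇒≤ (0<inv n)) (0≤fromℕ j)

  grid-suc : ∀ n j → grid n (suc j) ≡ grid n j + inv n
  grid-suc n j = trans (cong (inv n *_) (sym (fromℕ-suc j)))
    (trans (*-distribˡ-+ (inv n) (fromℕ j) 1ℚ) (cong (λ z → grid n j + z) (*-identityʳ (inv n))))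

  cross : ∀ n → ∃[ j ] (expSum (grid n j) (suc n) ≤ s (suc n) ×
                        s (suc n) < expSum (grid n (suc j)) (suc n))
  cross n = crossing (λ j → expSum (grid n j) (suc n)) (s (suc n)) b
    (subst (λ z → expSum z (suc n) ≤ s (suc n)) (sym (*-zeroʳ (inv n)))
      (subst (_≤ s (suc n)) (sym (expSum-0 (suc n))) (1≤s (suc n))))
    (<-≤-trans (≤-<-trans (proj₂ (archimedean (s (suc n)) (0<inv n)))
        (subst (_< 1ℚ + grid n b) (+-identityˡ (grid n b)) (+-monoˡ-< (grid n b) (positive⁻¹ 1ℚ))))
      (≤expSum (0≤grid n b) n))
    where
    b : ℕ
    b = proj₁ (archimedean (s (suc n)) (0<inv n))

  lower upper : ℕ → ℚ
  lower n = grid n (proj₁ (cross n))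
  upper n = grid n (suc (proj₁ (cross n)))

  logSeq : ℕ → ℚ
  logSeq zero    = 0ℚ
  logSeq (suc n) = lower n

  0≤lower : ∀ n → 0ℚ ≤ lower n
  0≤lower n = 0≤grid n (proj₁ (cross n))
  0≤upper : ∀ n → 0ℚ ≤ upper n
  0≤upper n = 0≤grid n (suc (proj₁ (cross n)))

  lower≤ : ∀ n → expSum (lower n) (suc n) ≤ s (suc n)
  lower≤ n = proj₁ (proj₂ (cross n))

  ≤upper : ∀ n → s (suc n) ≤ expSum (upper n) (suc n)
  ≤upper n = <⇒≤ (proj₂ (proj₂ (cross n)))

  upper≡ : ∀ n → upper n ≡ lower n + inv n
  upper≡ n = grid-suc n (proj₁ (cross n))

  M B : ℕ
  M = proj₁ (eventually-bounded {s} s-cauchy)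
  B = proj₁ (proj₂ (eventually-bounded {s} s-cauchy))
  s-bounded : ∀ n → B ℕ.≤ n → ∣ s n ∣ ≤ fromℕ (suc M)
  s-bounded = proj₂ (proj₂ (eventually-bounded {s} s-cauchy))

  lower-bounded : ∀ n → B ℕ.≤ suc n → lower n ≤ fromℕ (suc M)
  lower-bounded n B≤n = begin
    lower n                   ≡⟨ +-identityˡ (lower n) ⟨
    0ℚ + lower n              ≤⟨ +-monoˡ-≤ (lower n) (nonNegative⁻¹ 1ℚ) ⟩
    1ℚ + lower n              ≤⟨ ≤expSum (0≤lower n) n ⟩
    expSum (lower n) (suc n)  ≤⟨ lower≤ n ⟩
    s (suc n)                 ≤⟨ p≤∣p∣ (s (suc n)) ⟩
    ∣ s (suc n) ∣             ≤⟨ s-bounded (suc n) B≤n ⟩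
    fromℕ (suc M)             ∎
    where open ≤-Reasoning

  ∣lower∣ : ∀ n → B ℕ.≤ suc n → ∣ lower n ∣ ≤ fromℕ (suc (suc M))
  ∣lower∣ n B≤n = subst (_≤ fromℕ (suc (suc M))) (sym (0≤p⇒∣p∣≡p (0≤lower n)))
    (≤-trans (lower-bounded n B≤n) (fromℕ-mono (ℕ.n≤1+n (suc M))))

  ∣upper∣ : ∀ n → B ℕ.≤ suc n → ∣ upper n ∣ ≤ fromℕ (suc (suc M))
  ∣upper∣ n B≤n = subst (_≤ fromℕ (suc (suc M))) (sym (0≤p⇒∣p∣≡p (0≤upper n)))
    (subst₂ _≤_ (sym (upper≡ n)) (fromℕ-suc (suc M))
      (+-mono-≤ (lower-bounded n B≤n) (inv≤1 n)))

  logSeq-cauchy : IsCauchy logSeq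
  logSeq-cauchy δ 0<δ = suc N , close
    where
    open ≤-Reasoning
    η : ℚ
    η = δ * ½ * ½
    0<η : 0ℚ < η
    0<η = 0<* (0<* 0<δ 0<½) 0<½
    4η : η + η + (η + η) ≡ δ
    4η = trans (cong₂ _+_ (half (δ * ½)) (half (δ * ½))) (half δ)
    3η≤δ : η + η + η ≤ δ
    3η≤δ = subst (η + η + η ≤_) 4η (+-monoʳ-≤ (η + η) (≤+ʳ η (<⇒≤ 0<η)))
    N₁ N₂ N₃ N : ℕ
    N₁ = proj₁ (s-cauchy η 0<η)
    N₂ = proj₁ (expSum-uniform (suc M) η 0<η)
    N₃ = proj₁ (inv-small η 0<η)
    N = (B ℕ.⊔ N₁) ℕ.⊔ (N₂ ℕ.⊔ N₃)
    B≤N : B ℕ.≤ N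
    B≤N = ℕ.≤-trans (ℕ.m≤m⊔n B N₁) (ℕ.m≤m⊔n (B ℕ.⊔ N₁) (N₂ ℕ.⊔ N₃))
    N₁≤N : N₁ ℕ.≤ N
    N₁≤N = ℕ.≤-trans (ℕ.m≤n⊔m B N₁) (ℕ.m≤m⊔n (B ℕ.⊔ N₁) (N₂ ℕ.⊔ N₃))
    N₂≤N : N₂ ℕ.≤ N
    N₂≤N = ℕ.≤-trans (ℕ.m≤m⊔n N₂ N₃) (ℕ.m≤n⊔m (B ℕ.⊔ N₁) (N₂ ℕ.⊔ N₃))
    N₃≤N : N₃ ℕ.≤ N
    N₃≤N = ℕ.≤-trans (ℕ.m≤n⊔m N₂ N₃) (ℕ.m≤n⊔m (B ℕ.⊔ N₁) (N₂ ℕ.⊔ N₃))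
    one-sided : ∀ m n → N ℕ.≤ m → N ℕ.≤ n → lower m ≤ lower n + δ
    one-sided m n N≤m N≤n = [ small , large ]′ (≤-total (lower m) (upper n))
      where
      up : ∀ {K i} → K ℕ.≤ N → N ℕ.≤ i → K ℕ.≤ suc i
      up K≤N N≤i = ℕ.m≤n⇒m≤1+n (ℕ.≤-trans K≤N N≤i)
      inv≤η : inv n ≤ η
      inv≤η = proj₂ (inv-small η 0<η) n (ℕ.≤-trans N₃≤N N≤n)
      η≤δ : η ≤ δ
      η≤δ = ≤-trans (≤+ʳ η (<⇒≤ 0<η)) (≤-trans (≤+ʳ (η + η) (<⇒≤ 0<η)) 3η≤δ)
      small : lower m ≤ upper n → lower m ≤ lower n + δ
      small h = ≤-trans h (≤-trans (≤-reflexive (upper≡ n))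
        (+-monoʳ-≤ (lower n) (≤-trans inv≤η η≤δ)))
      cancel : ∀ {a b c} → c + a ≤ c + b → a ≤ b
      cancel {a} {b} {c} h = subst₂ _≤_ (drop c a) (drop c b) (+-monoʳ-≤ (- c) h)
        where
        drop : ∀ c a → - c + (c + a) ≡ a
        drop = solve 2 (λ c a → :- c :+ (c :+ a) := a) refl
      large : upper n ≤ lower m → lower m ≤ lower n + δ
      large h = cancel {lower m} {lower n + δ} {s (suc n)} (begin
        s (suc n) + lower m
          ≤⟨ +-monoˡ-≤ (lower m) (≤upper n) ⟩
        expSum (upper n) (suc n) + lower m
          ≤⟨ expSum-expands (0≤upper n) h n ⟩
        expSum (lower m) (suc n) + upper n
          ≤⟨ +-mono-≤
               (proj₂ (expSum-uniform (suc M) η 0<η) (suc n) (suc m) (lower m)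
                 (up N₂≤N N≤n) (up N₂≤N N≤m) (∣lower∣ m (up B≤N N≤m)))
               (≤-trans (≤-reflexive (upper≡ n)) (+-monoʳ-≤ (lower n) inv≤η)) ⟩
        (expSum (lower m) (suc m) + η) + (lower n + η)
          ≤⟨ +-monoˡ-≤ (lower n + η) (+-monoˡ-≤ η (≤-trans (lower≤ m)
               (≤-from-∣-∣ (s (suc m)) (s (suc n))
                 (proj₂ (s-cauchy η 0<η) (suc m) (suc n) (up N₁≤N N≤m) (up N₁≤N N≤n))))) ⟩
        ((s (suc n) + η) + η) + (lower n + η)
          ≡⟨ solve 3 (λ s e l → ((s :+ e) :+ e) :+ (l :+ e) := s :+ (l :+ (e :+ e :+ e))) refl
               (s (suc n)) η (lower n) ⟩
        s (suc n) + (lower n + (η + η + η))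
          ≤⟨ +-monoʳ-≤ (s (suc n)) (+-monoʳ-≤ (lower n) 3η≤δ) ⟩
        s (suc n) + (lower n + δ) ∎)
    close : ∀ m n → suc N ℕ.≤ m → suc N ℕ.≤ n → ∣ logSeq m - logSeq n ∣ ≤ δ
    close (suc m) (suc n) (ℕ.s≤s N≤m) (ℕ.s≤s N≤n) =
      ∣-∣-≤ (lower m) (lower n) δ (one-sided m n N≤m N≤n) (one-sided n m N≤n N≤m)

  log : ℝ
  log = mkℝ logSeq logSeq-cauchy

  exp-log≤ : exp log ≤ℝ mkℝ s s-cauchy
  exp-log≤ δ 0<δ = 1 , below
    where
    below : ∀ n → 1 ℕ.≤ n → expSum (logSeq n) n ≤ s n + δ
    below (suc n) _ = ≤-trans (lower≤ n) (≤+ʳ (s (suc n)) (<⇒≤ 0<δ))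

  ≤exp-log : mkℝ s s-cauchy ≤ℝ exp log
  ≤exp-log δ 0<δ = suc N , above
    where
    open ≤-Reasoning
    r : ℚ
    r = fromℕ (suc (suc M))
    L A N : ℕ
    L = proj₁ (≤-fromℕ (expSum r (N₀ (suc M)) + expTerm r (N₀ (suc M))))
    0<δ/L : 0ℚ < δ * inv L
    0<δ/L = 0<* 0<δ (0<inv L)
    A = proj₁ (inv-small (δ * inv L) 0<δ/L)
    N = (B ℕ.⊔ N₀ (suc M)) ℕ.⊔ A
    above : ∀ n → suc N ℕ.≤ n → s n ≤ expSum (logSeq n) n + δ
    above (suc n) (ℕ.s≤s N≤n) = ≤-trans (≤upper n)
      (≤-from-∣-∣ (expSum (upper n) (suc n)) (expSum (lower n) (suc n)) (begin
        ∣ expSum (upper n) (suc n) - expSum (lower n) (suc n) ∣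
          ≤⟨ ∣expSum-lip∣ (0≤fromℕ (suc (suc M))) (∣upper∣ n B≤) (∣lower∣ n B≤) (suc n) ⟩
        ∣ upper n - lower n ∣ * expSum r (suc n)
          ≡⟨ cong (_* expSum r (suc n)) gap ⟩
        inv n * expSum r (suc n)
          ≤⟨ *-monoˡ-≤-nonNeg (inv n) (≤-trans (expSum-bound (suc M) (suc n) N₀≤)
               (≤-trans (proj₂ (≤-fromℕ (expSum r (N₀ (suc M)) + expTerm r (N₀ (suc M)))))
                 (fromℕ-mono (ℕ.n≤1+n L)))) ⟩
        inv n * fromℕ (suc L)
          ≡⟨ *-comm (inv n) (fromℕ (suc L)) ⟩
        fromℕ (suc L) * inv n
          ≤⟨ ≤-÷suc L (proj₂ (inv-small (δ * inv L) 0<δ/L) n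
               (ℕ.≤-trans (ℕ.m≤n⊔m (B ℕ.⊔ N₀ (suc M)) A) N≤n)) ⟩
        δ ∎))
      where
      B≤ : B ℕ.≤ suc n
      B≤ = ℕ.m≤n⇒m≤1+n (ℕ.m⊔n≤o⇒m≤o B (N₀ (suc M)) (ℕ.m⊔n≤o⇒m≤o (B ℕ.⊔ N₀ (suc M)) A N≤n))
      N₀≤ : N₀ (suc M) ℕ.≤ suc n
      N₀≤ = ℕ.m≤n⇒m≤1+n (ℕ.m⊔n≤o⇒n≤o B (N₀ (suc M)) (ℕ.m⊔n≤o⇒m≤o (B ℕ.⊔ N₀ (suc M)) A N≤n))
      gap : ∣ upper n - lower n ∣ ≡ inv n
      gap = trans (cong (λ z → ∣ z - lower n ∣) (upper≡ n))
        (trans (cong ∣_∣ (solve 2 (λ l i → (l :+ i) :- l := i) refl (lower n) (inv n))) (∣inv∣ n))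

log-exists : ∀ x → fromℚ 1ℚ ≤ℝ x → ∃[ ℓ ] ℓ IsLogOf x
log-exists x 1≤x = log , exp-log≤x , x≤exp-log
  where
  open LogApproximation {λ n → seq x n ⊔ 1ℚ} (λ n → p≤q⊔p (seq x n) 1ℚ)
    (⊔1-cauchy {seq x} (cauchy x))
  exp-log≤x : exp log ≤ℝ x
  exp-log≤x δ 0<δ = N₁ ℕ.⊔ N₂ , λ n N≤n → ≤-trans
    (proj₂ (exp-log≤ (δ * ½) 0<δ½) n (ℕ.m⊔n≤o⇒m≤o N₁ N₂ N≤n))
    (≤-trans (+-monoˡ-≤ (δ * ½) (⊔-lub (≤+ʳ (seq x n) (<⇒≤ 0<δ½))
        (proj₂ (1≤x (δ * ½) 0<δ½) n (ℕ.m⊔n≤o⇒n≤o N₁ N₂ N≤n))))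
      (≤-reflexive (trans (+-assoc (seq x n) (δ * ½) (δ * ½)) (cong (λ z → seq x n + z) (half δ)))))
    where
    0<δ½ : 0ℚ < δ * ½
    0<δ½ = 0<* 0<δ 0<½
    N₁ N₂ : ℕ
    N₁ = proj₁ (exp-log≤ (δ * ½) 0<δ½)
    N₂ = proj₁ (1≤x (δ * ½) 0<δ½)
  x≤exp-log : x ≤ℝ exp log
  x≤exp-log δ 0<δ = proj₁ (≤exp-log δ 0<δ) , λ n N≤n →
    ≤-trans (p≤p⊔q (seq x n) 1ℚ) (proj₂ (≤exp-log δ 0<δ) n N≤n)

-- ε k → 0 as k → ∞; the two inequalities say ∣ε k∣ ≤ δ.
TendsToZero : (ℕ → ℝ) → Set
TendsToZero ε = ∀ δ → 0ℚ < δ →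
  ∃[ K ] (∀ k → K ℕ.≤ k → fromℚ (- δ) ≤ℝ ε k × ε k ≤ℝ fromℚ δ)

ℕ→ℝ : ℕ → ℝ
ℕ→ℝ n = fromℚ (fromℕ n)

{-# OPTIONS --safe #-}
module Submission where

-- Choose L with k < 2^L and call a difference d good if it has at most r prime
-- factors below 2^L, counted with multiplicity, where r is the mean number of such
-- factors, rounded up.  If a good d and some j ≤ k satisfy j d = m, then the
-- 2^L-smooth part of d is a product of at most r primes out of the at most r + L
-- primes below 2^L that divide m, and it determines j.  So m has at most
-- (r + L + 1)^r such representations.  If no progression with a good difference is
-- rainbow, counting monochromatic pairs in two ways therefore bounds the number of
-- colors, since by Markov's inequality at least one in r + 1 differences is good.
--
-- That mean is at most Σ 1/(p - 1) over the primes p < 2^L, hence at most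
-- (1 + o(1)) ln L: averaging Σ_{p ∣ d} ln p ≤ ln d over d ≤ n gives Mertens' bound
-- for Σ (ln p)/p, where only p ≤ n/M are used in order to keep the rounding errors in
-- ⌊n/p⌋ harmless without Chebyshev's estimate; then sum by parts.

open import Data.Nat.Base as ℕ using (ℕ; zero; suc; NonZero)
import Data.Nat.Properties as ℕ
open import Data.Product.Base using (_×_; _,_; ∃-syntax; proj₁; proj₂)
open import Data.Sum.Base using (inj₁; inj₂)
open import Function.Base using (id; _∘_)
open import Relation.Binary.PropositionalEquality
open import Relation.Nullary.Decidable.Core using (Dec; yes; no; ¬?)
open import Relation.Nullary.Negation.Core using (¬_; contradiction)
import Data.Rational.Base as ℚ

-- Why differences are restricted: if m is divisible by lcm(1, ..., k), then every j ≤ k gives a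
-- representation m = j d, so counting with all differences would yield only a bound of order k^3.
-- With r about ln ln k and L about ln k / ln 2, the bound (r + L + 1)^r is exp((1 + o(1)) (ln ln
-- k)^2). The constant 1 in this exponent is that of the bound on r, so no constant factor may be
-- lost in Mertens' estimate, whereas L and the density 1 / (r + 1) may lose such factors freely.
-- This is why ⌊log₂ p⌋ takes the place of ln p: it is constant on dyadic blocks, where 1/p is an
-- exact multiple of its weight, so summing by parts loses nothing. Reals are Cauchy sequences and
-- exp is given by partial sums. Hence ln ln k enters only through a rational lower bound, the
-- harmonic sum `h m` with m about log₂ k, and r and L are bounded in terms of the same `h m`. A
-- fixed M gives 1 + ε with a fixed ε > 0; a diagonal choice of M depending on k then sends ε to 0.

module DoubleCounting where
  open import Data.Nat.Base
  open import Data.Nat.Properties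
  open import Data.Nat.DivMod using (_/_; m/n*n≤m; m≡m%n+[m/n]*n; m%n<n)
  open import Data.Nat.Solver using (module +-*-Solver)
  open import Data.Fin.Base as Fin using (Fin; toℕ; fromℕ<)
  open import Data.Fin.Properties as Fin using (toℕ-injective; toℕ-fromℕ<; fromℕ<-toℕ; toℕ<n)
  open import Data.List.Base using (List; []; _∷_; length; filter; tabulate; allFin)
  open import Data.List.Properties using (filter-≐; length-tabulate)
  open import Relation.Binary.Definitions using (tri<; tri≈; tri>)
  open +-*-Solver using (solve; _:+_; _:*_; _:=_; con)
  open import Defs using (Coloring; classSize; Equinumerous; RainbowAP; ForcesRainbowAP)

  -- Finite sums and indicators.

  ∑ : ℕ → (ℕ → ℕ) → ℕ
  ∑ zero    f = 0
  ∑ (suc n) f = ∑ n f + f n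

  ∑-mono : ∀ n {f g} → (∀ i → i < n → f i ≤ g i) → ∑ n f ≤ ∑ n g
  ∑-mono zero    h = z≤n
  ∑-mono (suc n) h = +-mono-≤ (∑-mono n λ i i<n → h i (m<n⇒m<1+n i<n)) (h n (n<1+n n))

  ∑-cong : ∀ n {f g} → (∀ i → i < n → f i ≡ g i) → ∑ n f ≡ ∑ n g
  ∑-cong zero    h = refl
  ∑-cong (suc n) h = cong₂ _+_ (∑-cong n λ i i<n → h i (m<n⇒m<1+n i<n)) (h n (n<1+n n))

  ∑-const : ∀ n c → ∑ n (λ _ → c) ≡ n * c
  ∑-const zero    c = refl
  ∑-const (suc n) c = trans (cong (_+ c) (∑-const n c)) (+-comm (n * c) c)

  ∑-zero : ∀ n {f} → (∀ i → i < n → f i ≡ 0) → ∑ n f ≡ 0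
  ∑-zero n h = trans (∑-cong n h) (trans (∑-const n 0) (*-zeroʳ n))

  ∑-+ : ∀ n f g → ∑ n (λ i → f i + g i) ≡ ∑ n f + ∑ n g
  ∑-+ zero    f g = refl
  ∑-+ (suc n) f g = trans (cong (_+ (f n + g n)) (∑-+ n f g))
    (solve 4 (λ a b c d → (a :+ b) :+ (c :+ d) := (a :+ c) :+ (b :+ d)) refl (∑ n f) (∑ n g) (f n) (g n))

  ∑-*ˡ : ∀ n c f → ∑ n (λ i → c * f i) ≡ c * ∑ n f
  ∑-*ˡ zero    c f = sym (*-zeroʳ c)
  ∑-*ˡ (suc n) c f = trans (cong (_+ c * f n) (∑-*ˡ n c f)) (sym (*-distribˡ-+ c (∑ n f) (f n)))

  ∑-*ʳ : ∀ n c f → ∑ n (λ i → f i * c) ≡ ∑ n f * c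
  ∑-*ʳ n c f = trans (∑-cong n λ i _ → *-comm (f i) c) (trans (∑-*ˡ n c f) (*-comm c (∑ n f)))

  ∑-swap : ∀ m n (f : ℕ → ℕ → ℕ) → ∑ m (λ i → ∑ n (f i)) ≡ ∑ n (λ j → ∑ m (λ i → f i j))
  ∑-swap zero    n f = sym (∑-zero n λ _ _ → refl)
  ∑-swap (suc m) n f = trans (cong (_+ ∑ n (f m)) (∑-swap m n f))
    (sym (∑-+ n (λ j → ∑ m (λ i → f i j)) (f m)))

  ∑-suc : ∀ n f → ∑ (suc n) f ≡ f 0 + ∑ n (λ i → f (suc i))
  ∑-suc zero    f = +-comm 0 (f 0)
  ∑-suc (suc n) f = trans (cong (_+ f (suc n)) (∑-suc n f)) (+-assoc (f 0) _ _)

  term≤∑ : ∀ n f {i} → i < n → f i ≤ ∑ n f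
  term≤∑ (suc n) f {i} i<1+n with m≤n⇒m<n∨m≡n (s≤s⁻¹ i<1+n)
  ... | inj₁ i<n  = ≤-trans (term≤∑ n f i<n) (m≤m+n (∑ n f) (f n))
  ... | inj₂ refl = m≤n+m (f n) (∑ n f)

  ∑-shift : ∀ s n f → ∑ n (λ i → f (s + i)) ≤ ∑ (s + n) f
  ∑-shift zero    n f = ≤-refl
  ∑-shift (suc s) n f = ≤-trans (∑-shift s n (λ i → f (suc i)))
    (≤-trans (m≤n+m (∑ (s + n) (λ i → f (suc i))) (f 0)) (≤-reflexive (sym (∑-suc (s + n) f))))

  ∑-support : ∀ N n f → (∀ i → N ≤ i → f i ≡ 0) → ∑ n f ≤ ∑ N f
  ∑-support N zero    f h = z≤n
  ∑-support N (suc n) f h with <-≤-connex n N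
  ... | inj₁ n<N = extend n<N
    where
    extend : ∀ {m n} → m ≤ n → ∑ m f ≤ ∑ n f
    extend {m} {zero}  z≤n = z≤n
    extend {m} {suc n} m≤ with m≤n⇒m<n∨m≡n m≤
    ... | inj₁ m<  = ≤-trans (extend (s≤s⁻¹ m<)) (m≤m+n (∑ n f) (f n))
    ... | inj₂ refl = ≤-refl
  ... | inj₂ N≤n = ≤-trans (≤-reflexive (trans (cong (∑ n f +_) (h n N≤n)) (+-identityʳ (∑ n f))))
    (∑-support N n f h)

  ∑≤1 : ∀ n f → (∀ i → i < n → f i ≤ 1) →
    (∀ i j → i < n → j < n → f i ≢ 0 → f j ≢ 0 → i ≡ j) → ∑ n f ≤ 1
  ∑≤1 zero    f f≤1 unique = z≤n
  ∑≤1 (suc n) f f≤1 unique with f n ≟ 0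
  ... | yes fn≡0 = ≤-trans (≤-reflexive (trans (cong (∑ n f +_) fn≡0) (+-identityʳ (∑ n f))))
    (∑≤1 n f (λ i i<n → f≤1 i (m<n⇒m<1+n i<n))
      (λ i j i<n j<n → unique i j (m<n⇒m<1+n i<n) (m<n⇒m<1+n j<n)))
  ... | no fn≢0 = ≤-trans (≤-reflexive (cong (_+ f n) (∑-zero n below))) (f≤1 n (n<1+n n))
    where
    below : ∀ i → i < n → f i ≡ 0
    below i i<n with f i ≟ 0
    ... | yes fi≡0 = fi≡0
    ... | no  fi≢0 = contradiction (unique i n (m<n⇒m<1+n i<n) (n<1+n n) fi≢0 fn≢0) (<⇒≢ i<n)

  𝟏 : ∀ {P : Set} → Dec P → ℕ
  𝟏 (yes _) = 1
  𝟏 (no _)  = 0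

  𝟏≤1 : ∀ {P : Set} (P? : Dec P) → 𝟏 P? ≤ 1
  𝟏≤1 (yes _) = ≤-refl
  𝟏≤1 (no _)  = z≤n

  𝟏-yes : ∀ {P : Set} (P? : Dec P) → P → 𝟏 P? ≡ 1
  𝟏-yes (yes _) p = refl
  𝟏-yes (no ¬p) p = contradiction p ¬p

  𝟏-no : ∀ {P : Set} (P? : Dec P) → ¬ P → 𝟏 P? ≡ 0
  𝟏-no (yes p) ¬p = contradiction p ¬p
  𝟏-no (no _)  ¬p = refl

  𝟏≢0 : ∀ {P : Set} (P? : Dec P) → 𝟏 P? ≢ 0 → P
  𝟏≢0 (yes p) _  = p
  𝟏≢0 (no _)  ≢0 = contradiction refl ≢0

  𝟏-⇔ : ∀ {P Q : Set} (P? : Dec P) (Q? : Dec Q) → (P → Q) → (Q → P) → 𝟏 P? ≡ 𝟏 Q?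
  𝟏-⇔ (yes p) Q? f g = sym (𝟏-yes Q? (f p))
  𝟏-⇔ (no ¬p) Q? f g = sym (𝟏-no Q? λ q → ¬p (g q))

  -- Counting monochromatic pairs in two ways.

  module _ (κ : ℕ → ℕ) where

    agree : ℕ → ℕ → ℕ
    agree x m = 𝟏 (κ x ≟ κ (x + m))

    -- Pairs whose upper point lies beyond the end of the progression are counted too. This
    -- decouples i from j, so that the sum over i becomes a mere factor k, and vanishing of the sum
    -- still forces all terms to differ.
    collisions : ℕ → ℕ → ℕ → ℕ
    collisions k a D = ∑ k λ i → ∑ k λ j → agree (a + i * D) (suc j * D)

    -- `g` marks the good differences up to X, and `R` bounds the representations of an integer as j
    -- d with d good and j ≤ k. `κ` colors all of ℕ, so sums need no boundary conditions; `beyond`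
    -- removes the pairs that start outside [N].
    module _ (N n k X R : ℕ) (g : ℕ → ℕ)
      (beyond : ∀ x m → N ≤ x → κ x ≢ κ (x + suc m))
      (class≤ : ∀ x → x < N → ∀ Y → ∑ Y (λ y → 𝟏 (κ x ≟ κ y)) ≤ n)
      (reps≤ : ∀ m → ∑ X (λ d → ∑ k (λ j → g d * 𝟏 (suc j * suc d ≟ suc m))) ≤ R)
      where

      private
        total : ℕ → ℕ
        total m = ∑ N λ x → agree x m

      agree-shifted : ∀ A s m → ∑ A (λ a → agree (a + s) (suc m)) ≤ total (suc m)
      agree-shifted A s m = begin
        ∑ A (λ a → agree (a + s) (suc m))
          ≡⟨ ∑-cong A (λ a _ → cong (λ z → agree z (suc m)) (+-comm a s)) ⟩
        ∑ A (λ a → agree (s + a) (suc m))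
          ≤⟨ ∑-shift s A (λ x → agree x (suc m)) ⟩
        ∑ (s + A) (λ x → agree x (suc m))
          ≤⟨ ∑-support N (s + A) _ (λ x N≤x → 𝟏-no (κ x ≟ κ (x + suc m)) (beyond x m N≤x)) ⟩
        total (suc m) ∎
        where open ≤-Reasoning

      collisions-total : ∀ A d → ∑ A (λ a → collisions k a (suc d)) ≤
        k * ∑ k (λ j → total (suc j * suc d))
      collisions-total A d = begin
        ∑ A (λ a → ∑ k λ i → ∑ k λ j → agree (a + i * D) (suc j * D))
          ≡⟨ ∑-swap A k (λ a i → ∑ k λ j → agree (a + i * D) (suc j * D)) ⟩
        ∑ k (λ i → ∑ A λ a → ∑ k λ j → agree (a + i * D) (suc j * D))
          ≡⟨ ∑-cong k (λ i _ → ∑-swap A k (λ a j → agree (a + i * D) (suc j * D))) ⟩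
        ∑ k (λ i → ∑ k λ j → ∑ A λ a → agree (a + i * D) (suc j * D))
          ≤⟨ ∑-mono k (λ i _ → ∑-mono k (λ j _ → agree-shifted A (i * D) (d + j * D))) ⟩
        ∑ k (λ i → ∑ k λ j → total (suc j * D))
          ≡⟨ ∑-const k _ ⟩
        k * ∑ k (λ j → total (suc j * D)) ∎
        where
        open ≤-Reasoning
        D : ℕ
        D = suc d

      -- Introduces a sum over m with a single nonzero term, so that `local≤` can exchange the order
      -- of summation.
      agree≤ : ∀ x j d → j < k → d < X → agree x (suc j * suc d) ≤
        ∑ (k * X) (λ m → 𝟏 (suc j * suc d ≟ suc m) * agree x (suc m))
      agree≤ x j d j<k d<X = begin
        agree x (suc q)
          ≡⟨ *-identityˡ _ ⟨
        1 * agree x (suc q)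
          ≡⟨ cong (_* agree x (suc q)) (𝟏-yes (suc q ≟ suc q) refl) ⟨
        𝟏 (suc q ≟ suc q) * agree x (suc q)
          ≤⟨ term≤∑ (k * X) (λ m → 𝟏 (suc q ≟ suc m) * agree x (suc m)) (*-mono-≤ j<k d<X) ⟩
        ∑ (k * X) (λ m → 𝟏 (suc q ≟ suc m) * agree x (suc m)) ∎
        where
        open ≤-Reasoning
        q : ℕ
        q = d + j * suc d

      -- Group the pairs (d, j) by the distance (j + 1)(d + 1). Each distance arises at most R times
      -- from good d, and the distances at which the color of x recurs correspond to different
      -- members of its class.
      local≤ : ∀ x → x < N → ∑ X (λ d → ∑ k λ j → g d * agree x (suc j * suc d)) ≤ R * n
      local≤ x x<N = begin
        ∑ X (λ d → ∑ k λ j → g d * agree x (suc j * suc d))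
          ≤⟨ ∑-mono X (λ d d<X → ∑-mono k λ j j<k → *-monoʳ-≤ (g d) (agree≤ x j d j<k d<X)) ⟩
        ∑ X (λ d → ∑ k λ j → g d * ∑ Z (λ m → rep d j m * agree x (suc m)))
          ≡⟨ ∑-cong X (λ d _ → ∑-cong k λ j _ → trans (sym (∑-*ˡ Z (g d) _))
               (∑-cong Z λ m _ → sym (*-assoc (g d) (rep d j m) (agree x (suc m))))) ⟩
        ∑ X (λ d → ∑ k λ j → ∑ Z λ m → g d * rep d j m * agree x (suc m))
          ≡⟨ ∑-cong X (λ d _ → ∑-swap k Z (λ j m → g d * rep d j m * agree x (suc m))) ⟩
        ∑ X (λ d → ∑ Z λ m → ∑ k λ j → g d * rep d j m * agree x (suc m))
          ≡⟨ ∑-swap X Z (λ d m → ∑ k λ j → g d * rep d j m * agree x (suc m)) ⟩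
        ∑ Z (λ m → ∑ X λ d → ∑ k λ j → g d * rep d j m * agree x (suc m))
          ≡⟨ ∑-cong Z (λ m _ → trans
               (∑-cong X λ d _ → ∑-*ʳ k (agree x (suc m)) (λ j → g d * rep d j m))
               (∑-*ʳ X (agree x (suc m)) _)) ⟩
        ∑ Z (λ m → ∑ X (λ d → ∑ k λ j → g d * rep d j m) * agree x (suc m))
          ≤⟨ ∑-mono Z (λ m _ → *-monoˡ-≤ (agree x (suc m)) (reps≤ m)) ⟩
        ∑ Z (λ m → R * agree x (suc m))
          ≡⟨ ∑-*ˡ Z R (λ m → agree x (suc m)) ⟩
        R * ∑ Z (λ m → agree x (suc m))
          ≡⟨ cong (R *_) (∑-cong Z λ m _ → cong (λ z → 𝟏 (κ x ≟ κ z)) (+-suc x m)) ⟩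
        R * ∑ Z (λ m → 𝟏 (κ x ≟ κ (suc x + m)))
          ≤⟨ *-monoʳ-≤ R (≤-trans (∑-shift (suc x) Z (λ y → 𝟏 (κ x ≟ κ y))) (class≤ x x<N _)) ⟩
        R * n ∎
        where
        open ≤-Reasoning
        Z : ℕ
        Z = k * X
        rep : ℕ → ℕ → ℕ → ℕ
        rep d j m = 𝟏 (suc j * suc d ≟ suc m)

      -- Every progression with a good difference contributes at least 1 to the weighted number of
      -- collisions. Summed over the lower point x of the pair instead, that number is bounded by
      -- `local≤`, with a factor k for the position of x in the progression.
      double-count : ∀ A → (∀ a d → a < A → d < X → 1 ≤ collisions k a (suc d)) →
        A * ∑ X g ≤ k * (N * (R * n))
      double-count A collide = begin
        A * ∑ X g
          ≡⟨ ∑-const A (∑ X g) ⟨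
        ∑ A (λ a → ∑ X g)
          ≤⟨ ∑-mono A (λ a a<A → ∑-mono X λ d d<X → ≤-trans (≤-reflexive (sym (*-identityʳ (g d))))
               (*-monoʳ-≤ (g d) (collide a d a<A d<X))) ⟩
        ∑ A (λ a → ∑ X λ d → g d * collisions k a (suc d))
          ≡⟨ ∑-swap A X _ ⟩
        ∑ X (λ d → ∑ A λ a → g d * collisions k a (suc d))
          ≡⟨ ∑-cong X (λ d _ → ∑-*ˡ A (g d) _) ⟩
        ∑ X (λ d → g d * ∑ A λ a → collisions k a (suc d))
          ≤⟨ ∑-mono X (λ d _ → *-monoʳ-≤ (g d) (collisions-total A d)) ⟩
        ∑ X (λ d → g d * (k * ∑ k λ j → total (suc j * suc d)))
          ≡⟨ ∑-cong X (λ d _ → solve 3 (λ a b c → a :* (b :* c) := b :* (a :* c)) refl (g d) k _) ⟩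
        ∑ X (λ d → k * (g d * ∑ k λ j → total (suc j * suc d)))
          ≡⟨ ∑-*ˡ X k _ ⟩
        k * ∑ X (λ d → g d * ∑ k λ j → total (suc j * suc d))
          ≡⟨ cong (k *_) (∑-cong X λ d _ → trans (sym (∑-*ˡ k (g d) _))
               (∑-cong k λ j _ → sym (∑-*ˡ N (g d) _))) ⟩
        k * ∑ X (λ d → ∑ k λ j → ∑ N λ x → g d * agree x (suc j * suc d))
          ≡⟨ cong (k *_) (∑-cong X λ d _ → ∑-swap k N (λ j x → g d * agree x (suc j * suc d))) ⟩
        k * ∑ X (λ d → ∑ N λ x → ∑ k λ j → g d * agree x (suc j * suc d))
          ≡⟨ cong (k *_) (∑-swap X N (λ d x → ∑ k λ j → g d * agree x (suc j * suc d))) ⟩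
        k * ∑ N (λ x → ∑ X λ d → ∑ k λ j → g d * agree x (suc j * suc d))
          ≤⟨ *-monoʳ-≤ k (∑-mono N local≤) ⟩
        k * ∑ N (λ x → R * n)
          ≡⟨ cong (k *_) (∑-const N (R * n)) ⟩
        k * (N * (R * n)) ∎
        where open ≤-Reasoning

  -- Colorings of [N] and the number of colors that forces a rainbow progression.

  length-filter-∷ : ∀ {A : Set} {P : A → Set} (P? : ∀ x → Dec (P x)) x xs →
    length (filter P? (x ∷ xs)) ≡ 𝟏 (P? x) + length (filter P? xs)
  length-filter-∷ P? x xs with P? x
  ... | yes _ = refl
  ... | no _  = refl

  length-filter-tabulate : ∀ {A : Set} {P : A → Set} (P? : ∀ x → Dec (P x)) n (f : Fin n → A) (g : ℕ → ℕ) →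
    (∀ i → g (toℕ i) ≡ 𝟏 (P? (f i))) → length (filter P? (tabulate f)) ≡ ∑ n g
  length-filter-tabulate P? zero    f g h = refl
  length-filter-tabulate P? (suc n) f g h = trans (length-filter-∷ P? (f Fin.zero) (tabulate (f ∘ Fin.suc)))
    (trans (cong₂ _+_ (sym (h Fin.zero)) (length-filter-tabulate P? n (f ∘ Fin.suc) (g ∘ suc) (h ∘ Fin.suc)))
      (sym (∑-suc n g)))

  ∑-𝟏-≡ : ∀ t v → v < t → ∑ t (λ j → 𝟏 (v ≟ j)) ≡ 1
  ∑-𝟏-≡ t v v<t = ≤-antisym
    (∑≤1 t _ (λ j _ → 𝟏≤1 (v ≟ j)) (λ i j _ _ i≢ j≢ → trans (sym (𝟏≢0 (v ≟ i) i≢)) (𝟏≢0 (v ≟ j) j≢)))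
    (≤-trans (≤-reflexive (sym (𝟏-yes (v ≟ v) refl))) (term≤∑ t (λ j → 𝟏 (v ≟ j)) v<t))

  ∑-length-filter : ∀ {A : Set} t (v : A → ℕ) → (∀ x → v x < t) → ∀ xs →
    ∑ t (λ j → length (filter (λ x → v x ≟ j) xs)) ≡ length xs
  ∑-length-filter t v v<t []       = ∑-zero t λ _ _ → refl
  ∑-length-filter t v v<t (x ∷ xs) =
    trans (∑-cong t (λ j _ → length-filter-∷ (λ x → v x ≟ j) x xs))
      (trans (∑-+ t (λ j → 𝟏 (v x ≟ j)) _) (cong₂ _+_ (∑-𝟏-≡ t (v x) (v<t x)) (∑-length-filter t v v<t xs)))

  module _ {N t} (c : Coloring N t) where

    -- The colors of the integers ≥ N are chosen distinct from each other and from
    -- those in use, so that no pair leaving [N] is monochromatic.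
    color : ℕ → ℕ
    color x with x <? N
    ... | yes x<N = toℕ (c (fromℕ< x<N))
    ... | no  _   = t + x

    color-inside : ∀ i → color (toℕ i) ≡ toℕ (c i)
    color-inside i with toℕ i <? N
    ... | yes i<N = cong (toℕ ∘ c) (fromℕ<-toℕ i i<N)
    ... | no  i≮N = contradiction (toℕ<n i) i≮N

    color-outside : ∀ x → N ≤ x → color x ≡ t + x
    color-outside x N≤x with x <? N
    ... | yes x<N = contradiction x<N (≤⇒≯ N≤x)
    ... | no  _   = refl

    color-beyond : ∀ x m → N ≤ x → color x ≢ color (x + suc m)
    color-beyond x m N≤x eq = m≢1+m+n x (trans
      (+-cancelˡ-≡ t x (x + suc m) (trans (sym (color-outside x N≤x)) (trans eq
        (color-outside (x + suc m) (≤-trans N≤x (m≤m+n x (suc m)))))))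
      (+-suc x m))

    size : ℕ → ℕ
    size j = length (filter (λ x → toℕ (c x) ≟ j) (allFin N))

    classSize≡size : ∀ j → classSize c j ≡ size (toℕ j)
    classSize≡size j = cong length (filter-≐ (λ x → c x Fin.≟ j) (λ x → toℕ (c x) ≟ toℕ j)
      (cong toℕ , toℕ-injective) (allFin N))

    ∑-size : ∑ t size ≡ N
    ∑-size = trans (∑-length-filter t (toℕ ∘ c) (λ x → toℕ<n (c x)) (allFin N)) (length-tabulate id)

    class≤size : ∀ i Y → ∑ Y (λ y → 𝟏 (color (toℕ i) ≟ color y)) ≤ size (toℕ (c i))
    class≤size i Y = ≤-trans
      (∑-support N Y _ λ y N≤y → 𝟏-no (color (toℕ i) ≟ color y) λ eq →
        <⇒≢ (≤-trans (toℕ<n (c i)) (m≤m+n t y)) (trans (sym (color-inside i)) (trans eq (color-outside y N≤y))))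
      (≤-reflexive (sym (length-filter-tabulate (λ x → toℕ (c x) ≟ toℕ (c i)) N id _ λ y →
        𝟏-⇔ (color (toℕ i) ≟ color (toℕ y)) (toℕ (c y) ≟ toℕ (c i))
          (λ eq → trans (sym (color-inside y)) (trans (sym eq) (color-inside i)))
          (λ eq → trans (color-inside i) (trans (sym eq) (sym (color-inside y)))))))

  -- The t sizes are equal and add up to `t * n`; cancel t.
  equinumerous-size : ∀ t n (c : Coloring (t * n) t) → Equinumerous c → ∀ (j : Fin t) → size c (toℕ j) ≡ n
  equinumerous-size (suc t) n c eq j = *-cancelˡ-≡ (size c (toℕ j)) n (suc t) (begin
    suc t * size c (toℕ j)
      ≡⟨ ∑-const (suc t) _ ⟨
    ∑ (suc t) (λ _ → size c (toℕ j))
      ≡⟨ ∑-cong (suc t) (λ i i<t → trans (trans (sym (classSize≡size c j)) (trans (eq j (fromℕ< i<t)) (classSize≡size c (fromℕ< i<t))))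
           (cong (size c) (toℕ-fromℕ< i<t))) ⟩
    ∑ (suc t) (size c)
      ≡⟨ ∑-size c ⟩
    suc t * n ∎)
    where open ≡-Reasoning

  -- Equal colors at positions i < i′ would be counted in the summand with lower position i and j =
  -- i′ - i - 1.
  collisions≡0⇒rainbow : ∀ {N t} (c : Coloring N t) k a d → (∀ i → i < k → a + i * suc d < N) →
    collisions (color c) k a (suc d) ≡ 0 → RainbowAP c k
  collisions≡0⇒rainbow {N} {t} c k a d inside none = record
    { start        = suc a
    ; difference   = suc d
    ; difference≥1 = s≤s z≤n
    ; term         = term
    ; term-eq      = λ i → cong suc (toℕ-term i)
    ; rainbow      = λ {i} {i′} → injective i i′
    }
    where
    κ : ℕ → ℕ
    κ = color c
    term : Fin k → Fin N
    term i = fromℕ< (inside (toℕ i) (toℕ<n i))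
    toℕ-term : ∀ i → toℕ (term i) ≡ a + toℕ i * suc d
    toℕ-term i = toℕ-fromℕ< (inside (toℕ i) (toℕ<n i))
    κ-term : ∀ i → κ (a + toℕ i * suc d) ≡ toℕ (c (term i))
    κ-term i = trans (cong κ (sym (toℕ-term i))) (color-inside c (term i))
    distinct : ∀ i j → i < k → j < k → κ (a + i * suc d) ≢ κ (a + i * suc d + suc j * suc d)
    distinct i j i<k j<k eq = <⇒≢ (begin-strict
      0                                                    <⟨ n<1+n 0 ⟩
      1                                                    ≡⟨ 𝟏-yes (κ _ ≟ κ _) eq ⟨
      agree κ (a + i * suc d) (suc j * suc d)              ≤⟨ term≤∑ k (λ j → agree κ (a + i * suc d) (suc j * suc d)) j<k ⟩
      ∑ k (λ j → agree κ (a + i * suc d) (suc j * suc d))  ≤⟨ term≤∑ k (λ i → ∑ k λ j → agree κ (a + i * suc d) (suc j * suc d)) i<k ⟩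
      collisions κ k a (suc d)                             ∎) (sym none)
      where open ≤-Reasoning
    ordered : ∀ i i′ → toℕ i < toℕ i′ → c (term i) ≢ c (term i′)
    ordered i i′ i<i′ eq with m<n⇒∃[o]m+o≡n i<i′
      where
      m<n⇒∃[o]m+o≡n : ∀ {m n} → m < n → ∃[ o ] m + suc o ≡ n
      m<n⇒∃[o]m+o≡n {m} {n} m<n = n ∸ suc m , trans (+-suc m (n ∸ suc m)) (m+[n∸m]≡n m<n)
    ... | o , i+o≡i′ = distinct (toℕ i) o (toℕ<n i)
      (≤-<-trans (≤-trans (n≤1+n o) (≤-trans (m≤n+m (suc o) (toℕ i)) (≤-reflexive i+o≡i′))) (toℕ<n i′))
      (trans (κ-term i) (trans (cong toℕ eq) (trans (sym (κ-term i′)) (cong κ (begin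
        a + toℕ i′ * suc d                 ≡⟨ cong (λ z → a + z * suc d) i+o≡i′ ⟨
        a + (toℕ i + suc o) * suc d        ≡⟨ cong (a +_) (*-distribʳ-+ (suc d) (toℕ i) (suc o)) ⟩
        a + (toℕ i * suc d + suc o * suc d) ≡⟨ +-assoc a _ _ ⟨
        a + toℕ i * suc d + suc o * suc d  ∎)))))
      where open ≡-Reasoning
    injective : ∀ i i′ → c (term i) ≡ c (term i′) → i ≡ i′
    injective i i′ eq with <-cmp (toℕ i) (toℕ i′)
    ... | tri< i<i′ _ _ = contradiction eq (ordered i i′ i<i′)
    ... | tri≈ _ i≡i′ _ = toℕ-injective i≡i′
    ... | tri> _ _ i>i′ = contradiction (sym eq) (ordered i′ i i>i′)

  -- Whether some progression is free of collisions is decided by bounded search, so the argument by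
  -- contradiction is constructive.
  search : ∀ A X (f : ℕ → ℕ → ℕ) →
    Dec (∃[ a ] (a < A × ∃[ d ] (d < X × f a d ≡ 0)))
  search A X f = anyUpTo? (λ a → anyUpTo? (λ d → f a d ≟ 0) X) A

  module _ (k R s : ℕ) (g : ℕ → ℕ) .{{_ : NonZero k}}
    (reps≤ : ∀ X m → ∑ X (λ d → ∑ k (λ j → g d * 𝟏 (suc j * suc d ≟ suc m))) ≤ R)
    (dense : ∀ X → X ≤ s * ∑ X g)
    where

    -- The factor 4 comes from N < 2 k (X + 1) and from N ≤ 2 A. The summand 2 absorbs the rounding
    -- in X, which costs 2 k ≤ 2 k^2 n.
    forcing : ℕ
    forcing = k * k * (4 * (R * s) + 2)

    forces : ForcesRainbowAP k forcing
    forces n 1≤n c equi = conclude (search A X λ a d → collisions κ k a (suc d))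
      where
      κ : ℕ → ℕ
      κ = color c
      N X A : ℕ
      N = forcing * n
      instance
        _ : NonZero (2 * k)
        _ = m*n≢0 2 k
      -- With differences up to N / (2 k), at least half of [N] remains available as starting points
      -- of progressions that stay inside [N].
      X = N / (2 * k)
      A = N ∸ k * X
      2kX≤N : 2 * (k * X) ≤ N
      2kX≤N = ≤-trans (≤-reflexive (solve 2 (λ k x → con 2 :* (k :* x) := x :* (con 2 :* k)) refl k X))
        (m/n*n≤m N (2 * k))
      N<2k[1+X] : N < 2 * k * suc X
      N<2k[1+X] = begin-strict
        N                          ≡⟨ m≡m%n+[m/n]*n N (2 * k) ⟩
        _ + X * (2 * k)            <⟨ +-monoˡ-< (X * (2 * k)) (m%n<n N (2 * k)) ⟩
        2 * k + X * (2 * k)        ≡⟨ *-comm (suc X) (2 * k) ⟩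
        2 * k * suc X              ∎
        where open ≤-Reasoning
      N≤2A : N ≤ 2 * A
      N≤2A = +-cancelʳ-≤ (2 * (k * X)) N (2 * A) (begin
        N + 2 * (k * X)      ≤⟨ +-monoʳ-≤ N 2kX≤N ⟩
        N + N                ≡⟨ cong (N +_) (+-identityʳ N) ⟨
        2 * N                ≡⟨ cong (2 *_) (m∸n+n≡m (≤-trans (m≤n*m (k * X) 2) 2kX≤N)) ⟨
        2 * (A + k * X)      ≡⟨ *-distribˡ-+ 2 A (k * X) ⟩
        2 * A + 2 * (k * X)  ∎)
        where open ≤-Reasoning
      conclude : Dec (∃[ a ] (a < A × ∃[ d ] (d < X × collisions κ k a (suc d) ≡ 0))) → RainbowAP c k
      conclude (yes (a , a<A , d , d<X , none)) = collisions≡0⇒rainbow c k a d inside none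
        where
        inside : ∀ i → i < k → a + i * suc d < N
        inside i i<k = ≤-trans (+-mono-<-≤ a<A (*-mono-≤ (<⇒≤ i<k) d<X))
          (≤-reflexive (m∸n+n≡m (≤-trans (m≤n*m (k * X) 2) 2kX≤N)))
      conclude (no ∄) = contradiction N<N (n≮n N)
        where
        open ≤-Reasoning
        counted : A * ∑ X g ≤ k * (N * (R * n))
        counted = double-count κ N n k X R g (color-beyond c)
          (λ x x<N Y → ≤-trans (≤-reflexive (cong (λ z → ∑ Y λ y → 𝟏 (κ z ≟ κ y)) (sym (toℕ-fromℕ< x<N))))
            (≤-trans (class≤size c (fromℕ< x<N) Y) (≤-reflexive (equinumerous-size forcing n c equi (c (fromℕ< x<N))))))
          (reps≤ X) A
          (λ a d a<A d<X → n≢0⇒n>0 λ none → ∄ (a , a<A , d , d<X , none))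
        instance
          _ : NonZero n
          _ = >-nonZero 1≤n
          _ : NonZero forcing
          _ = m*n≢0 (k * k) (4 * (R * s) + 2) {{m*n≢0 k k}} {{>-nonZero (≤-trans (s≤s z≤n) (m≤n+m 2 (4 * (R * s))))}}
          _ : NonZero N
          _ = m*n≢0 forcing n
        X≤ : X ≤ 2 * (s * (k * (R * n)))
        X≤ = *-cancelˡ-≤ N (begin
          N * X
            ≤⟨ *-mono-≤ N≤2A (dense X) ⟩
          2 * A * (s * ∑ X g)
            ≡⟨ solve 3 (λ a s g → con 2 :* a :* (s :* g) := con 2 :* (s :* (a :* g))) refl A s (∑ X g) ⟩
          2 * (s * (A * ∑ X g))
            ≤⟨ *-monoʳ-≤ 2 (*-monoʳ-≤ s counted) ⟩
          2 * (s * (k * (N * (R * n))))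
            ≡⟨ solve 4 (λ s k N m → con 2 :* (s :* (k :* (N :* m))) := N :* (con 2 :* (s :* (k :* m)))) refl s k N (R * n) ⟩
          N * (2 * (s * (k * (R * n)))) ∎)
        N<N : N < N
        N<N = begin-strict
          N
            <⟨ N<2k[1+X] ⟩
          2 * k * suc X
            ≤⟨ *-monoʳ-≤ (2 * k) (s≤s X≤) ⟩
          2 * k * suc (2 * (s * (k * (R * n))))
            ≡⟨ solve 4 (λ k s R n → con 2 :* k :* (con 1 :+ con 2 :* (s :* (k :* (R :* n)))) :=
                 k :* k :* (con 4 :* (R :* s)) :* n :+ con 2 :* k) refl k s R n ⟩
          k * k * (4 * (R * s)) * n + 2 * k
            ≤⟨ +-monoʳ-≤ (k * k * (4 * (R * s)) * n) (≤-trans (*-monoʳ-≤ 2 (m≤m*n k (k * n) {{m*n≢0 k n}}))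
                 (≤-reflexive (solve 2 (λ k n → con 2 :* (k :* (k :* n)) := k :* k :* con 2 :* n) refl k n))) ⟩
          k * k * (4 * (R * s)) * n + k * k * 2 * n
            ≡⟨ solve 3 (λ k m n → k :* k :* m :* n :+ k :* k :* con 2 :* n := k :* k :* (m :+ con 2) :* n) refl k (4 * (R * s)) n ⟩
          N ∎

-- Prime factors, smooth parts and the number of representations.

module PrimeFactors where
  open import Data.Nat.Base
  open import Data.Nat.Properties
  open import Data.Nat.Coprimality as Coprimality using (prime⇒coprime; coprime-divisor)
  open import Data.Nat.Divisibility
  open import Data.Nat.ListAction using (sum; product)
  open import Data.Nat.ListAction.Properties using (∈⇒∣product)
  open import Data.Nat.Primality using (Prime; prime?; euclidsLemma; prime⇒nonTrivial; prime⇒nonZero)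
  open import Data.Nat.Primality.Factorisation using (module PrimeFactorisation; factorise; factors; factorisationHasAllPrimeFactors)
  open import Data.Nat.Solver using (module +-*-Solver)
  open import Data.List.Base using (List; []; _∷_; _++_; length; filter; map; cartesianProductWith)
  open import Data.List.Properties using (length-++; length-map; filter-accept; filter-reject; filter-none)
  open import Data.List.Membership.Propositional using (_∈_)
  open import Data.List.Membership.Propositional.Properties using (∈-filter⁺; ∈-++⁺ˡ; ∈-++⁺ʳ; ∈-cartesianProductWith⁺)
  open import Data.List.Relation.Unary.All as All using (All; []; _∷_)
  open import Data.List.Relation.Unary.All.Properties using (all-filter; filter⁺)
  open import Data.List.Relation.Unary.Any using (here; there)
  open PrimeFactorisation using (factorsPrime; isFactorisation)
  open +-*-Solver using (solve; _:+_; _:*_; _:=_; con)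
  open DoubleCounting

  product-partition : ∀ {P Q : ℕ → Set} (P? : ∀ x → Dec (P x)) (Q? : ∀ x → Dec (Q x)) →
    (∀ x → P x → ¬ Q x) → (∀ x → ¬ P x → Q x) → ∀ xs →
    product xs ≡ product (filter P? xs) * product (filter Q? xs)
  product-partition P? Q? P⇒¬Q ¬P⇒Q []       = refl
  product-partition P? Q? P⇒¬Q ¬P⇒Q (x ∷ xs) with P? x
  ... | yes p = trans (cong (x *_) (product-partition P? Q? P⇒¬Q ¬P⇒Q xs))
    (trans (sym (*-assoc x _ _)) (cong ((x * _) *_) (cong product (sym (filter-reject Q? (P⇒¬Q x p))))))
  ... | no ¬p = trans (cong (x *_) (product-partition P? Q? P⇒¬Q ¬P⇒Q xs))
    (trans (solve 3 (λ x a b → x :* (a :* b) := a :* (x :* b)) refl x (product (filter P? xs)) _)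
      (cong (product (filter P? xs) *_) (cong product (sym (filter-accept Q? (¬P⇒Q x ¬p))))))

  2^length≤product : ∀ {ps} → All Prime ps → 2 ^ length ps ≤ product ps
  2^length≤product []         = ≤-refl
  2^length≤product (pr ∷ prs) = *-mono-≤ (nonTrivial⇒n>1 _ {{prime⇒nonTrivial pr}}) (2^length≤product prs)

  -- The additional entry 1 pads products of fewer than r factors. Repetitions in the list are
  -- harmless, since its length serves as an upper bound.
  products : ℕ → List ℕ → List ℕ
  products zero    xs = 1 ∷ []
  products (suc r) xs = cartesianProductWith _*_ (1 ∷ xs) (products r xs)

  length-cartesianProductWith : ∀ (f : ℕ → ℕ → ℕ) xs ys →
    length (cartesianProductWith f xs ys) ≡ length xs * length ys
  length-cartesianProductWith f []       ys = refl
  length-cartesianProductWith f (x ∷ xs) ys = trans (length-++ (map (f x) ys))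
    (cong₂ _+_ (length-map (f x) ys) (length-cartesianProductWith f xs ys))

  length-products : ∀ r xs → length (products r xs) ≡ suc (length xs) ^ r
  length-products zero    xs = refl
  length-products (suc r) xs = trans (length-cartesianProductWith _*_ (1 ∷ xs) (products r xs))
    (cong (suc (length xs) *_) (length-products r xs))

  ∈-products : ∀ r xs {ys} → length ys ≤ r → All (_∈ xs) ys → product ys ∈ products r xs
  ∈-products zero    xs z≤n     []           = here refl
  ∈-products (suc r) xs z≤n     []           = ∈-cartesianProductWith⁺ _*_ {1 ∷ xs} {products r xs} {1} {1} (here refl) (∈-products r xs z≤n [])
  ∈-products (suc r) xs {y ∷ ys} (s≤s l) (y∈xs ∷ ys∈) = ∈-cartesianProductWith⁺ _*_ {1 ∷ xs} {products r xs} {y} {product ys} (there y∈xs) (∈-products r xs l ys∈)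

  ∑∑-zero : ∀ n k {f : ℕ → ℕ → ℕ} → (∀ d j → d < n → j < k → f d j ≡ 0) → ∑ n (λ d → ∑ k (f d)) ≡ 0
  ∑∑-zero n k h = ∑-zero n λ d d<n → ∑-zero k λ j j<k → h d j d<n j<k

  ∑≢0⇒∃ : ∀ n f → ∑ n f ≢ 0 → ∃[ i ] (i < n × f i ≢ 0)
  ∑≢0⇒∃ zero    f ≢0 = contradiction refl ≢0
  ∑≢0⇒∃ (suc n) f ≢0 with f n ≟ 0
  ... | no  fn≢0 = n , n<1+n n , fn≢0
  ... | yes fn≡0 with ∑≢0⇒∃ n f (λ eq → ≢0 (cong₂ _+_ eq fn≡0))
  ...   | i , i<n , fi≢0 = i , m<n⇒m<1+n i<n , fi≢0

  -- Pigeonhole for sums: the support of f injects into P through `code`. Induction on P splits off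
  -- the pairs coded by the head of P, of which there is at most one.
  ∑∑≤length : ∀ n k (P : List ℕ) (f : ℕ → ℕ → ℕ) (code : ℕ → ℕ) → (∀ d j → f d j ≤ 1) →
    (∀ d j → d < n → j < k → f d j ≢ 0 → code d ∈ P) →
    (∀ d j d′ j′ → d < n → j < k → d′ < n → j′ < k → f d j ≢ 0 → f d′ j′ ≢ 0 → code d ≡ code d′ → d ≡ d′ × j ≡ j′) →
    ∑ n (λ d → ∑ k (f d)) ≤ length P
  ∑∑≤length n k [] f code f≤1 code∈ unique = ≤-reflexive (∑∑-zero n k zero′)
    where
    zero′ : ∀ d j → d < n → j < k → f d j ≡ 0
    zero′ d j d<n j<k with f d j ≟ 0
    ... | yes f≡0 = f≡0
    ... | no  f≢0 with () ← code∈ d j d<n j<k f≢0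
  ∑∑≤length n k (s ∷ P) f code f≤1 code∈ unique = begin
    ∑ n (λ d → ∑ k (f d))
      ≡⟨ ∑-cong n (λ d _ → trans (∑-cong k λ j _ → split d j) (∑-+ k (λ j → f d j * hit d) (λ j → f d j * miss d))) ⟩
    ∑ n (λ d → ∑ k (λ j → f d j * hit d) + ∑ k (λ j → f d j * miss d))
      ≡⟨ ∑-+ n _ _ ⟩
    ∑ n (λ d → ∑ k λ j → f d j * hit d) + ∑ n (λ d → ∑ k λ j → f d j * miss d)
      ≤⟨ +-mono-≤ (∑≤1 n _ inner unique-outer)
           (∑∑≤length n k P (λ d j → f d j * miss d) code
             (λ d j → *-mono-≤ (f≤1 d j) (𝟏≤1 (¬? (code d ≟ s))))
             rest∈
             (λ d j d′ j′ a b a′ b′ h h′ → unique d j d′ j′ a b a′ b′ (≢0ˡ d j (miss d) h) (≢0ˡ d′ j′ (miss d′) h′))) ⟩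
    1 + length P ∎
    where
    open ≤-Reasoning
    hit miss : ℕ → ℕ
    hit d  = 𝟏 (code d ≟ s)
    miss d = 𝟏 (¬? (code d ≟ s))
    split : ∀ d j → f d j ≡ f d j * hit d + f d j * miss d
    split d j with code d ≟ s
    ... | yes _ = solve 1 (λ x → x := x :* con 1 :+ x :* con 0) refl (f d j)
    ... | no _  = solve 1 (λ x → x := x :* con 0 :+ x :* con 1) refl (f d j)
    ≢0ˡ : ∀ d j c → f d j * c ≢ 0 → f d j ≢ 0
    ≢0ˡ d j c h eq = h (cong (_* c) eq)
    ≢0ʳ : ∀ d j c → f d j * c ≢ 0 → c ≢ 0
    ≢0ʳ d j c h eq = h (trans (cong (f d j *_) eq) (*-zeroʳ (f d j)))
    code≡s : ∀ d j → f d j * hit d ≢ 0 → code d ≡ s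
    code≡s d j h = 𝟏≢0 (code d ≟ s) (≢0ʳ d j (hit d) h)
    same : ∀ d j d′ j′ → d < n → j < k → d′ < n → j′ < k → f d j * hit d ≢ 0 → f d′ j′ * hit d′ ≢ 0 → d ≡ d′ × j ≡ j′
    same d j d′ j′ a b a′ b′ h h′ = unique d j d′ j′ a b a′ b′ (≢0ˡ d j (hit d) h) (≢0ˡ d′ j′ (hit d′) h′)
      (trans (code≡s d j h) (sym (code≡s d′ j′ h′)))
    inner : ∀ d → d < n → ∑ k (λ j → f d j * hit d) ≤ 1
    inner d d<n = ∑≤1 k _ (λ j _ → *-mono-≤ (f≤1 d j) (𝟏≤1 (code d ≟ s)))
      (λ j j′ j<k j′<k h h′ → proj₂ (same d j d j′ d<n j<k d<n j′<k h h′))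
    unique-outer : ∀ d d′ → d < n → d′ < n → ∑ k (λ j → f d j * hit d) ≢ 0 → ∑ k (λ j → f d′ j * hit d′) ≢ 0 → d ≡ d′
    unique-outer d d′ d<n d′<n h h′ with ∑≢0⇒∃ k _ h | ∑≢0⇒∃ k _ h′
    ... | j , j<k , g | j′ , j′<k , g′ = proj₁ (same d j d′ j′ d<n j<k d′<n j′<k g g′)
    rest∈ : ∀ d j → d < n → j < k → f d j * miss d ≢ 0 → code d ∈ P
    rest∈ d j d<n j<k h with code∈ d j d<n j<k (≢0ˡ d j (miss d) h)
    ... | here eq  = contradiction eq (𝟏≢0 (¬? (code d ≟ s)) (≢0ʳ d j (miss d) h))
    ... | there c∈ = c∈

  abstract
    primeFactors : ℕ → List ℕ
    primeFactors d = factors (factorise (suc d))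

    product-primeFactors : ∀ d → product (primeFactors d) ≡ suc d
    product-primeFactors d = sym (isFactorisation (factorise (suc d)))

    primeFactors-prime : ∀ d → All Prime (primeFactors d)
    primeFactors-prime d = factorsPrime (factorise (suc d))

  ∣-product⇒∈ : ∀ {d p} → Prime p → p ∣ suc d → p ∈ primeFactors d
  ∣-product⇒∈ {d} {p} pr p∣ = factorisationHasAllPrimeFactors pr
    (subst (p ∣_) (sym (product-primeFactors d)) p∣) (primeFactors-prime d)

  -- A nonzero j below a prime is coprime to it, so the primes can be removed one at a time.
  coprime-product : ∀ {j m} ps → .{{NonZero j}} → All Prime ps → All (j <_) ps → j ∣ m * product ps → j ∣ m
  coprime-product {j} {m} []       []         []         j∣ = subst (j ∣_) (*-identityʳ m) j∣
  coprime-product {j} {m} (p ∷ ps) (pr ∷ prs) (j<p ∷ j<) j∣ = coprime-product ps prs j<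
    (coprime-divisor (Coprimality.sym (prime⇒coprime pr j<p))
      (subst (j ∣_) (solve 3 (λ m p q → m :* (p :* q) := p :* (m :* q)) refl m p (product ps)) j∣))

  -- Prime factors, smooth parts and so on are indexed by the predecessor: d stands for suc d.
  module Smooth (B : ℕ) where

    small large : ℕ → List ℕ
    small d = filter (_<? B) (primeFactors d)
    large d = filter (B ≤?_) (primeFactors d)

    smoothPart roughPart Ω : ℕ → ℕ
    smoothPart d = product (small d)
    roughPart d  = product (large d)
    Ω d          = length (small d)

    small-prime : ∀ d → All Prime (small d)
    small-prime d = filter⁺ (_<? B) (primeFactors-prime d)

    small< : ∀ d → All (_< B) (small d)
    small< d = all-filter (_<? B) (primeFactors d)

    smooth*rough : ∀ d → suc d ≡ smoothPart d * roughPart d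
    smooth*rough d = trans (sym (product-primeFactors d))
      (product-partition (_<? B) (B ≤?_) (λ x → <⇒≱) (λ x → ≮⇒≥) (primeFactors d))

    smoothPart≢0 : ∀ d → NonZero (smoothPart d)
    smoothPart≢0 d = m*n≢0⇒m≢0 (smoothPart d) {{subst NonZero (smooth*rough d) _}}

    ∈-small : ∀ {d p} → Prime p → p < B → p ∣ suc d → p ∈ small d
    ∈-small {d} pr p<B p∣ = ∈-filter⁺ (_<? B) (∣-product⇒∈ pr p∣) p<B

    ∣-rough : ∀ {j m d} → suc j < B → suc j ∣ m * roughPart d → suc j ∣ m
    ∣-rough {j} {m} {d} j<B = coprime-product (large d) (filter⁺ (B ≤?_) (primeFactors-prime d))
      (All.map (<-≤-trans j<B) (all-filter (B ≤?_) (primeFactors d)))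

    -- Cancelling the common smooth part leaves an equation between multiples of the rough parts.
    -- Both multipliers are below B, hence coprime to the rough parts, so they divide each other.
    same-smooth⇒≡ : ∀ {d j d′ j′} → suc j < B → suc j′ < B → suc j * suc d ≡ suc j′ * suc d′ →
      smoothPart d ≡ smoothPart d′ → d ≡ d′ × j ≡ j′
    same-smooth⇒≡ {d} {j} {d′} {j′} j<B j′<B eq s≡ =
      suc-injective (*-cancelˡ-≡ (suc d) (suc d′) (suc j) (trans eq (cong (_* suc d′) (sym j≡j′)))) ,
      suc-injective j≡j′
      where
      pull : ∀ j d → suc j * suc d ≡ smoothPart d * (suc j * roughPart d)
      pull j d = trans (cong (suc j *_) (smooth*rough d))
        (solve 3 (λ j s r → j :* (s :* r) := s :* (j :* r)) refl (suc j) (smoothPart d) (roughPart d))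
      rough-eq : suc j * roughPart d ≡ suc j′ * roughPart d′
      rough-eq = *-cancelˡ-≡ _ _ (smoothPart d) {{smoothPart≢0 d}}
        (trans (sym (pull j d)) (trans eq (trans (pull j′ d′) (cong (_* (suc j′ * roughPart d′)) (sym s≡)))))
      j≡j′ : suc j ≡ suc j′
      j≡j′ = ∣-antisym
        (∣-rough {d = d′} j<B (subst (suc j ∣_) rough-eq (m∣m*n (roughPart d))))
        (∣-rough {d = d} j′<B (subst (suc j′ ∣_) (sym rough-eq) (m∣m*n (roughPart d′))))

    module _ (r : ℕ) where

      fewFactors : ℕ → ℕ
      fewFactors d = 𝟏 (Ω d ≤? r)

      module _ (L : ℕ) (B≤2^L : B ≤ 2 ^ L) (k : ℕ) (k<B : k < B) where

        -- One representation, given by d₀ and j₀, already exhibits every prime below B that divides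
        -- the number represented: at most r of them come from d₀, and at most L from j₀, which
        -- stands for a number below 2^L. Hence the case distinction on whether there is a
        -- representation at all.
        reps≤ : ∀ X m → ∑ X (λ d → ∑ k (λ j → fewFactors d * 𝟏 (suc j * suc d ≟ suc m))) ≤ suc (r + L) ^ r
        reps≤ X m = decide (∑ X (λ d → ∑ k (f d)) ≟ 0)
          where
          open ≤-Reasoning
          f : ℕ → ℕ → ℕ
          f d j = fewFactors d * 𝟏 (suc j * suc d ≟ suc m)
          f≤1 : ∀ d j → f d j ≤ 1
          f≤1 d j = *-mono-≤ (𝟏≤1 (Ω d ≤? r)) (𝟏≤1 (suc j * suc d ≟ suc m))
          few : ∀ d j → f d j ≢ 0 → Ω d ≤ r
          few d j h = 𝟏≢0 (Ω d ≤? r) λ eq → h (cong (_* 𝟏 (suc j * suc d ≟ suc m)) eq)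
          eqn : ∀ d j → f d j ≢ 0 → suc j * suc d ≡ suc m
          eqn d j h = 𝟏≢0 (suc j * suc d ≟ suc m) λ eq → h (trans (cong (fewFactors d *_) eq) (*-zeroʳ (fewFactors d)))
          decide : Dec (∑ X (λ d → ∑ k (f d)) ≡ 0) → ∑ X (λ d → ∑ k (f d)) ≤ suc (r + L) ^ r
          decide (yes ≡0) = ≤-trans (≤-reflexive ≡0) z≤n
          decide (no ≢0) with ∑≢0⇒∃ X _ ≢0
          ... | d₀ , _ , ≢0′ with ∑≢0⇒∃ k (f d₀) ≢0′
          ...   | j₀ , j₀<k , f≢0 = begin
            ∑ X (λ d → ∑ k (f d))  ≤⟨ ∑∑≤length X k (products r F) f smoothPart f≤1 code∈ unique ⟩
            length (products r F)  ≡⟨ length-products r F ⟩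
            suc (length F) ^ r     ≤⟨ ^-monoˡ-≤ r (s≤s length-F) ⟩
            suc (r + L) ^ r        ∎
            where
            F : List ℕ
            F = small d₀ ++ primeFactors j₀
            length-factors : length (primeFactors j₀) ≤ L
            length-factors with length (primeFactors j₀) ≤? L
            ... | yes ≤L = ≤L
            ... | no  ≰L = contradiction (begin-strict
              suc j₀                          <⟨ ≤-<-trans j₀<k k<B ⟩
              B                               ≤⟨ B≤2^L ⟩
              2 ^ L                           ≤⟨ ^-monoʳ-≤ 2 (<⇒≤ (≰⇒> ≰L)) ⟩
              2 ^ length (primeFactors j₀)    ≤⟨ 2^length≤product (primeFactors-prime j₀) ⟩
              product (primeFactors j₀)       ≡⟨ product-primeFactors j₀ ⟩
              suc j₀                          ∎) (n≮n (suc j₀))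
            length-F : length F ≤ r + L
            length-F = ≤-trans (≤-reflexive (length-++ (small d₀))) (+-mono-≤ (few d₀ j₀ f≢0) length-factors)
            code∈ : ∀ d j → d < X → j < k → f d j ≢ 0 → smoothPart d ∈ products r F
            code∈ d j _ _ h = ∈-products r F (few d j h) (All.tabulate factor∈)
              where
              factor∈ : ∀ {p} → p ∈ small d → p ∈ F
              factor∈ {p} p∈ with euclidsLemma (suc j₀) (suc d₀) pr p∣
                where
                pr : Prime p
                pr = All.lookup (small-prime d) p∈
                p∣ : p ∣ suc j₀ * suc d₀
                p∣ = subst (p ∣_) (trans (eqn d j h) (sym (eqn d₀ j₀ f≢0)))
                  (∣-trans (∈⇒∣product p∈) (∣-trans (subst (smoothPart d ∣_) (sym (smooth*rough d)) (m∣m*n (roughPart d)))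
                    (n∣m*n (suc j))))
              ... | inj₁ p∣j₀ = ∈-++⁺ʳ (small d₀) (∣-product⇒∈ (All.lookup (small-prime d) p∈) p∣j₀)
              ... | inj₂ p∣d₀ = ∈-++⁺ˡ (∈-small (All.lookup (small-prime d) p∈) (All.lookup (small< d) p∈) p∣d₀)
            unique : ∀ d j d′ j′ → d < X → j < k → d′ < X → j′ < k → f d j ≢ 0 → f d′ j′ ≢ 0 →
              smoothPart d ≡ smoothPart d′ → d ≡ d′ × j ≡ j′
            unique d j d′ j′ _ j<k _ j′<k h h′ = same-smooth⇒≡ (≤-<-trans j<k k<B) (≤-<-trans j′<k k<B)
              (trans (eqn d j h) (sym (eqn d′ j′ h′)))

  -- Binary logarithms, multiples and averages over d.

  ∑-extend : ∀ {m n} f → m ≤ n → ∑ m f ≤ ∑ n f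
  ∑-extend {m} {n} f m≤n with m≤n⇒∃[o]m+o≡n m≤n
  ... | o , refl = prefix m o
    where
    prefix : ∀ m o → ∑ m f ≤ ∑ (m + o) f
    prefix m zero    = ≤-reflexive (cong (λ z → ∑ z f) (sym (+-identityʳ m)))
    prefix m (suc o) = ≤-trans (≤-trans (prefix m o) (m≤m+n (∑ (m + o) f) (f (m + o))))
      (≤-reflexive (cong (λ z → ∑ z f) (sym (+-suc m o))))

  multiplicity : ℕ → List ℕ → ℕ
  multiplicity p xs = length (filter (λ x → x ≟ p) xs)

  -- Turns a sum over the prime factors of one number into a sum over a fixed range of p, which can
  -- be exchanged with a sum over d.
  ∑-multiplicity : ∀ t (w : ℕ → ℕ) xs → All (_< t) xs → ∑ t (λ p → multiplicity p xs * w p) ≡ sum (map w xs)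
  ∑-multiplicity t w []       []           = ∑-zero t λ _ _ → refl
  ∑-multiplicity t w (x ∷ xs) (x<t ∷ xs<t) = begin
    ∑ t (λ p → multiplicity p (x ∷ xs) * w p)
      ≡⟨ ∑-cong t (λ p _ → trans (cong (_* w p) (length-filter-∷ (λ x → x ≟ p) x xs))
           (*-distribʳ-+ (w p) (𝟏 (x ≟ p)) (multiplicity p xs))) ⟩
    ∑ t (λ p → 𝟏 (x ≟ p) * w p + multiplicity p xs * w p)
      ≡⟨ ∑-+ t _ _ ⟩
    ∑ t (λ p → 𝟏 (x ≟ p) * w p) + ∑ t (λ p → multiplicity p xs * w p)
      ≡⟨ cong₂ _+_ (trans (∑-cong t λ p _ → diagonal p) (trans (∑-*ʳ t (w x) (λ p → 𝟏 (x ≟ p)))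
           (trans (cong (_* w x) (∑-𝟏-≡ t x x<t)) (*-identityˡ (w x)))))
           (∑-multiplicity t w xs xs<t) ⟩
    w x + sum (map w xs) ∎
    where
    open ≡-Reasoning
    diagonal : ∀ p → 𝟏 (x ≟ p) * w p ≡ 𝟏 (x ≟ p) * w x
    diagonal p with x ≟ p
    ... | yes refl = refl
    ... | no _     = refl

  sum-map-1 : ∀ (xs : List ℕ) → sum (map (λ _ → 1) xs) ≡ length xs
  sum-map-1 []       = refl
  sum-map-1 (x ∷ xs) = cong suc (sum-map-1 xs)

  ^-multiplicity∣product : ∀ p xs → p ^ multiplicity p xs ∣ product xs
  ^-multiplicity∣product p []       = ∣-refl
  ^-multiplicity∣product p (x ∷ xs) with x ≟ p | length-filter-∷ (λ x → x ≟ p) x xs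
  ... | yes refl | eq = subst (λ z → p ^ z ∣ p * product xs) (sym eq) (*-monoʳ-∣ p (^-multiplicity∣product p xs))
  ... | no _     | eq = subst (λ z → p ^ z ∣ x * product xs) (sym eq) (∣n⇒∣m*n x (^-multiplicity∣product p xs))

  1≤multiplicity : ∀ {p xs} → p ∈ xs → 1 ≤ multiplicity p xs
  1≤multiplicity {p} {x ∷ xs} (here refl) = ≤-trans
    (≤-trans (≤-reflexive (sym (𝟏-yes (x ≟ x) refl))) (m≤m+n (𝟏 (x ≟ x)) _))
    (≤-reflexive (sym (length-filter-∷ (λ y → y ≟ x) x xs)))
  1≤multiplicity {p} {x ∷ xs} (there p∈)  = ≤-trans (1≤multiplicity p∈)
    (≤-trans (m≤n+m (multiplicity p xs) (𝟏 (x ≟ p))) (≤-reflexive (sym (length-filter-∷ (λ y → y ≟ p) x xs))))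

  n<m^n : ∀ {m} n → 1 < m → n < m ^ n
  n<m^n zero    1<m = s≤s z≤n
  n<m^n {m} (suc n) 1<m = begin-strict
    suc n          ≤⟨ n<m^n n 1<m ⟩
    m ^ n          <⟨ m<m*n (m ^ n) m {{>-nonZero (≤-trans (s≤s z≤n) (n<m^n n 1<m))}} 1<m ⟩
    m ^ n * m      ≡⟨ *-comm (m ^ n) m ⟩
    m ^ suc n      ∎
    where open ≤-Reasoning

  log₂-bracket : ∀ n → ∃[ l ] (2 ^ l ≤ suc n × suc n < 2 ^ suc l)
  log₂-bracket zero    = 0 , s≤s z≤n , s≤s (s≤s z≤n)
  log₂-bracket (suc n) with log₂-bracket n
  ... | l , lo , hi with suc (suc n) <? 2 ^ suc l
  ...   | yes <2^ = l , m≤n⇒m≤1+n lo , <2^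
  ...   | no  ≮2^ = suc l , ≮⇒≥ ≮2^ , ≤-trans (s≤s hi)
    (≤-trans (+-monoˡ-≤ (2 ^ suc l) (m^n>0 2 (suc l))) (≤-reflexive (cong (2 ^ suc l +_) (sym (+-identityʳ (2 ^ suc l))))))

  -- Rounding down has two purposes: powers of two with these exponents multiply to at most the
  -- product of the primes, and the weight is constant on each [2^l, 2^(l+1)).
  lg : ℕ → ℕ
  lg zero    = 0
  lg (suc n) = proj₁ (log₂-bracket n)

  2^lg≤ : ∀ n .{{_ : NonZero n}} → 2 ^ lg n ≤ n
  2^lg≤ (suc n) = proj₁ (proj₂ (log₂-bracket n))

  <2^1+lg : ∀ n → n < 2 ^ suc (lg n)
  <2^1+lg zero    = s≤s z≤n
  <2^1+lg (suc n) = proj₂ (proj₂ (log₂-bracket n))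

  2^-cancel-≤ : ∀ {m n} → 2 ^ m < 2 ^ suc n → m ≤ n
  2^-cancel-≤ {m} {n} lt with m ≤? n
  ... | yes m≤n = m≤n
  ... | no  m≰n = contradiction (^-monoʳ-≤ 2 (≰⇒> m≰n)) (<⇒≱ lt)

  lg-unique : ∀ {n l} → 2 ^ l ≤ n → n < 2 ^ suc l → lg n ≡ l
  lg-unique {n} {l} lo hi = ≤-antisym
    (2^-cancel-≤ (≤-<-trans (2^lg≤ n {{>-nonZero (≤-trans (m^n>0 2 l) lo)}}) hi))
    (2^-cancel-≤ (≤-<-trans lo (<2^1+lg n)))

  2^sum-lg≤product : ∀ {ps} → All Prime ps → 2 ^ sum (map lg ps) ≤ product ps
  2^sum-lg≤product []                  = ≤-refl
  2^sum-lg≤product {p ∷ ps} (pr ∷ prs) = ≤-trans (≤-reflexive (^-distribˡ-+-* 2 (lg p) _))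
    (*-mono-≤ (2^lg≤ p {{prime⇒nonZero pr}}) (2^sum-lg≤product prs))

  -- This is ⌊X / q⌋, written as a count so that sums over d can be exchanged with sums over primes;
  -- `multiples-bracket` gives its value.
  multiples : ℕ → ℕ → ℕ
  multiples X q = ∑ X λ d → 𝟏 (q ∣? suc d)

  multiples-bracket : ∀ X q .{{_ : NonZero q}} → multiples X q * q ≤ X × X < suc (multiples X q) * q
  multiples-bracket zero    q = z≤n , >-nonZero⁻¹ (1 * q) {{m*n≢0 1 q}}
  multiples-bracket (suc X) q with multiples-bracket X q | q ∣? suc X
  ... | lo , hi | yes (divides c eq) =
    subst (_≤ suc X) (cong (_* q) (sym (+-comm M 1))) (≤-trans (*-monoˡ-≤ q M<c) (≤-reflexive (sym eq))) ,
    subst (suc X <_) (cong (λ z → suc z * q) (+-comm 1 M)) (≤-<-trans hi (m<n+m (suc M * q) (>-nonZero⁻¹ q)))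
    where
    M = multiples X q
    M<c : M < c
    M<c = *-cancelʳ-< q M c (≤-trans (s≤s lo) (≤-reflexive eq))
  ... | lo , hi | no ∤ =
    subst (_≤ suc X) (cong (_* q) (sym (+-identityʳ M))) (m≤n⇒m≤1+n lo) ,
    subst (λ z → suc X < suc z * q) (sym (+-identityʳ M)) (≤∧≢⇒< hi λ eq → ∤ (divides (suc M) eq))
    where
    M = multiples X q

  module _ (B : ℕ) where
    open Smooth B

    Ω≤ : ∀ X d → d < X → Ω d ≤ ∑ B (λ p → 𝟏 (prime? p) * ∑ X (λ a → 𝟏 (p ^ suc a ∣? suc d)))
    Ω≤ X d d<X = begin
      Ω d
        ≡⟨ sum-map-1 (small d) ⟨
      sum (map (λ _ → 1) (small d))
        ≡⟨ ∑-multiplicity B (λ _ → 1) (small d) (small< d) ⟨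
      ∑ B (λ p → multiplicity p (small d) * 1)
        ≤⟨ ∑-mono B (λ p _ → ≤-trans (≤-reflexive (*-identityʳ _)) (bound p)) ⟩
      ∑ B (λ p → 𝟏 (prime? p) * ∑ X (λ a → 𝟏 (p ^ suc a ∣? suc d))) ∎
      where
      open ≤-Reasoning
      bound : ∀ p → multiplicity p (small d) ≤ 𝟏 (prime? p) * ∑ X (λ a → 𝟏 (p ^ suc a ∣? suc d))
      bound p with prime? p
      ... | no ¬pr = ≤-reflexive (cong length (filter-none (λ x → x ≟ p)
        (All.map (λ pr eq → ¬pr (subst Prime eq pr)) (small-prime d))))
      ... | yes pr = begin
        v
          ≡⟨ trans (sym (*-identityʳ v)) (sym (∑-const v 1)) ⟩
        ∑ v (λ _ → 1)
          ≤⟨ ∑-mono v (λ a a<v → ≤-reflexive (sym (𝟏-yes (p ^ suc a ∣? suc d) (∣-trans (^-∣ a<v) p^v∣)))) ⟩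
        ∑ v (λ a → 𝟏 (p ^ suc a ∣? suc d))
          ≤⟨ ∑-extend _ v≤X ⟩
        ∑ X (λ a → 𝟏 (p ^ suc a ∣? suc d))
          ≡⟨ *-identityˡ _ ⟨
        1 * ∑ X (λ a → 𝟏 (p ^ suc a ∣? suc d)) ∎
        where
        v : ℕ
        v = multiplicity p (small d)
        p^v∣ : p ^ v ∣ suc d
        p^v∣ = ∣-trans (^-multiplicity∣product p (small d))
          (subst (smoothPart d ∣_) (sym (smooth*rough d)) (m∣m*n (roughPart d)))
        ^-∣ : ∀ {a v} → a ≤ v → p ^ a ∣ p ^ v
        ^-∣ {a} a≤v with m≤n⇒∃[o]m+o≡n a≤v
        ... | o , refl = subst (p ^ a ∣_) (sym (^-distribˡ-+-* p a o)) (m∣m*n (p ^ o))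
        -- Exponents up to X suffice, because v < p^v ≤ d + 1 ≤ X.
        v≤X : v ≤ X
        v≤X = ≤-trans (<⇒≤ (n<m^n v (nonTrivial⇒n>1 p {{prime⇒nonTrivial pr}}))) (≤-trans (∣⇒≤ p^v∣) d<X)

    ∑Ω≤ : ∀ X → ∑ X Ω ≤ ∑ B (λ p → 𝟏 (prime? p) * ∑ X (λ a → multiples X (p ^ suc a)))
    ∑Ω≤ X = begin
      ∑ X Ω
        ≤⟨ ∑-mono X (Ω≤ X) ⟩
      ∑ X (λ d → ∑ B λ p → 𝟏 (prime? p) * ∑ X (λ a → 𝟏 (p ^ suc a ∣? suc d)))
        ≡⟨ ∑-swap X B _ ⟩
      ∑ B (λ p → ∑ X λ d → 𝟏 (prime? p) * ∑ X (λ a → 𝟏 (p ^ suc a ∣? suc d)))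
        ≡⟨ ∑-cong B (λ p _ → trans (∑-*ˡ X (𝟏 (prime? p)) _)
             (cong (𝟏 (prime? p) *_) (∑-swap X X (λ d a → 𝟏 (p ^ suc a ∣? suc d))))) ⟩
      ∑ B (λ p → 𝟏 (prime? p) * ∑ X (λ a → multiples X (p ^ suc a))) ∎
      where open ≤-Reasoning

    -- After exponentiation to base 2, each prime contributes at most itself, and the small prime
    -- factors with multiplicity multiply to the smooth part, which is at most d + 1.
    ∑lg≤ : ∀ I d → suc d ≤ 2 ^ I → ∑ B (λ p → 𝟏 (prime? p) * lg p * 𝟏 (p ∣? suc d)) ≤ I
    ∑lg≤ I d d<2^I = 2^-cancel-≤ (≤-<-trans 2^≤ (^-monoʳ-< 2 (s≤s (s≤s z≤n)) (n<1+n I)))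
      where
      open ≤-Reasoning
      term : ∀ p → p < B → 𝟏 (prime? p) * lg p * 𝟏 (p ∣? suc d) ≤ multiplicity p (small d) * lg p
      term p p<B with prime? p | p ∣? suc d
      ... | no _   | _      = z≤n
      ... | yes pr | no _   = ≤-trans (≤-reflexive (*-zeroʳ (1 * lg p))) z≤n
      ... | yes pr | yes p∣ = ≤-trans (≤-reflexive (*-identityʳ (1 * lg p)))
        (*-monoˡ-≤ (lg p) (1≤multiplicity (∈-small pr p<B p∣)))
      2^≤ : 2 ^ ∑ B (λ p → 𝟏 (prime? p) * lg p * 𝟏 (p ∣? suc d)) ≤ 2 ^ I
      2^≤ = begin
        2 ^ ∑ B (λ p → 𝟏 (prime? p) * lg p * 𝟏 (p ∣? suc d))
          ≤⟨ ^-monoʳ-≤ 2 (≤-trans (∑-mono B term) (≤-reflexive (∑-multiplicity B lg (small d) (small< d)))) ⟩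
        2 ^ sum (map lg (small d))
          ≤⟨ 2^sum-lg≤product (small-prime d) ⟩
        smoothPart d
          ≤⟨ m≤m*n (smoothPart d) (roughPart d) {{m*n≢0⇒n≢0 (smoothPart d) {{subst NonZero (smooth*rough d) _}}}} ⟩
        smoothPart d * roughPart d
          ≡⟨ smooth*rough d ⟨
        suc d
          ≤⟨ d<2^I ⟩
        2 ^ I ∎

    ∑lg-multiples≤ : ∀ I n → n ≤ 2 ^ I → ∑ B (λ p → 𝟏 (prime? p) * lg p * multiples n p) ≤ n * I
    ∑lg-multiples≤ I n n≤2^I = begin
      ∑ B (λ p → 𝟏 (prime? p) * lg p * multiples n p)
        ≡⟨ ∑-cong B (λ p _ → sym (∑-*ˡ n (𝟏 (prime? p) * lg p) _)) ⟩
      ∑ B (λ p → ∑ n λ d → 𝟏 (prime? p) * lg p * 𝟏 (p ∣? suc d))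
        ≡⟨ ∑-swap B n (λ p d → 𝟏 (prime? p) * lg p * 𝟏 (p ∣? suc d)) ⟩
      ∑ n (λ d → ∑ B λ p → 𝟏 (prime? p) * lg p * 𝟏 (p ∣? suc d))
        ≤⟨ ∑-mono n (λ d d<n → ∑lg≤ I d (≤-trans d<n n≤2^I)) ⟩
      ∑ n (λ _ → I)
        ≡⟨ ∑-const n I ⟩
      n * I ∎
      where open ≤-Reasoning

    -- Markov's inequality without division. A bad d has Ω d ≥ r + 1, which gives a pointwise bound;
    -- after summation r X cancels.
    fewFactors-dense : ∀ r X → ∑ X Ω ≤ r * X → X ≤ suc r * ∑ X (fewFactors r)
    fewFactors-dense r X mean = +-cancelʳ-≤ (r * X) X (suc r * ∑ X (fewFactors r)) (begin
      X + r * X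
        ≡⟨ trans (*-comm (suc r) X) (sym (∑-const X (suc r))) ⟩
      ∑ X (λ _ → suc r)
        ≤⟨ ∑-mono X (λ d _ → pointwise d) ⟩
      ∑ X (λ d → suc r * fewFactors r d + Ω d)
        ≡⟨ trans (∑-+ X _ _) (cong (_+ ∑ X Ω) (∑-*ˡ X (suc r) (fewFactors r))) ⟩
      suc r * ∑ X (fewFactors r) + ∑ X Ω
        ≤⟨ +-monoʳ-≤ (suc r * ∑ X (fewFactors r)) mean ⟩
      suc r * ∑ X (fewFactors r) + r * X ∎)
      where
      open ≤-Reasoning
      pointwise : ∀ d → suc r ≤ suc r * fewFactors r d + Ω d
      pointwise d with Ω d ≤? r
      ... | yes _ = ≤-trans (≤-reflexive (sym (*-identityʳ (suc r)))) (m≤m+n (suc r * 1) (Ω d))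
      ... | no ≰r = ≤-trans (≰⇒> ≰r) (m≤n+m (Ω d) (suc r * 0))

-- Sums over primes and Mertens' estimate.

module Mertens where
  import Data.Integer.Base as ℤ
  import Data.Integer.Properties as ℤ
  open import Data.Nat.Primality using (prime?; prime⇒nonTrivial)
  open import Data.Rational.Base hiding (NonZero)
  open import Data.Rational.Properties
  open import Data.Rational.Solver using (module +-*-Solver)
  open +-*-Solver using (solve; _:+_; _:*_; _:-_; _:=_; con)
  open import Defs
  open DoubleCounting using (∑; 𝟏; forces)
  open PrimeFactors

  fromℕ-+ : ∀ m n → fromℕ (m ℕ.+ n) ≡ fromℕ m + fromℕ n
  fromℕ-+ zero    n = sym (+-identityˡ (fromℕ n))
  fromℕ-+ (suc m) n = begin
    fromℕ (suc (m ℕ.+ n))       ≡⟨ fromℕ-suc (m ℕ.+ n) ⟨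
    fromℕ (m ℕ.+ n) + 1ℚ        ≡⟨ cong (_+ 1ℚ) (fromℕ-+ m n) ⟩
    fromℕ m + fromℕ n + 1ℚ      ≡⟨ solve 2 (λ a b → a :+ b :+ con 1ℚ := (a :+ con 1ℚ) :+ b) refl (fromℕ m) (fromℕ n) ⟩
    fromℕ m + 1ℚ + fromℕ n      ≡⟨ cong (_+ fromℕ n) (fromℕ-suc m) ⟩
    fromℕ (suc m) + fromℕ n     ∎
    where open ≡-Reasoning

  fromℕ-* : ∀ m n → fromℕ (m ℕ.* n) ≡ fromℕ m * fromℕ n
  fromℕ-* zero    n = sym (*-zeroˡ (fromℕ n))
  fromℕ-* (suc m) n = begin
    fromℕ (n ℕ.+ m ℕ.* n)           ≡⟨ fromℕ-+ n (m ℕ.* n) ⟩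
    fromℕ n + fromℕ (m ℕ.* n)       ≡⟨ cong (fromℕ n +_) (fromℕ-* m n) ⟩
    fromℕ n + fromℕ m * fromℕ n     ≡⟨ solve 2 (λ a b → b :+ a :* b := (a :+ con 1ℚ) :* b) refl (fromℕ m) (fromℕ n) ⟩
    (fromℕ m + 1ℚ) * fromℕ n        ≡⟨ cong (_* fromℕ n) (fromℕ-suc m) ⟩
    fromℕ (suc m) * fromℕ n         ∎
    where open ≡-Reasoning

  fromℕ-cancel-≤ : ∀ {m n} → fromℕ m ≤ fromℕ n → m ℕ.≤ n
  fromℕ-cancel-≤ {m} {n} (*≤* h) = ℤ.drop‿+≤+ (subst₂ ℤ._≤_ (ℤ.*-identityʳ (ℤ.+ m)) (ℤ.*-identityʳ (ℤ.+ n)) h)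

  monoˡ : ∀ a {b c} → 0ℚ ≤ a → b ≤ c → a * b ≤ a * c
  monoˡ a 0≤a = *-monoˡ-≤-nonNeg a {{nonNegative 0≤a}}

  monoʳ : ∀ a {b c} → 0ℚ ≤ a → b ≤ c → b * a ≤ c * a
  monoʳ a 0≤a = *-monoʳ-≤-nonNeg a {{nonNegative 0≤a}}

  0<fromℕ : ∀ n .{{_ : NonZero n}} → 0ℚ < fromℕ n
  0<fromℕ (suc n) = positive⁻¹ (fromℕ (suc n))

  cancel-fromℕ : ∀ n .{{_ : NonZero n}} {a b} → fromℕ n * a ≤ fromℕ n * b → a ≤ b
  cancel-fromℕ n = *-cancelˡ-≤-pos (fromℕ n) {{positive (0<fromℕ n)}}

  ∑ℚ : ℕ → (ℕ → ℚ) → ℚ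
  ∑ℚ zero    f = 0ℚ
  ∑ℚ (suc n) f = ∑ℚ n f + f n

  ∑ℚ-mono : ∀ n {f g} → (∀ i → i ℕ.< n → f i ≤ g i) → ∑ℚ n f ≤ ∑ℚ n g
  ∑ℚ-mono zero    h = ≤-refl
  ∑ℚ-mono (suc n) h = +-mono-≤ (∑ℚ-mono n λ i i<n → h i (ℕ.m<n⇒m<1+n i<n)) (h n (ℕ.n<1+n n))

  ∑ℚ-*ˡ : ∀ n c f → ∑ℚ n (λ i → c * f i) ≡ c * ∑ℚ n f
  ∑ℚ-*ˡ zero    c f = sym (*-zeroʳ c)
  ∑ℚ-*ˡ (suc n) c f = trans (cong (_+ c * f n) (∑ℚ-*ˡ n c f)) (sym (*-distribˡ-+ c (∑ℚ n f) (f n)))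

  fromℕ-∑ : ∀ n f → fromℕ (∑ n f) ≡ ∑ℚ n (λ i → fromℕ (f i))
  fromℕ-∑ zero    f = refl
  fromℕ-∑ (suc n) f = trans (fromℕ-+ (∑ n f) (f n)) (cong (_+ fromℕ (f n)) (fromℕ-∑ n f))

  -- The default at 0 gives meaning to the terms 1/p and 1/(p - 1) at p = 0 and p = 1, where the
  -- prime indicator vanishes anyway.
  recip : ℕ → ℚ
  recip zero    = 0ℚ
  recip (suc n) = inv n

  0≤recip : ∀ n → 0ℚ ≤ recip n
  0≤recip zero    = ≤-refl
  0≤recip (suc n) = <⇒≤ (0<inv n)

  fromℕ*recip : ∀ n .{{_ : NonZero n}} → fromℕ n * recip n ≡ 1ℚ
  fromℕ*recip (suc n) = trans (*-comm (fromℕ (suc n)) (inv n)) (inv*suc n)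

  cancel-recip : ∀ n .{{_ : NonZero n}} a → fromℕ n * (a * recip n) ≡ a
  cancel-recip (suc n) a = cancel-inv n a

  ≤-recip : ∀ {a b} n .{{_ : NonZero n}} → fromℕ n * a ≤ b → a ≤ b * recip n
  ≤-recip {a} {b} n h = cancel-fromℕ n (≤-trans h (≤-reflexive (sym (cancel-recip n b))))

  recip-* : ∀ m n .{{_ : NonZero m}} .{{_ : NonZero n}} → recip (m ℕ.* n) ≡ recip m * recip n
  recip-* m n = begin
    recip (m ℕ.* n)
      ≡⟨ *-identityʳ _ ⟨
    recip (m ℕ.* n) * 1ℚ
      ≡⟨ cong (recip (m ℕ.* n) *_) (cong₂ _*_ (fromℕ*recip m) (fromℕ*recip n)) ⟨
    recip (m ℕ.* n) * ((fromℕ m * recip m) * (fromℕ n * recip n))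
      ≡⟨ solve 5 (λ r a b c d → r :* ((a :* b) :* (c :* d)) := ((a :* c) :* r) :* (b :* d)) refl
           (recip (m ℕ.* n)) (fromℕ m) (recip m) (fromℕ n) (recip n) ⟩
    ((fromℕ m * fromℕ n) * recip (m ℕ.* n)) * (recip m * recip n)
      ≡⟨ cong (_* (recip m * recip n)) (trans (cong (_* recip (m ℕ.* n)) (sym (fromℕ-* m n))) (fromℕ*recip (m ℕ.* n))) ⟩
    1ℚ * (recip m * recip n)
      ≡⟨ *-identityˡ _ ⟩
    recip m * recip n ∎
    where
    open ≡-Reasoning
    instance
      _ : NonZero (m ℕ.* n)
      _ = ℕ.m*n≢0 m n

  -- This identity drives the geometric series, the comparison of 1/(p - 1) with 1/p, and summation
  -- by parts.
  inv-step : ∀ n → inv n ≡ inv (suc n) + inv n * inv (suc n)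
  inv-step n = sym (begin
    inv (suc n) + inv n * inv (suc n)
      ≡⟨ cong (_+ inv n * inv (suc n)) (trans (sym (*-identityˡ (inv (suc n)))) (cong (_* inv (suc n)) (sym (inv*suc n)))) ⟩
    inv n * fromℕ (suc n) * inv (suc n) + inv n * inv (suc n)
      ≡⟨ solve 3 (λ a b c → a :* c :* b :+ a :* b := a :* (b :* (c :+ con 1ℚ))) refl (inv n) (inv (suc n)) (fromℕ (suc n)) ⟩
    inv n * (inv (suc n) * (fromℕ (suc n) + 1ℚ))
      ≡⟨ cong (inv n *_) (trans (cong (inv (suc n) *_) (fromℕ-suc (suc n))) (inv*suc (suc n))) ⟩
    inv n * 1ℚ
      ≡⟨ *-identityʳ (inv n) ⟩
    inv n ∎)
    where open ≡-Reasoning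

  prime : ℕ → ℕ
  prime p = 𝟏 (prime? p)

  primeℚ : ℕ → ℚ
  primeℚ p = fromℕ (prime p)

  multiples≤ : ∀ X q .{{_ : NonZero q}} → fromℕ (multiples X q) ≤ fromℕ X * recip q
  multiples≤ X q = ≤-recip q (subst (_≤ fromℕ X)
    (trans (fromℕ-* (multiples X q) q) (*-comm (fromℕ (multiples X q)) (fromℕ q)))
    (fromℕ-mono (proj₁ (multiples-bracket X q))))

  -- For q = p + 2, the partial sum together with the remainder q^(-n) / (q - 1) is exactly 1 / (q -
  -- 1).
  geometric : ∀ p n → ∑ℚ n (λ a → recip (suc (suc p) ℕ.^ suc a)) ≤ inv p
  geometric p n = ≤-trans (≤+ʳ _ (0≤* (0≤recip (q ℕ.^ n)) (<⇒≤ (0<inv p)))) (≤-reflexive (exact n))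
    where
    open ≡-Reasoning
    q : ℕ
    q = suc (suc p)
    exact : ∀ n → ∑ℚ n (λ a → recip (q ℕ.^ suc a)) + recip (q ℕ.^ n) * inv p ≡ inv p
    exact zero    = trans (+-identityˡ _) (*-identityˡ (inv p))
    exact (suc n) = begin
      ∑ℚ n f + f n + f n * inv p
        ≡⟨ cong (λ z → ∑ℚ n f + z + z * inv p) (recip-* q (q ℕ.^ n) {{_}} {{ℕ.m^n≢0 q n}}) ⟩
      ∑ℚ n f + inv (suc p) * R + inv (suc p) * R * inv p
        ≡⟨ solve 4 (λ s i r j → s :+ i :* r :+ i :* r :* j := s :+ r :* (i :+ j :* i)) refl (∑ℚ n f) (inv (suc p)) R (inv p) ⟩
      ∑ℚ n f + R * (inv (suc p) + inv p * inv (suc p))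
        ≡⟨ cong (λ z → ∑ℚ n f + R * z) (sym (inv-step p)) ⟩
      ∑ℚ n f + R * inv p
        ≡⟨ exact n ⟩
      inv p ∎
      where
      f : ℕ → ℚ
      f a = recip (q ℕ.^ suc a)
      R : ℚ
      R = recip (q ℕ.^ n)

  -- A power p^a divides a proportion p^(-a) of the integers, and summing over a ≥ 1 gives 1 / (p -
  -- 1). This is therefore the mean number of prime factors below B.
  meanΩ : ℕ → ℚ
  meanΩ B = ∑ℚ B (λ p → primeℚ p * recip (ℕ.pred p))

  primeSum logSum : ℕ → ℚ
  primeSum B = ∑ℚ B (λ p → primeℚ p * recip p)
  logSum B   = ∑ℚ B (λ p → fromℕ (prime p ℕ.* lg p) * recip p)

  ∑Ω≤meanΩ : ∀ B X → fromℕ (∑ X (Smooth.Ω B)) ≤ fromℕ X * meanΩ B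
  ∑Ω≤meanΩ B X = begin
    fromℕ (∑ X (Smooth.Ω B))
      ≤⟨ fromℕ-mono (∑Ω≤ B X) ⟩
    fromℕ (∑ B (λ p → prime p ℕ.* ∑ X (λ a → multiples X (p ℕ.^ suc a))))
      ≡⟨ fromℕ-∑ B _ ⟩
    ∑ℚ B (λ p → fromℕ (prime p ℕ.* ∑ X (λ a → multiples X (p ℕ.^ suc a))))
      ≤⟨ ∑ℚ-mono B (λ p _ → term p) ⟩
    ∑ℚ B (λ p → fromℕ X * (primeℚ p * recip (ℕ.pred p)))
      ≡⟨ ∑ℚ-*ˡ B (fromℕ X) _ ⟩
    fromℕ X * meanΩ B ∎
    where
    open ≤-Reasoning
    bound : ∀ p → fromℕ (∑ X (λ a → multiples X (suc (suc p) ℕ.^ suc a))) ≤ fromℕ X * inv p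
    bound p = begin
      fromℕ (∑ X (λ a → multiples X (q ℕ.^ suc a)))
        ≡⟨ fromℕ-∑ X _ ⟩
      ∑ℚ X (λ a → fromℕ (multiples X (q ℕ.^ suc a)))
        ≤⟨ ∑ℚ-mono X (λ a _ → multiples≤ X (q ℕ.^ suc a) {{ℕ.m^n≢0 q (suc a)}}) ⟩
      ∑ℚ X (λ a → fromℕ X * recip (q ℕ.^ suc a))
        ≡⟨ ∑ℚ-*ˡ X (fromℕ X) _ ⟩
      fromℕ X * ∑ℚ X (λ a → recip (q ℕ.^ suc a))
        ≤⟨ monoˡ (fromℕ X) (0≤fromℕ X) (geometric p X) ⟩
      fromℕ X * inv p ∎
      where
      q : ℕ
      q = suc (suc p)
    weighted : ∀ (π : ℕ) m {y} → π ≡ 1 → fromℕ m ≤ fromℕ X * y → fromℕ (π ℕ.* m) ≤ fromℕ X * (fromℕ π * y)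
    weighted .1 m {y} refl h = subst₂ _≤_ (cong fromℕ (sym (ℕ.*-identityˡ m)))
      (cong (fromℕ X *_) (sym (*-identityˡ y))) h
    term : ∀ p → fromℕ (prime p ℕ.* ∑ X (λ a → multiples X (p ℕ.^ suc a))) ≤ fromℕ X * (primeℚ p * recip (ℕ.pred p))
    term p with prime? p
    ... | no _ = ≤-reflexive (sym (trans (cong (fromℕ X *_) (*-zeroˡ (recip (ℕ.pred p)))) (*-zeroʳ (fromℕ X))))
    ... | yes pr with p | prime⇒nonTrivial pr
    ...   | suc (suc e) | _ = weighted 1 (∑ X (λ a → multiples X (suc (suc e) ℕ.^ suc a))) {inv e} refl (bound e)

  -- The differences 1/(p - 1) - 1/p over primes are dominated by those over all integers from 2 on,
  -- which telescope to at most 1. Keeping the rest `recip (suc n)` of the telescoping sum makes the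
  -- induction work.
  meanΩ≤primeSum+1 : ∀ B → 2 ℕ.≤ B → meanΩ B ≤ primeSum B + 1ℚ
  meanΩ≤primeSum+1 (suc zero) (ℕ.s≤s ())
  meanΩ≤primeSum+1 (suc (suc n)) _ = ≤-trans (≤+ʳ _ (0≤recip (suc n))) (telescope n)
    where
    open ≤-Reasoning
    step : ∀ m → primeℚ (suc (suc m)) * inv m + inv (suc m) ≤ inv m + primeℚ (suc (suc m)) * inv (suc m)
    step m with prime? (suc (suc m))
    ... | yes _ = ≤-reflexive (solve 2 (λ a b → con 1ℚ :* a :+ b := a :+ con 1ℚ :* b) refl (inv m) (inv (suc m)))
    ... | no _  = begin
      0ℚ * inv m + inv (suc m)            ≡⟨ solve 2 (λ a b → con 0ℚ :* a :+ b := b :+ con 0ℚ :* b) refl (inv m) (inv (suc m)) ⟩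
      inv (suc m) + 0ℚ * inv (suc m)      ≤⟨ +-monoˡ-≤ (0ℚ * inv (suc m)) (≤+ʳ (inv (suc m)) (0≤* (<⇒≤ (0<inv m)) (<⇒≤ (0<inv (suc m))))) ⟩
      inv (suc m) + inv m * inv (suc m) + 0ℚ * inv (suc m) ≡⟨ cong (_+ 0ℚ * inv (suc m)) (inv-step m) ⟨
      inv m + 0ℚ * inv (suc m)            ∎
    telescope : ∀ n → meanΩ (suc (suc n)) + recip (suc n) ≤ primeSum (suc (suc n)) + 1ℚ
    telescope zero    = ≤-refl
    telescope (suc n) = begin
      meanΩ m + primeℚ m * inv n + inv (suc n)
        ≡⟨ +-assoc (meanΩ m) _ _ ⟩
      meanΩ m + (primeℚ m * inv n + inv (suc n))
        ≤⟨ +-monoʳ-≤ (meanΩ m) (step n) ⟩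
      meanΩ m + (inv n + primeℚ m * inv (suc n))
        ≡⟨ +-assoc (meanΩ m) _ _ ⟨
      meanΩ m + inv n + primeℚ m * inv (suc n)
        ≤⟨ +-monoˡ-≤ (primeℚ m * inv (suc n)) (telescope n) ⟩
      primeSum m + 1ℚ + primeℚ m * inv (suc n)
        ≡⟨ solve 2 (λ a b → a :+ con 1ℚ :+ b := a :+ b :+ con 1ℚ) refl (primeSum m) (primeℚ m * inv (suc n)) ⟩
      primeSum m + primeℚ m * inv (suc n) + 1ℚ ∎
      where
      m : ℕ
      m = suc (suc n)

  H : ℕ → ℚ
  H n = ∑ℚ n inv

  ∑ℚ-block : ∀ c (f g : ℕ → ℚ) m o → (∀ p → m ℕ.≤ p → p ℕ.< m ℕ.+ o → f p ≡ c * g p) →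
    ∑ℚ (m ℕ.+ o) f + c * ∑ℚ m g ≡ ∑ℚ m f + c * ∑ℚ (m ℕ.+ o) g
  ∑ℚ-block c f g m zero    h = trans (cong (λ z → ∑ℚ z f + c * ∑ℚ m g) (ℕ.+-identityʳ m))
    (cong (λ z → ∑ℚ m f + c * ∑ℚ z g) (sym (ℕ.+-identityʳ m)))
  ∑ℚ-block c f g m (suc o) h = begin
    ∑ℚ (m ℕ.+ suc o) f + c * ∑ℚ m g
      ≡⟨ cong (λ z → ∑ℚ z f + c * ∑ℚ m g) (ℕ.+-suc m o) ⟩
    ∑ℚ q f + f q + c * ∑ℚ m g
      ≡⟨ cong (λ z → ∑ℚ q f + z + c * ∑ℚ m g) (h q (ℕ.m≤m+n m o) (ℕ.≤-reflexive (sym (ℕ.+-suc m o)))) ⟩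
    ∑ℚ q f + c * g q + c * ∑ℚ m g
      ≡⟨ solve 3 (λ a b d → a :+ b :+ d := a :+ d :+ b) refl (∑ℚ q f) (c * g q) (c * ∑ℚ m g) ⟩
    ∑ℚ q f + c * ∑ℚ m g + c * g q
      ≡⟨ cong (_+ c * g q) (∑ℚ-block c f g m o λ p m≤p p< → h p m≤p (ℕ.<-≤-trans p< (ℕ.+-monoʳ-≤ m (ℕ.n≤1+n o)))) ⟩
    ∑ℚ m f + c * ∑ℚ q g + c * g q
      ≡⟨ solve 4 (λ a c b d → a :+ c :* b :+ c :* d := a :+ c :* (b :+ d)) refl (∑ℚ m f) c (∑ℚ q g) (g q) ⟩
    ∑ℚ m f + c * (∑ℚ q g + g q)
      ≡⟨ cong (λ z → ∑ℚ m f + c * ∑ℚ z g) (ℕ.+-suc m o) ⟨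
    ∑ℚ m f + c * ∑ℚ (m ℕ.+ suc o) g ∎
    where
    open ≡-Reasoning
    q : ℕ
    q = m ℕ.+ o

  module _ (M′ : ℕ) where
    private
      M : ℕ
      M = suc M′

    -- Counting up to M · 2^i makes the rounding error of ⌊n / p⌋ at most n / (M p).
    logSum≤ : ∀ i → fromℕ M′ * logSum (2 ℕ.^ i) ≤ fromℕ M * fromℕ (M ℕ.+ i)
    logSum≤ i = cancel-fromℕ n {{n≢0}} (begin
      fromℕ n * (fromℕ M′ * logSum B)
        ≡⟨ *-assoc (fromℕ n) (fromℕ M′) (logSum B) ⟨
      fromℕ n * fromℕ M′ * logSum B
        ≡⟨ ∑ℚ-*ˡ B (fromℕ n * fromℕ M′) _ ⟨
      ∑ℚ B (λ p → fromℕ n * fromℕ M′ * (fromℕ (prime p ℕ.* lg p) * recip p))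
        ≤⟨ ∑ℚ-mono B term ⟩
      ∑ℚ B (λ p → fromℕ M * fromℕ (prime p ℕ.* lg p ℕ.* multiples n p))
        ≡⟨ trans (∑ℚ-*ˡ B (fromℕ M) _) (cong (fromℕ M *_) (sym (fromℕ-∑ B _))) ⟩
      fromℕ M * fromℕ (∑ B (λ p → prime p ℕ.* lg p ℕ.* multiples n p))
        ≤⟨ monoˡ (fromℕ M) (0≤fromℕ M) (fromℕ-mono (∑lg-multiples≤ B (M ℕ.+ i) n n≤)) ⟩
      fromℕ M * fromℕ (n ℕ.* (M ℕ.+ i))
        ≡⟨ trans (cong (fromℕ M *_) (fromℕ-* n (M ℕ.+ i)))
             (solve 3 (λ a b c → a :* (b :* c) := b :* (a :* c)) refl (fromℕ M) (fromℕ n) (fromℕ (M ℕ.+ i))) ⟩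
      fromℕ n * (fromℕ M * fromℕ (M ℕ.+ i)) ∎)
      where
      open ≤-Reasoning
      B n : ℕ
      B = 2 ℕ.^ i
      n = M ℕ.* B
      n≢0 : NonZero n
      n≢0 = ℕ.m*n≢0 M B {{_}} {{ℕ.m^n≢0 2 i}}
      n≤ : n ℕ.≤ 2 ℕ.^ (M ℕ.+ i)
      n≤ = ℕ.≤-trans (ℕ.*-monoˡ-≤ B (ℕ.<⇒≤ (n<m^n M (ℕ.s≤s (ℕ.s≤s ℕ.z≤n)))))
        (ℕ.≤-reflexive (sym (ℕ.^-distribˡ-+-* 2 M i)))
      count : ∀ p .{{_ : NonZero p}} → p ℕ.< B → M′ ℕ.* n ℕ.≤ p ℕ.* (M ℕ.* multiples n p)
      count p p<B = ℕ.+-cancelˡ-≤ n (M′ ℕ.* n) (p ℕ.* (M ℕ.* multiples n p)) (ℕ.≤-trans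
        (ℕ.*-monoʳ-≤ M (ℕ.<⇒≤ (proj₂ (multiples-bracket n p))))
        (ℕ.≤-trans (ℕ.≤-reflexive (ℕ.*-distribˡ-+ M p (multiples n p ℕ.* p)))
          (ℕ.+-mono-≤ (ℕ.*-monoʳ-≤ M (ℕ.<⇒≤ p<B))
            (ℕ.≤-reflexive (trans (sym (ℕ.*-assoc M (multiples n p) p)) (ℕ.*-comm (M ℕ.* multiples n p) p))))))
      ratio : ∀ p .{{_ : NonZero p}} → p ℕ.< B → fromℕ n * fromℕ M′ * recip p ≤ fromℕ M * fromℕ (multiples n p)
      ratio p p<B = cancel-fromℕ p (begin
        fromℕ p * (fromℕ n * fromℕ M′ * recip p)
          ≡⟨ cancel-recip p _ ⟩
        fromℕ n * fromℕ M′
          ≡⟨ trans (*-comm (fromℕ n) (fromℕ M′)) (sym (fromℕ-* M′ n)) ⟩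
        fromℕ (M′ ℕ.* n)
          ≤⟨ fromℕ-mono (count p p<B) ⟩
        fromℕ (p ℕ.* (M ℕ.* multiples n p))
          ≡⟨ trans (fromℕ-* p _) (cong (fromℕ p *_) (fromℕ-* M (multiples n p))) ⟩
        fromℕ p * (fromℕ M * fromℕ (multiples n p)) ∎)
      term : ∀ p → p ℕ.< B → fromℕ n * fromℕ M′ * (fromℕ (prime p ℕ.* lg p) * recip p) ≤
        fromℕ M * fromℕ (prime p ℕ.* lg p ℕ.* multiples n p)
      term zero    p<B = ≤-trans (≤-reflexive (trans (cong (fromℕ n * fromℕ M′ *_) (*-zeroʳ (fromℕ (prime 0 ℕ.* lg 0))))
        (*-zeroʳ (fromℕ n * fromℕ M′)))) (0≤* (0≤fromℕ M) (0≤fromℕ (prime 0 ℕ.* lg 0 ℕ.* multiples n 0)))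
      term p@(suc _) p<B = begin
        fromℕ n * fromℕ M′ * (fromℕ w * recip p)
          ≡⟨ solve 3 (λ a w r → a :* (w :* r) := w :* (a :* r)) refl (fromℕ n * fromℕ M′) (fromℕ w) (recip p) ⟩
        fromℕ w * (fromℕ n * fromℕ M′ * recip p)
          ≤⟨ monoˡ (fromℕ w) (0≤fromℕ w) (ratio p p<B) ⟩
        fromℕ w * (fromℕ M * fromℕ (multiples n p))
          ≡⟨ solve 3 (λ w a m → w :* (a :* m) := a :* (w :* m)) refl (fromℕ w) (fromℕ M) (fromℕ (multiples n p)) ⟩
        fromℕ M * (fromℕ w * fromℕ (multiples n p))
          ≡⟨ cong (fromℕ M *_) (sym (fromℕ-* w (multiples n p))) ⟩
        fromℕ M * fromℕ (w ℕ.* multiples n p) ∎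
        where
        w : ℕ
        w = prime p ℕ.* lg p

    -- On this dyadic block `lg p` equals l + 1, so 1/p is exactly `inv l` times its weighted
    -- counterpart. Moving terms across avoids subtraction.
    primeSum-block : ∀ l → primeSum (2 ℕ.^ suc (suc l)) + inv l * logSum (2 ℕ.^ suc l) ≡
      primeSum (2 ℕ.^ suc l) + inv l * logSum (2 ℕ.^ suc (suc l))
    primeSum-block l = subst (λ z → primeSum z + inv l * logSum B ≡ primeSum B + inv l * logSum z) (cong (B ℕ.+_) (sym (ℕ.+-identityʳ B)))
      (∑ℚ-block (inv l) _ _ B B λ p B≤p p<2B → eq p (lg-unique B≤p (ℕ.<-≤-trans p<2B (ℕ.≤-reflexive (cong (B ℕ.+_) (sym (ℕ.+-identityʳ B)))))))
      where
      B : ℕ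
      B = 2 ℕ.^ suc l
      eq : ∀ p → lg p ≡ suc l → primeℚ p * recip p ≡ inv l * (fromℕ (prime p ℕ.* lg p) * recip p)
      eq p lg≡ = sym (begin
        inv l * (fromℕ (prime p ℕ.* lg p) * recip p)
          ≡⟨ cong (λ z → inv l * (z * recip p)) (trans (cong (λ z → fromℕ (prime p ℕ.* z)) lg≡) (fromℕ-* (prime p) (suc l))) ⟩
        inv l * (primeℚ p * fromℕ (suc l) * recip p)
          ≡⟨ solve 4 (λ i a b r → i :* (a :* b :* r) := (i :* b) :* (a :* r)) refl (inv l) (primeℚ p) (fromℕ (suc l)) (recip p) ⟩
        inv l * fromℕ (suc l) * (primeℚ p * recip p)
          ≡⟨ trans (cong (_* (primeℚ p * recip p)) (inv*suc l)) (*-identityˡ _) ⟩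
        primeℚ p * recip p ∎)
        where open ≡-Reasoning

    -- Summation by parts as an induction: the first summand is the boundary term. A step lowers its
    -- coefficient from `inv l` to `inv (suc l)`, at the cost of `inv l * inv (suc l)` times the
    -- bound M (M + l + 2) of `logSum≤`. The part l + 2 yields `inv l` and builds up `H`, while the
    -- part M telescopes to M (1 - inv l).
    abel : ∀ l → fromℕ M′ * primeSum (2 ℕ.^ suc l) ≤
      inv l * (fromℕ M′ * logSum (2 ℕ.^ suc l)) + fromℕ M * (H l + fromℕ M * (1ℚ - inv l))
    abel zero    = ≤-reflexive (trans (*-zeroʳ (fromℕ M′)) (sym (trans
      (cong₂ _+_ (trans (*-identityˡ (fromℕ M′ * 0ℚ)) (*-zeroʳ (fromℕ M′)))
        (trans (cong (fromℕ M *_) (trans (+-identityˡ _) (*-zeroʳ (fromℕ M)))) (*-zeroʳ (fromℕ M))))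
      (+-identityʳ 0ℚ))))
    abel (suc l) = begin
      m′ * s′
        ≡⟨ solve 4 (λ m s g i → m :* s := m :* (s :+ i :* g) :- i :* (m :* g)) refl m′ s′ g i ⟩
      m′ * (s′ + i * g) - i * (m′ * g)
        ≡⟨ cong (λ z → m′ * z - i * (m′ * g)) (primeSum-block l) ⟩
      m′ * (s + i * g′) - i * (m′ * g)
        ≡⟨ solve 5 (λ m s g g′ i → m :* (s :+ i :* g′) :- i :* (m :* g) := m :* s :+ (i :* (m :* g′) :- i :* (m :* g))) refl m′ s g g′ i ⟩
      m′ * s + (i * (m′ * g′) - i * (m′ * g))
        ≤⟨ +-monoˡ-≤ (i * (m′ * g′) - i * (m′ * g)) (abel l) ⟩
      i * (m′ * g) + m * (H l + m * (1ℚ - i)) + (i * (m′ * g′) - i * (m′ * g))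
        ≡⟨ solve 6 (λ m′ m g g′ i h → i :* (m′ :* g) :+ m :* (h :+ m :* (con 1ℚ :- i)) :+ (i :* (m′ :* g′) :- i :* (m′ :* g))
             := i :* (m′ :* g′) :+ m :* (h :+ m :* (con 1ℚ :- i))) refl m′ m g g′ i (H l) ⟩
      i * (m′ * g′) + m * (H l + m * (1ℚ - i))
        ≡⟨ cong (λ z → z * (m′ * g′) + m * (H l + m * (1ℚ - i))) (inv-step l) ⟩
      (i′ + i * i′) * (m′ * g′) + m * (H l + m * (1ℚ - i))
        ≤⟨ +-monoˡ-≤ (m * (H l + m * (1ℚ - i))) (≤-trans (≤-reflexive (*-distribʳ-+ (m′ * g′) i′ (i * i′)))
             (+-monoʳ-≤ (i′ * (m′ * g′)) (monoˡ (i * i′) (0≤* (<⇒≤ (0<inv l)) (<⇒≤ (0<inv (suc l)))) (logSum≤ (suc (suc l)))))) ⟩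
      i′ * (m′ * g′) + i * i′ * (m * fromℕ (M ℕ.+ suc (suc l))) + m * (H l + m * (1ℚ - i))
        ≡⟨ cong (λ z → i′ * (m′ * g′) + i * i′ * (m * z) + m * (H l + m * (1ℚ - i))) (fromℕ-+ M (suc (suc l))) ⟩
      i′ * (m′ * g′) + i * i′ * (m * (m + L)) + m * (H l + m * (1ℚ - i))
        ≡⟨ solve 7 (λ a i i′ m L h o → a :+ i :* i′ :* (m :* (m :+ L)) :+ m :* (h :+ m :* (o :- i))
             := a :+ m :* (h :+ i :* (i′ :* L) :+ m :* (o :- (i :- i :* i′)))) refl (i′ * (m′ * g′)) i i′ m L (H l) 1ℚ ⟩
      i′ * (m′ * g′) + m * (H l + i * (i′ * L) + m * (1ℚ - (i - i * i′)))
        ≡⟨ cong₂ (λ x y → i′ * (m′ * g′) + m * (H l + x + m * (1ℚ - y)))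
             (trans (cong (i *_) (inv*suc (suc l))) (*-identityʳ i))
             (trans (cong (_- i * i′) (inv-step l)) (solve 2 (λ a b → a :+ b :- b := a) refl i′ (i * i′))) ⟩
      i′ * (m′ * g′) + m * (H l + i + m * (1ℚ - i′)) ∎
      where
      open ≤-Reasoning
      m m′ s s′ g g′ i i′ L : ℚ
      m  = fromℕ M
      m′ = fromℕ M′
      s  = primeSum (2 ℕ.^ suc l)
      s′ = primeSum (2 ℕ.^ suc (suc l))
      g  = logSum (2 ℕ.^ suc l)
      g′ = logSum (2 ℕ.^ suc (suc l))
      i  = inv l
      i′ = inv (suc l)
      L  = fromℕ (suc (suc l))

    primeSum≤ : ∀ l → fromℕ M′ * primeSum (2 ℕ.^ suc l) ≤ fromℕ M * (H l + fromℕ M + 1ℚ)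
    primeSum≤ l = begin
      fromℕ M′ * primeSum (2 ℕ.^ suc l)
        ≤⟨ abel l ⟩
      i * (fromℕ M′ * logSum (2 ℕ.^ suc l)) + m * (H l + m * (1ℚ - i))
        ≤⟨ +-monoˡ-≤ _ (monoˡ i (<⇒≤ (0<inv l)) (logSum≤ (suc l))) ⟩
      i * (m * fromℕ (M ℕ.+ suc l)) + m * (H l + m * (1ℚ - i))
        ≡⟨ cong (λ z → i * (m * z) + m * (H l + m * (1ℚ - i))) (fromℕ-+ M (suc l)) ⟩
      i * (m * (m + fromℕ (suc l))) + m * (H l + m * (1ℚ - i))
        ≡⟨ solve 5 (λ i m L h o → i :* (m :* (m :+ L)) :+ m :* (h :+ m :* (o :- i)) := m :* (h :+ m :* o :+ i :* L)) refl
             i m (fromℕ (suc l)) (H l) 1ℚ ⟩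
      m * (H l + m * 1ℚ + i * fromℕ (suc l))
        ≡⟨ cong₂ (λ x y → m * (H l + x + y)) (*-identityʳ m) (inv*suc l) ⟩
      m * (H l + m + 1ℚ) ∎
      where
      open ≤-Reasoning
      i m : ℚ
      i = inv l
      m = fromℕ M

    meanΩ≤ : ∀ l → fromℕ M′ * meanΩ (2 ℕ.^ suc l) ≤ fromℕ M * (H l + fromℕ M + 1ℚ) + fromℕ M′
    meanΩ≤ l = begin
      fromℕ M′ * meanΩ B
        ≤⟨ monoˡ (fromℕ M′) (0≤fromℕ M′) (meanΩ≤primeSum+1 B (ℕ.^-monoʳ-≤ 2 {1} {suc l} (ℕ.s≤s ℕ.z≤n))) ⟩
      fromℕ M′ * (primeSum B + 1ℚ)
        ≡⟨ trans (*-distribˡ-+ (fromℕ M′) (primeSum B) 1ℚ) (cong (fromℕ M′ * primeSum B +_) (*-identityʳ (fromℕ M′))) ⟩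
      fromℕ M′ * primeSum B + fromℕ M′
        ≤⟨ +-monoˡ-≤ (fromℕ M′) (primeSum≤ l) ⟩
      fromℕ M * (H l + fromℕ M + 1ℚ) + fromℕ M′ ∎
      where
      open ≤-Reasoning
      B : ℕ
      B = 2 ℕ.^ suc l

  -- The value of `forcing` for the representation bound (r + L + 1)^r and density 1 / (r + 1).
  bound : ℕ → ℕ → ℕ → ℕ
  bound k L r = k ℕ.* k ℕ.* (4 ℕ.* (suc (r ℕ.+ L) ℕ.^ r ℕ.* suc r) ℕ.+ 2)

  forces-bound : ∀ k L r .{{_ : NonZero k}} → k ℕ.< 2 ℕ.^ L → meanΩ (2 ℕ.^ L) ≤ fromℕ r → ForcesRainbowAP k (bound k L r)
  forces-bound k L r k<2^L mean≤r = forces k (suc (r ℕ.+ L) ℕ.^ r) (suc r) (Smooth.fewFactors B r)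
    (Smooth.reps≤ B r L ℕ.≤-refl k k<2^L)
    (λ X → fewFactors-dense B r X (fromℕ-cancel-≤ (≤-trans (∑Ω≤meanΩ B X)
      (≤-trans (monoˡ (fromℕ X) (0≤fromℕ X) mean≤r)
        (≤-reflexive (trans (sym (fromℕ-* X r)) (cong fromℕ (ℕ.*-comm X r))))))))
    where
    B : ℕ
    B = 2 ℕ.^ L

-- Inequalities for partial sums of the exponential series.

module Exponential where
  import Data.Integer.Base as ℤ
  open import Data.Rational.Base hiding (NonZero)
  open import Data.Rational.Properties
  open import Data.Rational.Solver using (module +-*-Solver)
  open +-*-Solver using (solve; _:+_; _:*_; _:-_; :-_; _:=_; con)
  open import Defs
  open Mertens

  0≤1 : 0ℚ ≤ 1ℚ
  0≤1 = nonNegative⁻¹ 1ℚ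

  0≤expSum : ∀ {u} → 0ℚ ≤ u → ∀ n → 0ℚ ≤ expSum u n
  0≤expSum 0≤u zero    = 0≤1
  0≤expSum 0≤u (suc n) = 0≤+ (0≤expSum 0≤u n) (0≤expTerm 0≤u (suc n))

  1≤expSum : ∀ {u} → 0ℚ ≤ u → ∀ n → 1ℚ ≤ expSum u n
  1≤expSum 0≤u zero    = ≤-refl
  1≤expSum 0≤u (suc n) = ≤-trans (1≤expSum 0≤u n) (≤+ʳ _ (0≤expTerm 0≤u (suc n)))

  expSum-mono : ∀ {u v} → 0ℚ ≤ u → u ≤ v → ∀ n → expSum u n ≤ expSum v n
  expSum-mono 0≤u u≤v zero    = ≤-refl
  expSum-mono 0≤u u≤v (suc n) = +-mono-≤ (expSum-mono 0≤u u≤v n) (expTerm-mono 0≤u u≤v (suc n))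

  expSum-monoʳ : ∀ {u m n} → 0ℚ ≤ u → m ℕ.≤ n → expSum u m ≤ expSum u n
  expSum-monoʳ {u} {m} {n} 0≤u m≤n = subst (λ k → expSum u m ≤ expSum u k) (ℕ.m∸n+n≡m m≤n) (go (n ℕ.∸ m))
    where
    go : ∀ j → expSum u m ≤ expSum u (j ℕ.+ m)
    go zero    = ≤-refl
    go (suc j) = ≤-trans (go j) (≤+ʳ _ (0≤expTerm 0≤u (suc j ℕ.+ m)))

  -- The real exponential is approximated by partial sums at varying arguments. The law e^(u+v) =
  -- e^u e^v is therefore needed as inequalities between partial sums, obtained from the Cauchy
  -- product.
  module Cauchy (u v : ℚ) where

    -- diagonal i j = Σ_{l ≤ i} (u^(i-l) / (i-l)!) (v^(j+l) / (j+l)!), and similarly for triangle.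
    diagonal triangle : ℕ → ℕ → ℚ
    diagonal zero    j = expTerm u 0 * expTerm v j
    diagonal (suc i) j = expTerm u (suc i) * expTerm v j + diagonal i (suc j)
    triangle zero    j = expTerm u 0 * expSum v j
    triangle (suc i) j = expTerm u (suc i) * expSum v j + triangle i (suc j)

    private
      term : ∀ q i → fromℕ (suc i) * expTerm q (suc i) ≡ q * expTerm q i
      term q i = trans (*-comm (fromℕ (suc i)) (expTerm q (suc i))) (trans (expTerm-suc q i) (*-comm (expTerm q i) q))

    diagonal-0 : ∀ j → fromℕ (suc j) * diagonal 0 (suc j) ≡ v * diagonal 0 j
    diagonal-0 j = trans (cong (fromℕ (suc j) *_) (*-identityˡ (expTerm v (suc j))))
      (trans (term v j) (cong (v *_) (sym (*-identityˡ (expTerm v j)))))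

    -- A Leibniz rule: multiplying u^a v^b / (a! b!) by its degree a + b lowers one exponent at a
    -- time. It leads to the binomial theorem without binomial coefficients.
    product-term : ∀ i j → fromℕ (suc i ℕ.+ suc j) * (expTerm u (suc i) * expTerm v (suc j)) ≡
      u * (expTerm u i * expTerm v (suc j)) + v * (expTerm u (suc i) * expTerm v j)
    product-term i j = begin
      fromℕ (suc i ℕ.+ suc j) * (a′ * b′)
        ≡⟨ cong (_* (a′ * b′)) (fromℕ-+ (suc i) (suc j)) ⟩
      (fromℕ (suc i) + fromℕ (suc j)) * (a′ * b′)
        ≡⟨ solve 4 (λ m n a b → (m :+ n) :* (a :* b) := (m :* a) :* b :+ a :* (n :* b)) refl (fromℕ (suc i)) (fromℕ (suc j)) a′ b′ ⟩
      fromℕ (suc i) * a′ * b′ + a′ * (fromℕ (suc j) * b′)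
        ≡⟨ cong₂ (λ x y → x * b′ + a′ * y) (term u i) (term v j) ⟩
      u * expTerm u i * b′ + a′ * (v * expTerm v j)
        ≡⟨ solve 6 (λ u v a a′ b b′ → u :* a :* b′ :+ a′ :* (v :* b) := u :* (a :* b′) :+ v :* (a′ :* b)) refl u v (expTerm u i) a′ (expTerm v j) b′ ⟩
      u * (expTerm u i * b′) + v * (a′ * expTerm v j) ∎
      where
      open ≡-Reasoning
      a′ b′ : ℚ
      a′ = expTerm u (suc i)
      b′ = expTerm v (suc j)

    -- Sums `product-term` along a diagonal. `rest` is what remains after the first product is split
    -- off, and it reduces to `diagonal-suc` at a smaller i.
    diagonal-suc : ∀ i j → fromℕ (suc i ℕ.+ suc j) * diagonal (suc i) (suc j) ≡
      u * diagonal i (suc j) + v * diagonal (suc i) j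
    rest : ∀ i j → fromℕ (suc i ℕ.+ suc j) * diagonal i (suc (suc j)) + u * (expTerm u i * expTerm v (suc j)) ≡
      u * diagonal i (suc j) + v * diagonal i (suc j)
    diagonal-suc i j = begin
      N * (a′ * b′ + D)
        ≡⟨ *-distribˡ-+ N (a′ * b′) D ⟩
      N * (a′ * b′) + N * D
        ≡⟨ cong (_+ N * D) (product-term i j) ⟩
      x + v * (a′ * expTerm v j) + N * D
        ≡⟨ solve 3 (λ x y z → x :+ y :+ z := (z :+ x) :+ y) refl x (v * (a′ * expTerm v j)) (N * D) ⟩
      N * D + x + v * (a′ * expTerm v j)
        ≡⟨ cong (_+ v * (a′ * expTerm v j)) (rest i j) ⟩
      u * diagonal i (suc j) + v * diagonal i (suc j) + v * (a′ * expTerm v j)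
        ≡⟨ solve 4 (λ x v d t → x :+ v :* d :+ v :* t := x :+ v :* (t :+ d)) refl (u * diagonal i (suc j)) v (diagonal i (suc j)) (a′ * expTerm v j) ⟩
      u * diagonal i (suc j) + v * diagonal (suc i) j ∎
      where
      open ≡-Reasoning
      N a′ b′ D x : ℚ
      N  = fromℕ (suc i ℕ.+ suc j)
      a′ = expTerm u (suc i)
      b′ = expTerm v (suc j)
      D  = diagonal i (suc (suc j))
      x  = u * (expTerm u i * b′)
    rest zero    j = trans (cong (_+ u * diagonal 0 (suc j)) (diagonal-0 (suc j)))
      (+-comm (v * diagonal 0 (suc j)) (u * diagonal 0 (suc j)))
    rest (suc i) j = begin
      fromℕ (suc (suc i) ℕ.+ suc j) * D + u * t
        ≡⟨ cong (λ z → fromℕ z * D + u * t) (cong suc (sym (ℕ.+-suc i (suc j)))) ⟩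
      fromℕ (suc i ℕ.+ suc (suc j)) * D + u * t
        ≡⟨ cong (_+ u * t) (diagonal-suc i (suc j)) ⟩
      u * diagonal i (suc (suc j)) + v * diagonal (suc i) (suc j) + u * t
        ≡⟨ solve 4 (λ u d y t → u :* d :+ y :+ u :* t := u :* (t :+ d) :+ y) refl u (diagonal i (suc (suc j))) (v * diagonal (suc i) (suc j)) t ⟩
      u * diagonal (suc i) (suc j) + v * diagonal (suc i) (suc j) ∎
      where
      open ≡-Reasoning
      D t : ℚ
      D = diagonal (suc i) (suc (suc j))
      t = expTerm u (suc i) * expTerm v (suc j)

    diagonal-suc-0 : ∀ i → fromℕ (suc i) * diagonal (suc i) 0 ≡ (u + v) * diagonal i 0
    diagonal-suc-0 i = begin
      N * (expTerm u (suc i) * 1ℚ + diagonal i 1)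
        ≡⟨ solve 4 (λ n t o d → n :* (t :* o :+ d) := (n :* t) :* o :+ n :* d) refl N (expTerm u (suc i)) 1ℚ (diagonal i 1) ⟩
      N * expTerm u (suc i) * 1ℚ + N * diagonal i 1
        ≡⟨ cong (λ z → z * 1ℚ + N * diagonal i 1) (term u i) ⟩
      u * expTerm u i * 1ℚ + N * diagonal i 1
        ≡⟨ edge i ⟩
      (u + v) * diagonal i 0 ∎
      where
      open ≡-Reasoning
      N : ℚ
      N = fromℕ (suc i)
      edge : ∀ i → u * expTerm u i * 1ℚ + fromℕ (suc i) * diagonal i 1 ≡ (u + v) * diagonal i 0
      edge zero    = trans (cong (u * 1ℚ * 1ℚ +_) (diagonal-0 0))
        (solve 2 (λ u v → u :* con 1ℚ :* con 1ℚ :+ v :* (con 1ℚ :* con 1ℚ) := (u :+ v) :* (con 1ℚ :* con 1ℚ)) refl u v)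
      edge (suc i) = begin
        u * t * 1ℚ + fromℕ (suc (suc i)) * diagonal (suc i) 1
          ≡⟨ cong (λ z → u * t * 1ℚ + fromℕ z * diagonal (suc i) 1) (cong suc (ℕ.+-comm 1 i)) ⟩
        u * t * 1ℚ + fromℕ (suc i ℕ.+ 1) * diagonal (suc i) 1
          ≡⟨ cong (u * t * 1ℚ +_) (diagonal-suc i 0) ⟩
        u * t * 1ℚ + (u * diagonal i 1 + v * diagonal (suc i) 0)
          ≡⟨ solve 5 (λ u v t o d → u :* t :* o :+ (u :* d :+ v :* (t :* o :+ d)) := (u :+ v) :* (t :* o :+ d)) refl u v t 1ℚ (diagonal i 1) ⟩
        (u + v) * diagonal (suc i) 0 ∎
        where
        t : ℚ
        t = expTerm u (suc i)

    expTerm-+ : ∀ n → expTerm (u + v) n ≡ diagonal n 0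
    expTerm-+ zero    = sym (*-identityˡ 1ℚ)
    expTerm-+ (suc n) = *-cancelˡ-pos (fromℕ (suc n)) (begin
      fromℕ (suc n) * expTerm (u + v) (suc n)  ≡⟨ term (u + v) n ⟩
      (u + v) * expTerm (u + v) n              ≡⟨ cong ((u + v) *_) (expTerm-+ n) ⟩
      (u + v) * diagonal n 0                   ≡⟨ diagonal-suc-0 n ⟨
      fromℕ (suc n) * diagonal (suc n) 0       ∎)
      where
      open ≡-Reasoning
      *-cancelˡ-pos : ∀ p .{{_ : Positive p}} {a b} → p * a ≡ p * b → a ≡ b
      *-cancelˡ-pos p eq = ≤-antisym (*-cancelˡ-≤-pos p (≤-reflexive eq)) (*-cancelˡ-≤-pos p (≤-reflexive (sym eq)))

    triangle-suc : ∀ i j → triangle i (suc j) ≡ triangle i j + diagonal i (suc j)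
    triangle-suc zero    j = *-distribˡ-+ 1ℚ (expSum v j) (expTerm v (suc j))
    triangle-suc (suc i) j = trans (cong (expTerm u (suc i) * (expSum v j + expTerm v (suc j)) +_) (triangle-suc i (suc j)))
      (solve 5 (λ t s x a b → t :* (s :+ x) :+ (a :+ b) := (t :* s :+ a) :+ (t :* x :+ b)) refl
        (expTerm u (suc i)) (expSum v j) (expTerm v (suc j)) (triangle i (suc j)) (diagonal i (suc (suc j))))

    expSum-+ : ∀ n → expSum (u + v) n ≡ triangle n 0
    expSum-+ zero    = sym (*-identityˡ 1ℚ)
    expSum-+ (suc n) = begin
      expSum (u + v) n + expTerm (u + v) (suc n)
        ≡⟨ cong₂ _+_ (expSum-+ n) (expTerm-+ (suc n)) ⟩
      triangle n 0 + (expTerm u (suc n) * 1ℚ + diagonal n 1)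
        ≡⟨ solve 3 (λ a b c → a :+ (b :+ c) := b :+ (a :+ c)) refl (triangle n 0) (expTerm u (suc n) * 1ℚ) (diagonal n 1) ⟩
      expTerm u (suc n) * 1ℚ + (triangle n 0 + diagonal n 1)
        ≡⟨ cong (expTerm u (suc n) * 1ℚ +_) (sym (triangle-suc n 0)) ⟩
      triangle (suc n) 0 ∎
      where open ≡-Reasoning

    module _ (0≤u : 0ℚ ≤ u) (0≤v : 0ℚ ≤ v) where

      -- `triangle i j` sums over the exponents a ≤ i with a + b ≤ i + j. This region contains the
      -- rectangle a ≤ i, b ≤ j; for nonnegative terms, inclusions of regions become inequalities
      -- here and in the next lemmas.
      expSum*expSum≤triangle : ∀ i j → expSum u i * expSum v j ≤ triangle i j
      expSum*expSum≤triangle zero    j = ≤-refl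
      expSum*expSum≤triangle (suc i) j = begin
        (expSum u i + expTerm u (suc i)) * expSum v j
          ≡⟨ solve 3 (λ a b c → (a :+ b) :* c := b :* c :+ a :* c) refl (expSum u i) (expTerm u (suc i)) (expSum v j) ⟩
        expTerm u (suc i) * expSum v j + expSum u i * expSum v j
          ≤⟨ +-monoʳ-≤ (expTerm u (suc i) * expSum v j) (≤-trans
               (monoˡ (expSum u i) (0≤expSum 0≤u i) (expSum-monoʳ 0≤v (ℕ.n≤1+n j)))
               (expSum*expSum≤triangle i (suc j))) ⟩
        triangle (suc i) j ∎
        where open ≤-Reasoning

      triangle≤expSum*expSum : ∀ i j m → i ℕ.+ j ≡ m → triangle i j ≤ expSum u i * expSum v m
      triangle≤expSum*expSum zero    j m refl = ≤-refl
      triangle≤expSum*expSum (suc i) j m eq = begin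
        expTerm u (suc i) * expSum v j + triangle i (suc j)
          ≤⟨ +-mono-≤ (monoˡ (expTerm u (suc i)) (0≤expTerm 0≤u (suc i))
               (expSum-monoʳ 0≤v (ℕ.≤-trans (ℕ.m≤n+m j (suc i)) (ℕ.≤-reflexive eq))))
               (triangle≤expSum*expSum i (suc j) m (trans (ℕ.+-suc i j) eq)) ⟩
        expTerm u (suc i) * expSum v m + expSum u i * expSum v m
          ≡⟨ solve 3 (λ a b c → b :* c :+ a :* c := (a :+ b) :* c) refl (expSum u i) (expTerm u (suc i)) (expSum v m) ⟩
        expSum u (suc i) * expSum v m ∎
        where open ≤-Reasoning

      triangle-slide : ∀ j i → triangle i j ≤ triangle (j ℕ.+ i) 0
      triangle-slide zero    i = ≤-refl
      triangle-slide (suc j) i = ≤-trans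
        (subst (_≤ triangle (suc i) j) (+-identityˡ (triangle i (suc j)))
          (+-monoˡ-≤ (triangle i (suc j)) (0≤* (0≤expTerm 0≤u (suc i)) (0≤expSum 0≤v j))))
        (subst (λ z → triangle (suc i) j ≤ triangle z 0) (ℕ.+-suc j i) (triangle-slide j (suc i)))

      expSum-supermultiplicative : ∀ i j → expSum u i * expSum v j ≤ expSum (u + v) (j ℕ.+ i)
      expSum-supermultiplicative i j = ≤-trans (expSum*expSum≤triangle i j)
        (≤-trans (triangle-slide j i) (≤-reflexive (sym (expSum-+ (j ℕ.+ i)))))

      expSum-submultiplicative : ∀ n → expSum (u + v) n ≤ expSum u n * expSum v n
      expSum-submultiplicative n = ≤-trans (≤-reflexive (expSum-+ n)) (triangle≤expSum*expSum n 0 n (ℕ.+-identityʳ n))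

  open Cauchy

  -- The difference consists of the products with a ≤ i, b ≤ m and a + b > m. Each is bounded in
  -- absolute value by its counterpart at r and s, so arguments of either sign are covered.
  triangle-defect : ∀ {u v r s} → 0ℚ ≤ r → 0ℚ ≤ s → ∣ u ∣ ≤ r → ∣ v ∣ ≤ s → ∀ i j m → i ℕ.+ j ≡ m →
    ∣ expSum u i * expSum v m - triangle u v i j ∣ ≤ expSum r i * expSum s m - triangle r s i j
  triangle-defect {u} {v} {r} {s} 0≤r 0≤s u≤r v≤s zero    j m refl =
    ≤-reflexive (trans (cong ∣_∣ (+-inverseʳ (expSum u 0 * expSum v j))) (sym (+-inverseʳ (expSum r 0 * expSum s j))))
  triangle-defect {u} {v} {r} {s} 0≤r 0≤s u≤r v≤s (suc i) j m refl = begin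
    ∣ (expSum u i + t u) * expSum v m - (t u * expSum v j + triangle u v i (suc j)) ∣
      ≡⟨ cong ∣_∣ (rearrange (expSum u i) (t u) (expSum v m) (expSum v j) (triangle u v i (suc j))) ⟩
    ∣ t u * (expSum v m - expSum v j) + (expSum u i * expSum v m - triangle u v i (suc j)) ∣
      ≤⟨ ∣p+q∣≤∣p∣+∣q∣ (t u * (expSum v m - expSum v j)) (expSum u i * expSum v m - triangle u v i (suc j)) ⟩
    ∣ t u * (expSum v m - expSum v j) ∣ + ∣ expSum u i * expSum v m - triangle u v i (suc j) ∣
      ≡⟨ cong (_+ ∣ expSum u i * expSum v m - triangle u v i (suc j) ∣) (∣p*q∣≡∣p∣*∣q∣ (t u) (expSum v m - expSum v j)) ⟩
    ∣ t u ∣ * ∣ expSum v m - expSum v j ∣ + ∣ expSum u i * expSum v m - triangle u v i (suc j) ∣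
      ≤⟨ +-mono-≤ (*-mono-≤ (0≤∣p∣ (expSum v m - expSum v j)) (0≤expTerm 0≤r (suc i))
           (∣expTerm∣ 0≤r u≤r (suc i)) (∣expSum-tail∣ 0≤s v≤s j (suc i)))
           (triangle-defect 0≤r 0≤s u≤r v≤s i (suc j) m (ℕ.+-suc i j)) ⟩
    t r * (expSum s m - expSum s j) + (expSum r i * expSum s m - triangle r s i (suc j))
      ≡⟨ rearrange (expSum r i) (t r) (expSum s m) (expSum s j) (triangle r s i (suc j)) ⟨
    (expSum r i + t r) * expSum s m - (t r * expSum s j + triangle r s i (suc j)) ∎
    where
    open ≤-Reasoning
    t : ℚ → ℚ
    t z = expTerm z (suc i)
    rearrange : ∀ a b c d e → (a + b) * c - (b * d + e) ≡ b * (c - d) + (a * c - e)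
    rearrange = solve 5 (λ a b c d e → (a :+ b) :* c :- (b :* d :+ e) := b :* (c :- d) :+ (a :* c :- e)) refl

  -- By `triangle-defect`, the product of the partial sums at -x and x differs from the partial sum
  -- at 0, which is 1, by no more than the defect at (x, x). That defect is at most a tail of the
  -- series for e^(2x), hence at most 1 for large n.
  expSum-neg≤2 : ∀ M → ∃[ N ] (∀ n x → N ℕ.≤ n → 0ℚ ≤ x → x + x ≤ fromℕ (suc M) → expSum (- x) n ≤ 1ℚ + 1ℚ)
  expSum-neg≤2 M = N , below
    where
    open ≤-Reasoning
    r : ℚ
    r = fromℕ (suc M)
    N₁ N : ℕ
    N₁ = proj₁ (expTerm-small M 1ℚ (positive⁻¹ 1ℚ))
    N = N₀ M ℕ.⊔ N₁
    below : ∀ n x → N ℕ.≤ n → 0ℚ ≤ x → x + x ≤ r → expSum (- x) n ≤ 1ℚ + 1ℚ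
    below n x N≤n 0≤x 2x≤r with ≤-total 0ℚ (expSum (- x) n)
    ... | inj₂ ≤0 = ≤-trans ≤0 (0≤+ 0≤1 0≤1)
    ... | inj₁ 0≤ = begin
      expSum (- x) n
        ≡⟨ *-identityʳ (expSum (- x) n) ⟨
      expSum (- x) n * 1ℚ
        ≤⟨ monoˡ (expSum (- x) n) 0≤ (1≤expSum 0≤x n) ⟩
      expSum (- x) n * expSum x n
        ≤⟨ ≤-from-∣-∣ (expSum (- x) n * expSum x n) (triangle (- x) x n 0) (triangle-defect 0≤x 0≤x ∣-x∣≤x ∣x∣≤x n 0 n (ℕ.+-identityʳ n)) ⟩
      triangle (- x) x n 0 + (expSum x n * expSum x n - triangle x x n 0)
        ≡⟨ cong₂ (λ a b → a + (expSum x n * expSum x n - b))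
             (trans (sym (expSum-+ (- x) x n)) (trans (cong (λ z → expSum z n) (+-inverseˡ x)) (expSum-0 n)))
             (sym (expSum-+ x x n)) ⟩
      1ℚ + (expSum x n * expSum x n - expSum (x + x) n)
        ≤⟨ +-monoʳ-≤ 1ℚ (+-monoˡ-≤ (- expSum (x + x) n) (expSum-supermultiplicative x x 0≤x 0≤x n n)) ⟩
      1ℚ + (expSum (x + x) (n ℕ.+ n) - expSum (x + x) n)
        ≤⟨ +-monoʳ-≤ 1ℚ (≤-trans (p≤∣p∣ (expSum (x + x) (n ℕ.+ n) - expSum (x + x) n))
             (∣expSum-tail∣ (0≤fromℕ (suc M)) ∣2x∣≤r n n)) ⟩
      1ℚ + (expSum r (n ℕ.+ n) - expSum r n)
        ≤⟨ +-monoʳ-≤ 1ℚ (≤-trans (expSum-tail≤expTerm M n n (ℕ.≤-trans (ℕ.m≤m⊔n (N₀ M) N₁) N≤n))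
             (proj₂ (expTerm-small M 1ℚ (positive⁻¹ 1ℚ)) n (ℕ.≤-trans (ℕ.m≤n⊔m (N₀ M) N₁) N≤n))) ⟩
      1ℚ + 1ℚ ∎
      where
      ∣x∣≤x : ∣ x ∣ ≤ x
      ∣x∣≤x = ≤-reflexive (0≤p⇒∣p∣≡p 0≤x)
      ∣-x∣≤x : ∣ - x ∣ ≤ x
      ∣-x∣≤x = ≤-trans (≤-reflexive (∣-p∣≡∣p∣ x)) ∣x∣≤x
      ∣2x∣≤r : ∣ x + x ∣ ≤ r
      ∣2x∣≤r = ≤-trans (≤-reflexive (0≤p⇒∣p∣≡p (0≤+ 0≤x 0≤x))) 2x≤r

  -- Consecutive terms have ratio at most z, so the series is dominated by the geometric one. The
  -- additional summand `z * expTerm z n` makes the bound inductive.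
  expSum-geometric : ∀ {z} → 0ℚ ≤ z → z ≤ 1ℚ → ∀ n → (1ℚ - z) * expSum z n ≤ 1ℚ
  expSum-geometric {z} 0≤z z≤1 n = ≤-trans (≤+ʳ _ (0≤* 0≤z (0≤expTerm 0≤z n))) (go n)
    where
    open ≤-Reasoning
    go : ∀ n → (1ℚ - z) * expSum z n + z * expTerm z n ≤ 1ℚ
    go zero    = ≤-reflexive (solve 1 (λ z → (con 1ℚ :- z) :* con 1ℚ :+ z :* con 1ℚ := con 1ℚ) refl z)
    go (suc n) = begin
      (1ℚ - z) * (expSum z n + t) + z * t
        ≡⟨ solve 3 (λ z s t → (con 1ℚ :- z) :* (s :+ t) :+ z :* t := (con 1ℚ :- z) :* s :+ t) refl z (expSum z n) t ⟩
      (1ℚ - z) * expSum z n + t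
        ≤⟨ +-monoʳ-≤ ((1ℚ - z) * expSum z n) (≤-trans
             (monoˡ (expTerm z n * z) (0≤* (0≤expTerm 0≤z n) 0≤z) (inv≤1 n))
             (≤-reflexive (trans (*-identityʳ _) (*-comm (expTerm z n) z)))) ⟩
      (1ℚ - z) * expSum z n + z * expTerm z n
        ≤⟨ go n ⟩
      1ℚ ∎
      where
      t : ℚ
      t = expTerm z (suc n)

  expSum-inv : ∀ i n → fromℕ (suc i) * expSum (inv (suc i)) n ≤ fromℕ (suc (suc i))
  expSum-inv i n = begin
    fromℕ (suc i) * e
      ≡⟨ cong (_* e) eq ⟨
    b * (1ℚ - z) * e
      ≡⟨ *-assoc b (1ℚ - z) e ⟩
    b * ((1ℚ - z) * e)
      ≤⟨ monoˡ b (0≤fromℕ (suc (suc i))) (expSum-geometric (<⇒≤ (0<inv (suc i))) (inv≤1 (suc i)) n) ⟩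
    b * 1ℚ
      ≡⟨ *-identityʳ b ⟩
    b ∎
    where
    open ≤-Reasoning
    b z e : ℚ
    b = fromℕ (suc (suc i))
    z = inv (suc i)
    e = expSum z n
    eq : b * (1ℚ - z) ≡ fromℕ (suc i)
    eq = trans (solve 2 (λ b z → b :* (con 1ℚ :- z) := b :- z :* b) refl b z)
      (trans (cong₂ _-_ (sym (fromℕ-suc (suc i))) (inv*suc (suc i)))
        (solve 1 (λ x → (x :+ con 1ℚ) :- con 1ℚ := x) refl (fromℕ (suc i))))

  -- The case i = 0 of `expSum-inv` is e^(1/2) ≤ 2. Using it in place of the true value of ln 2
  -- costs a constant factor in ln k, hence only an additive constant in ln ln k.
  expSum-halves : ∀ j n → expSum (fromℕ j * ½) n ≤ fromℕ (2 ℕ.^ j)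
  expSum-halves zero    n = ≤-reflexive (trans (cong (λ z → expSum z n) (*-zeroˡ ½)) (expSum-0 n))
  expSum-halves (suc j) n = begin
    expSum (fromℕ (suc j) * ½) n
      ≡⟨ cong (λ z → expSum z n) (trans (cong (_* ½) (sym (fromℕ-suc j)))
           (trans (*-distribʳ-+ ½ (fromℕ j) 1ℚ) (cong (fromℕ j * ½ +_) (*-identityˡ ½)))) ⟩
    expSum (fromℕ j * ½ + ½) n
      ≤⟨ expSum-submultiplicative (fromℕ j * ½) ½ 0≤j/2 (<⇒≤ 0<½) n ⟩
    expSum (fromℕ j * ½) n * expSum ½ n
      ≤⟨ *-mono-≤ (0≤expSum (<⇒≤ 0<½) n) (0≤fromℕ (2 ℕ.^ j)) (expSum-halves j n)
           (≤-trans (≤-reflexive (sym (*-identityˡ (expSum ½ n)))) (expSum-inv 0 n)) ⟩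
    fromℕ (2 ℕ.^ j) * fromℕ 2
      ≡⟨ trans (*-comm (fromℕ (2 ℕ.^ j)) (fromℕ 2)) (sym (fromℕ-* 2 (2 ℕ.^ j))) ⟩
    fromℕ (2 ℕ.^ suc j) ∎
    where
    open ≤-Reasoning
    0≤j/2 : 0ℚ ≤ fromℕ j * ½
    0≤j/2 = 0≤* (0≤fromℕ j) (<⇒≤ 0<½)

  -- h m = 1/4 + … + 1/(m + 3)
  h : ℕ → ℚ
  h m = ∑ℚ m (λ i → inv (3 ℕ.+ i))

  0≤h : ∀ m → 0ℚ ≤ h m
  0≤h zero    = ≤-refl
  0≤h (suc m) = 0≤+ (0≤h m) (<⇒≤ (0<inv (3 ℕ.+ m)))

  -- The bounds of `expSum-inv` telescope, so h m is at most ln ((m + 3) / 3). Starting at 1/4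
  -- provides the divisor 3, which outweighs the factor 1/2 lost in `expSum-halves`.
  expSum-h : ∀ m n → fromℕ 3 * expSum (h m) n ≤ fromℕ (3 ℕ.+ m)
  expSum-h zero    n = ≤-reflexive (trans (cong (fromℕ 3 *_) (expSum-0 n)) (*-identityʳ (fromℕ 3)))
  expSum-h (suc m) n = begin
    fromℕ 3 * expSum (h m + z) n
      ≤⟨ monoˡ (fromℕ 3) (0≤fromℕ 3) (expSum-submultiplicative (h m) z (0≤h m) 0≤z n) ⟩
    fromℕ 3 * (expSum (h m) n * expSum z n)
      ≡⟨ *-assoc (fromℕ 3) (expSum (h m) n) (expSum z n) ⟨
    fromℕ 3 * expSum (h m) n * expSum z n
      ≤⟨ monoʳ (expSum z n) (0≤expSum 0≤z n) (expSum-h m n) ⟩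
    fromℕ (3 ℕ.+ m) * expSum z n
      ≤⟨ expSum-inv (2 ℕ.+ m) n ⟩
    fromℕ (4 ℕ.+ m)
      ≡⟨ cong fromℕ (sym (ℕ.+-suc 3 m)) ⟩
    fromℕ (3 ℕ.+ suc m) ∎
    where
    open ≤-Reasoning
    z : ℚ
    z = inv (3 ℕ.+ m)
    0≤z : 0ℚ ≤ z
    0≤z = <⇒≤ (0<inv (3 ℕ.+ m))

  H≤h+2 : ∀ m → H (3 ℕ.+ m) ≤ h m + fromℕ 2
  -- Here 1 + 1/2 + 1/3 = 11/6 ≤ 2, which is 11 ≤ 12 after cross-multiplication.
  H≤h+2 zero    = *≤* (ℤ.+≤+ (ℕ.m≤m+n 11 1))
  H≤h+2 (suc m) = ≤-trans (+-monoˡ-≤ (inv (3 ℕ.+ m)) (H≤h+2 m))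
    (≤-reflexive (solve 3 (λ a b c → a :+ b :+ c := a :+ c :+ b) refl (h m) (fromℕ 2) (inv (3 ℕ.+ m))))

  -- B ≲exp u expresses B ≤ e^u, for u ≥ 0, through a partial sum.
  infix 4 _≲exp_
  _≲exp_ : ℚ → ℚ → Set
  B ≲exp u = ∃[ n ] B ≤ expSum u n

  ≲exp-weaken : ∀ {A B u v} → 0ℚ ≤ u → A ≤ B → u ≤ v → B ≲exp u → A ≲exp v
  ≲exp-weaken 0≤u A≤B u≤v (n , B≤) = n , ≤-trans A≤B (≤-trans B≤ (expSum-mono 0≤u u≤v n))

  ≲exp-* : ∀ {A B u v} → 0ℚ ≤ u → 0ℚ ≤ v → 0ℚ ≤ B → A ≲exp u → B ≲exp v → A * B ≲exp u + v
  ≲exp-* {A} {B} {u} {v} 0≤u 0≤v 0≤B (i , A≤) (j , B≤) = j ℕ.+ i , ≤-trans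
    (*-mono-≤ 0≤B (0≤expSum 0≤u i) A≤ B≤) (expSum-supermultiplicative u v 0≤u 0≤v i j)

  1+≲exp : ∀ {u} → 0ℚ ≤ u → 1ℚ + u ≲exp u
  1+≲exp 0≤u = 1 , ≤expSum 0≤u 0

  suc≲exp : ∀ n → fromℕ (suc n) ≲exp fromℕ n
  suc≲exp n = ≲exp-weaken (0≤fromℕ n) (≤-reflexive (trans (sym (fromℕ-suc n)) (+-comm (fromℕ n) 1ℚ))) ≤-refl (1+≲exp (0≤fromℕ n))

  -- The sum is at most 2 e^u, and 2 ≤ e.
  ≲exp-+ : ∀ {A B u} → 0ℚ ≤ u → A ≲exp u → B ≲exp u → A + B ≲exp u + 1ℚ
  ≲exp-+ {A} {B} {u} 0≤u (i , A≤) (j , B≤) =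
    ≲exp-weaken (0≤+ 0≤u 0≤1) bound′ ≤-refl
      (≲exp-* 0≤u 0≤1 (0≤fromℕ 2) (i ℕ.⊔ j , ≤-refl) (suc≲exp 1))
    where
    open ≤-Reasoning
    e : ℚ
    e = expSum u (i ℕ.⊔ j)
    bound′ : A + B ≤ e * fromℕ 2
    bound′ = begin
      A + B      ≤⟨ +-mono-≤ (≤-trans A≤ (expSum-monoʳ 0≤u (ℕ.m≤m⊔n i j))) (≤-trans B≤ (expSum-monoʳ 0≤u (ℕ.m≤n⊔m i j))) ⟩
      e + e      ≡⟨ solve 1 (λ e → e :+ e := e :* con (fromℕ 2)) refl e ⟩
      e * fromℕ 2 ∎

  ≲exp-^ : ∀ {b u} → 0ℚ ≤ u → fromℕ b ≲exp u → ∀ m → fromℕ (b ℕ.^ m) ≲exp fromℕ m * u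
  ≲exp-^ {b} {u} 0≤u b≲ zero    = 0 , ≤-refl
  ≲exp-^ {b} {u} 0≤u b≲ (suc m) = ≲exp-weaken (0≤+ 0≤u (0≤* (0≤fromℕ m) 0≤u))
    (≤-reflexive (fromℕ-* b (b ℕ.^ m)))
    (≤-reflexive (trans (solve 2 (λ u m → u :+ m :* u := (m :+ con 1ℚ) :* u) refl u (fromℕ m)) (cong (_* u) (fromℕ-suc m))))
    (≲exp-* 0≤u (0≤* (0≤fromℕ m) 0≤u) (0≤fromℕ (b ℕ.^ m)) b≲ (≲exp-^ 0≤u b≲ m))

  0≤H : ∀ n → 0ℚ ≤ H n
  0≤H zero    = ≤-refl
  0≤H (suc n) = 0≤+ (0≤H n) (<⇒≤ (0<inv n))

  -- The factors 1 + 1/i ≤ e^(1/i) for i ≤ n multiply to n + 1.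
  suc≲expH : ∀ n → fromℕ (suc n) ≲exp H n
  suc≲expH zero    = 0 , ≤-refl
  suc≲expH (suc n) = ≲exp-weaken (0≤H (suc n)) (≤-reflexive eq) ≤-refl
    (≲exp-* (0≤H n) (<⇒≤ (0<inv n)) (0≤+ 0≤1 (<⇒≤ (0<inv n))) (suc≲expH n) (1+≲exp (<⇒≤ (0<inv n))))
    where
    eq : fromℕ (suc (suc n)) ≡ fromℕ (suc n) * (1ℚ + inv n)
    eq = sym (trans (solve 2 (λ a i → a :* (con 1ℚ :+ i) := a :+ i :* a) refl (fromℕ (suc n)) (inv n))
      (trans (cong (fromℕ (suc n) +_) (inv*suc n)) (fromℕ-suc (suc n))))

  -- Otherwise m + 4 ≤ e^(H (m + 3)) ≤ e^(G + 2) ≤ 2^(2 (G + 2)) ≤ m; the third inequality is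
  -- e^(1/2) ≤ 2.
  h-unbounded : ∀ G m → 2 ℕ.^ (2 ℕ.* (G ℕ.+ 2)) ℕ.≤ m → fromℕ G ≤ h m
  h-unbounded G m big with fromℕ G ≤? h m
  ... | yes G≤h = G≤h
  ... | no  G≰h = contradiction (ℕ.≤-trans (fromℕ-cancel-≤ (small (3 ℕ.+ m) H≤x (suc≲expH (3 ℕ.+ m)))) big)
      (ℕ.<⇒≱ (ℕ.m≤n+m (suc m) 3))
    where
    open ≤-Reasoning
    j : ℕ
    j = 2 ℕ.* (G ℕ.+ 2)
    H≤x : H (3 ℕ.+ m) ≤ fromℕ j * ½
    H≤x = begin
      H (3 ℕ.+ m)                   ≤⟨ H≤h+2 m ⟩
      h m + fromℕ 2                 ≤⟨ +-monoˡ-≤ (fromℕ 2) (<⇒≤ (≰⇒> G≰h)) ⟩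
      fromℕ G + fromℕ 2             ≡⟨ fromℕ-+ G 2 ⟨
      fromℕ (G ℕ.+ 2)               ≡⟨ solve 1 (λ g → g := con (fromℕ 2) :* g :* con ½) refl (fromℕ (G ℕ.+ 2)) ⟩
      fromℕ 2 * fromℕ (G ℕ.+ 2) * ½ ≡⟨ cong (_* ½) (sym (fromℕ-* 2 (G ℕ.+ 2))) ⟩
      fromℕ j * ½                   ∎
    small : ∀ l → H l ≤ fromℕ j * ½ → fromℕ (suc l) ≲exp H l → fromℕ (suc l) ≤ fromℕ (2 ℕ.^ j)
    small l H≤ (n , ≤e) = ≤-trans ≤e (≤-trans (expSum-mono (0≤H l) H≤ n) (expSum-halves j n))

  -- The condition 2 ≤ B excludes the branch s n < 0, where partial sums are not monotone.
  eventually-≥ : ∀ {s : ℕ → ℚ} {w B} → IsCauchy s → 0ℚ ≤ w → 1ℚ + 1ℚ ≤ B → (∀ n → expSum w n ≤ B) →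
    (∃[ N ] (∀ n → N ℕ.≤ n → B < expSum (s n) n)) → ∃[ N ] (∀ n → N ℕ.≤ n → w ≤ s n)
  eventually-≥ {s} {w} {B} cs 0≤w 2≤B w≤B (N₁ , above) = combine (eventually-bounded {s} cs)
    where
    open ≤-Reasoning
    module _ (M C : ℕ) (bounded : ∀ n → C ℕ.≤ n → ∣ s n ∣ ≤ fromℕ (suc M)) (N₂ : ℕ)
      (neg≤2 : ∀ n x → N₂ ℕ.≤ n → 0ℚ ≤ x → x + x ≤ fromℕ (suc (M ℕ.+ suc M)) → expSum (- x) n ≤ 1ℚ + 1ℚ)
      where
      -≤ : ∀ n → C ℕ.≤ n → - s n ≤ fromℕ (suc M)
      -≤ n C≤n = begin
        - s n          ≤⟨ p≤∣p∣ (- s n) ⟩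
        ∣ - s n ∣      ≡⟨ ∣-p∣≡∣p∣ (s n) ⟩
        ∣ s n ∣        ≤⟨ bounded n C≤n ⟩
        fromℕ (suc M)  ∎
      2x≤ : ∀ n → C ℕ.≤ n → - s n + - s n ≤ fromℕ (suc (M ℕ.+ suc M))
      2x≤ n C≤n = ≤-trans (+-mono-≤ (-≤ n C≤n) (-≤ n C≤n)) (≤-reflexive (sym (fromℕ-+ (suc M) (suc M))))
      neg-branch : ∀ n → C ℕ.⊔ N₂ ℕ.≤ n → s n ≤ 0ℚ → expSum (s n) n ≤ B
      neg-branch n ≤n s≤0 = subst (λ z → expSum z n ≤ B) (solve 1 (λ x → :- (:- x) := x) refl (s n))
        (≤-trans (neg≤2 n (- s n) (ℕ.m⊔n≤o⇒n≤o C N₂ ≤n) (neg-antimono-≤ s≤0) (2x≤ n (ℕ.m⊔n≤o⇒m≤o C N₂ ≤n))) 2≤B)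
      lower : ∀ n → N₁ ℕ.⊔ (C ℕ.⊔ N₂) ℕ.≤ n → w ≤ s n
      lower n N≤n with w ≤? s n
      ... | yes w≤s = w≤s
      ... | no  w≰s with ≤-total 0ℚ (s n)
      ...   | inj₁ 0≤s = contradiction (<-≤-trans (above n (ℕ.m⊔n≤o⇒m≤o N₁ (C ℕ.⊔ N₂) N≤n))
          (≤-trans (expSum-mono 0≤s (<⇒≤ (≰⇒> w≰s)) n) (w≤B n))) (<-irrefl refl)
      ...   | inj₂ s≤0 = contradiction (<-≤-trans (above n (ℕ.m⊔n≤o⇒m≤o N₁ (C ℕ.⊔ N₂) N≤n))
          (neg-branch n (ℕ.m⊔n≤o⇒n≤o N₁ (C ℕ.⊔ N₂) N≤n) s≤0)) (<-irrefl refl)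
    combine : (∃[ M ] ∃[ C ] (∀ n → C ℕ.≤ n → ∣ s n ∣ ≤ fromℕ (suc M))) → ∃[ N ] (∀ n → N ℕ.≤ n → w ≤ s n)
    combine (M , C , bounded) = N₁ ℕ.⊔ (C ℕ.⊔ proj₁ (expSum-neg≤2 (M ℕ.+ suc M))) ,
      lower M C bounded (proj₁ (expSum-neg≤2 (M ℕ.+ suc M))) (proj₂ (expSum-neg≤2 (M ℕ.+ suc M)))

-- Comparing the forcing bound with ln ln k.

module Comparison where
  open import Data.Rational.Base hiding (NonZero)
  open import Data.Rational.Properties
  open import Data.Rational.Solver using (module +-*-Solver)
  open +-*-Solver using (solve; _:+_; _:*_; _:=_; con)
  open import Defs
  open PrimeFactors using (lg; 2^lg≤; <2^1+lg; 2^-cancel-≤)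
  open Mertens
  open Exponential

  least-ℕ-above : ∀ x → 0ℚ ≤ x → ∃[ r ] (x ≤ fromℕ r × fromℕ r ≤ x + 1ℚ)
  least-ℕ-above x 0≤x with ≤-fromℕ x
  ... | n , x≤n with crossing fromℕ x (suc n) 0≤x (≤-<-trans x≤n (subst₂ _<_ (+-identityʳ (fromℕ n)) (fromℕ-suc n) (+-monoʳ-< (fromℕ n) (positive⁻¹ 1ℚ))))
  ... | j , j≤x , x<1+j = suc j , <⇒≤ x<1+j , ≤-trans (≤-reflexive (sym (fromℕ-suc j))) (+-monoˡ-≤ 1ℚ j≤x)

  0≤meanΩ : ∀ B → 0ℚ ≤ meanΩ B
  0≤meanΩ zero    = ≤-refl
  0≤meanΩ (suc B) = 0≤+ (0≤meanΩ B) (0≤* (0≤fromℕ (prime B)) (0≤recip (ℕ.pred B)))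

  -- The target is ε = 1/(q + 1) = 2/M′, twice the relative loss 1/M′ in `meanΩ≤`. D and c collect
  -- the additive errors in r and in ln V; once y ≥ G, the spare y^2 / M′ exceeds all lower-order
  -- terms.
  module Parameters (q : ℕ) where

    M′ M D c G : ℕ
    M′ = 2 ℕ.* suc q
    M  = suc M′
    D  = M ℕ.+ 6
    c  = M ℕ.* D ℕ.+ 3
    G  = M ℕ.* (D ℕ.+ c) ℕ.+ M ℕ.* (D ℕ.* c) ℕ.+ 7 ℕ.* M′

    M′*[1+inv] : ∀ y → fromℕ M′ * ((1ℚ + inv q) * y) ≡ fromℕ M * y + y
    M′*[1+inv] y = begin
      fromℕ M′ * ((1ℚ + inv q) * y)
        ≡⟨ cong (_* ((1ℚ + inv q) * y)) (fromℕ-* 2 (suc q)) ⟩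
      fromℕ 2 * s * ((1ℚ + inv q) * y)
        ≡⟨ solve 4 (λ t s i y → t :* s :* ((con 1ℚ :+ i) :* y) := (t :* s :+ t :* (i :* s)) :* y) refl (fromℕ 2) s (inv q) y ⟩
      (fromℕ 2 * s + fromℕ 2 * (inv q * s)) * y
        ≡⟨ cong₂ (λ a b → (a + fromℕ 2 * b) * y) (sym (fromℕ-* 2 (suc q))) (inv*suc q) ⟩
      (fromℕ M′ + fromℕ 2 * 1ℚ) * y
        ≡⟨ solve 2 (λ m y → (m :+ con (fromℕ 2) :* con 1ℚ) :* y := (m :+ con 1ℚ) :* y :+ y) refl (fromℕ M′) y ⟩
      (fromℕ M′ + 1ℚ) * y + y
        ≡⟨ cong (λ z → z * y + y) (fromℕ-suc M′) ⟩
      fromℕ M * y + y ∎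
      where
      open ≡-Reasoning
      s : ℚ
      s = fromℕ (suc q)

    -- With R = r + 1 and y + c as a bound for ln V, the left side bounds the logarithm of 8
    -- V^(r+1); the 7 comes from 8 ≤ e^7.
    quadratic : ∀ {R y} → 0ℚ ≤ y → fromℕ G ≤ y → fromℕ M′ * R ≤ fromℕ M * (y + fromℕ D) →
      fromℕ 7 + R * (y + fromℕ c) ≤ (1ℚ + inv q) * (y * y)
    quadratic {R} {y} 0≤y G≤y R≤ = cancel-fromℕ M′ (begin
      m′ * (fromℕ 7 + R * (y + c′))
        ≡⟨ solve 4 (λ m s r x → m :* (s :+ r :* x) := s :* m :+ m :* r :* x) refl m′ (fromℕ 7) R (y + c′) ⟩
      fromℕ 7 * m′ + m′ * R * (y + c′)
        ≤⟨ +-monoʳ-≤ (fromℕ 7 * m′) (monoʳ (y + c′) (0≤+ 0≤y (0≤fromℕ c)) R≤) ⟩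
      fromℕ 7 * m′ + m * (y + d) * (y + c′)
        ≡⟨ solve 5 (λ s m y d c → s :+ m :* (y :+ d) :* (y :+ c) := m :* (y :* y) :+ (m :* (d :+ c) :* y :+ (m :* (d :* c) :+ s)))
             refl (fromℕ 7 * m′) m y d c′ ⟩
      m * (y * y) + (m * (d + c′) * y + e)
        ≤⟨ +-monoʳ-≤ (m * (y * y)) (+-monoʳ-≤ (m * (d + c′) * y) (≤-trans (≤-reflexive (sym (*-identityʳ e))) (monoˡ e 0≤e 1≤y))) ⟩
      m * (y * y) + (m * (d + c′) * y + e * y)
        ≡⟨ cong (m * (y * y) +_) (trans (solve 4 (λ a b s y → a :* y :+ (b :+ s) :* y := (a :+ b :+ s) :* y) refl (m * (d + c′)) (m * (d * c′)) (fromℕ 7 * m′) y)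
             (cong (_* y) (sym G≡))) ⟩
      m * (y * y) + fromℕ G * y
        ≤⟨ +-monoʳ-≤ (m * (y * y)) (monoʳ y 0≤y G≤y) ⟩
      m * (y * y) + y * y
        ≡⟨ M′*[1+inv] (y * y) ⟨
      m′ * ((1ℚ + inv q) * (y * y)) ∎)
      where
      open ≤-Reasoning
      m m′ d c′ e : ℚ
      m  = fromℕ M
      m′ = fromℕ M′
      d  = fromℕ D
      c′ = fromℕ c
      e  = m * (d * c′) + fromℕ 7 * m′
      0≤e : 0ℚ ≤ e
      0≤e = 0≤+ (0≤* (0≤fromℕ M) (0≤* (0≤fromℕ D) (0≤fromℕ c))) (0≤* (0≤fromℕ 7) (0≤fromℕ M′))
      1≤y : 1ℚ ≤ y
      1≤y = ≤-trans (fromℕ-mono (ℕ.≤-trans (ℕ.s≤s ℕ.z≤n) (ℕ.m≤n+m (7 ℕ.* M′) (M ℕ.* (D ℕ.+ c) ℕ.+ M ℕ.* (D ℕ.* c))))) G≤y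
      G≡ : fromℕ G ≡ m * (d + c′) + m * (d * c′) + fromℕ 7 * m′
      G≡ = trans (fromℕ-+ (M ℕ.* (D ℕ.+ c) ℕ.+ M ℕ.* (D ℕ.* c)) (7 ℕ.* M′)) (cong₂ _+_
        (trans (fromℕ-+ (M ℕ.* (D ℕ.+ c)) (M ℕ.* (D ℕ.* c))) (cong₂ _+_
          (trans (fromℕ-* M (D ℕ.+ c)) (cong (m *_) (fromℕ-+ D c)))
          (trans (fromℕ-* M (D ℕ.* c)) (cong (m *_) (fromℕ-* D c)))))
        (fromℕ-* 7 M′))

    module _ (m r : ℕ) (r≤ : fromℕ r ≤ meanΩ (2 ℕ.^ (3 ℕ.+ m)) + 1ℚ) where

      -- In D = M + 6, the part M + 1 comes from `meanΩ≤`, 2 from `H≤h+2`, and 3 from three summands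
      -- M′ ≤ M.
      M′*suc-r≤ : fromℕ M′ * fromℕ (suc r) ≤ fromℕ M * (h m + fromℕ D)
      M′*suc-r≤ = begin
        m′ * fromℕ (suc r)
          ≡⟨ cong (m′ *_) (fromℕ-suc r) ⟨
        m′ * (fromℕ r + 1ℚ)
          ≤⟨ monoˡ m′ (0≤fromℕ M′) (+-monoˡ-≤ 1ℚ r≤) ⟩
        m′ * (meanΩ (2 ℕ.^ (3 ℕ.+ m)) + 1ℚ + 1ℚ)
          ≡⟨ solve 2 (λ m e → m :* (e :+ con 1ℚ :+ con 1ℚ) := m :* e :+ (m :+ m)) refl m′ (meanΩ (2 ℕ.^ (3 ℕ.+ m))) ⟩
        m′ * meanΩ (2 ℕ.^ (3 ℕ.+ m)) + (m′ + m′)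
          ≤⟨ +-monoˡ-≤ (m′ + m′) (meanΩ≤ M′ (2 ℕ.+ m)) ⟩
        μ * (H (2 ℕ.+ m) + μ + 1ℚ) + m′ + (m′ + m′)
          ≤⟨ +-mono-≤ (+-mono-≤ (monoˡ μ (0≤fromℕ M) (+-monoˡ-≤ 1ℚ (+-monoˡ-≤ μ
               (≤-trans (≤+ʳ (H (2 ℕ.+ m)) (<⇒≤ (0<inv (2 ℕ.+ m)))) (H≤h+2 m))))) m′≤μ) (+-mono-≤ m′≤μ m′≤μ) ⟩
        μ * (h m + fromℕ 2 + μ + 1ℚ) + μ + (μ + μ)
          ≡⟨ solve 2 (λ μ h → μ :* (h :+ con (fromℕ 2) :+ μ :+ con 1ℚ) :+ μ :+ (μ :+ μ) := μ :* (h :+ (μ :+ con (fromℕ 6)))) refl μ (h m) ⟩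
        μ * (h m + (μ + fromℕ 6))
          ≡⟨ cong (λ z → μ * (h m + z)) (fromℕ-+ M 6) ⟨
        μ * (h m + fromℕ D) ∎
        where
        open ≤-Reasoning
        μ m′ : ℚ
        μ  = fromℕ M
        m′ = fromℕ M′
        m′≤μ : m′ ≤ μ
        m′≤μ = fromℕ-mono (ℕ.n≤1+n M′)

      suc-r≤ : fromℕ (suc r) ≤ fromℕ (M ℕ.* D) * (1ℚ + h m)
      suc-r≤ = begin
        fromℕ (suc r)
          ≡⟨ *-identityˡ (fromℕ (suc r)) ⟨
        1ℚ * fromℕ (suc r)
          ≤⟨ monoʳ (fromℕ (suc r)) (0≤fromℕ (suc r)) (fromℕ-mono {1} {M′} (ℕ.s≤s ℕ.z≤n)) ⟩
        fromℕ M′ * fromℕ (suc r)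
          ≤⟨ M′*suc-r≤ ⟩
        μ * (h m + d)
          ≤⟨ monoˡ μ (0≤fromℕ M) (+-monoˡ-≤ d (≤-trans (≤-reflexive (sym (*-identityˡ (h m))))
               (monoʳ (h m) (0≤h m) (fromℕ-mono {1} {D} (ℕ.s≤s ℕ.z≤n))))) ⟩
        μ * (d * h m + d)
          ≡⟨ solve 3 (λ μ d h → μ :* (d :* h :+ d) := μ :* d :* (con 1ℚ :+ h)) refl μ d (h m) ⟩
        μ * d * (1ℚ + h m)
          ≡⟨ cong (_* (1ℚ + h m)) (fromℕ-* M D) ⟨
        fromℕ (M ℕ.* D) * (1ℚ + h m) ∎
        where
        open ≤-Reasoning
        μ d : ℚ
        μ = fromℕ M
        d = fromℕ D

      V : ℕ
      V = suc (r ℕ.+ (3 ℕ.+ m))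

      -- With a = M D, r + 1 ≤ a (1 + h m) ≤ e^(a + h m), and 3 + m ≤ e^(H (3 + m)) ≤ e^(h m + 2).
      -- Both are at most e^(h m + a + 2), and adding them costs one more in the exponent.
      V≲ : fromℕ V ≲exp h m + fromℕ c
      V≲ = ≲exp-weaken (0≤+ 0≤x 0≤1) (≤-reflexive (fromℕ-+ (suc r) (3 ℕ.+ m))) (≤-reflexive x+1≡)
        (≲exp-+ 0≤x
          (≲exp-weaken (0≤+ (0≤fromℕ a) (0≤h m)) suc-r≤ a+h≤x
            (≲exp-* (0≤fromℕ a) (0≤h m) (0≤+ 0≤1 (0≤h m))
              (≲exp-weaken (0≤fromℕ a) (fromℕ-mono (ℕ.n≤1+n a)) ≤-refl (suc≲exp a)) (1+≲exp (0≤h m))))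
          (≲exp-weaken (0≤H (3 ℕ.+ m)) (fromℕ-mono (ℕ.n≤1+n (3 ℕ.+ m)))
            (≤-trans (H≤h+2 m) (+-monoʳ-≤ (h m) (fromℕ-mono (ℕ.m≤n+m 2 a)))) (suc≲expH (3 ℕ.+ m))))
        where
        a : ℕ
        a = M ℕ.* D
        x : ℚ
        x = h m + fromℕ (a ℕ.+ 2)
        0≤x : 0ℚ ≤ x
        0≤x = 0≤+ (0≤h m) (0≤fromℕ (a ℕ.+ 2))
        a+h≤x : fromℕ a + h m ≤ x
        a+h≤x = ≤-trans (≤-reflexive (+-comm (fromℕ a) (h m))) (+-monoʳ-≤ (h m) (fromℕ-mono (ℕ.m≤m+n a 2)))
        x+1≡ : x + 1ℚ ≡ h m + fromℕ c
        x+1≡ = trans (+-assoc (h m) (fromℕ (a ℕ.+ 2)) 1ℚ)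
          (cong (h m +_) (trans (fromℕ-suc (a ℕ.+ 2)) (cong fromℕ (sym (ℕ.+-suc a 2)))))

      8*V^≲ : fromℕ G ≤ h m → fromℕ (8 ℕ.* V ℕ.^ suc r) ≲exp (1ℚ + inv q) * (h m * h m)
      8*V^≲ G≤h = ≲exp-weaken (0≤+ (0≤fromℕ 7) (0≤* (0≤fromℕ (suc r)) 0≤x)) (≤-reflexive (fromℕ-* 8 (V ℕ.^ suc r)))
        (quadratic (0≤h m) G≤h M′*suc-r≤)
        (≲exp-* (0≤fromℕ 7) (0≤* (0≤fromℕ (suc r)) 0≤x) (0≤fromℕ (V ℕ.^ suc r)) (suc≲exp 7) (≲exp-^ 0≤x V≲ (suc r)))
        where
        0≤x : 0ℚ ≤ h m + fromℕ c
        0≤x = 0≤+ (0≤h m) (0≤fromℕ c)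

  -- An inequality between reals holds for the approximations only up to a positive error. Error ½
  -- against a slack of 1 leaves a strict inequality.
  <-from-½ : ∀ {a b} → a + 1ℚ ≤ b + ½ → a < b
  <-from-½ {a} {b} le with b ≤? a
  ... | no  b≰a = ≰⇒> b≰a
  ... | yes b≤a = contradiction (<-≤-trans (≤-<-trans (+-monoˡ-≤ ½ b≤a) (+-monoʳ-< a ½<1)) le) (<-irrefl refl)
    where
    ½<1 : ½ < 1ℚ
    ½<1 = subst₂ _<_ (+-identityʳ ½) (half 1ℚ) (+-monoʳ-< ½ 0<½)

  log-≥ : ∀ {k ℓ} m → 2 ℕ.^ (2 ℕ.+ m) ℕ.≤ k → ℓ IsLogOf ℕ→ℝ k →
    ∃[ N ] (∀ n → N ℕ.≤ n → fromℕ (suc m) * ½ ≤ seq ℓ n)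
  log-≥ {k} {ℓ} m 2^≤k (_ , k≤expℓ) = eventually-≥ {seq ℓ} (cauchy ℓ) (0≤* (0≤fromℕ (suc m)) (<⇒≤ 0<½))
    (fromℕ-mono {2} (ℕ.^-monoʳ-≤ 2 {1} {suc m} (ℕ.s≤s ℕ.z≤n))) (expSum-halves (suc m))
    (proj₁ (k≤expℓ ½ 0<½) , λ n N≤n → <-from-½ (≤-trans 2^+1≤k (proj₂ (k≤expℓ ½ 0<½) n N≤n)))
    where
    2^+1≤k : fromℕ (2 ℕ.^ suc m) + 1ℚ ≤ fromℕ k
    2^+1≤k = ≤-trans (≤-reflexive (fromℕ-suc (2 ℕ.^ suc m))) (fromℕ-mono
      (ℕ.≤-trans (ℕ.^-monoʳ-< 2 (ℕ.s≤s (ℕ.s≤s ℕ.z≤n)) (ℕ.n<1+n (suc m))) 2^≤k))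

  -- Compare e^(h m) ≤ (m + 3)/3 with ln k ≥ (m + 1)/2. The slack of 1 asks for (m + 3)/3 + 1 ≤ (m +
  -- 1)/2, which is equivalent to m ≥ 9.
  loglog-≥ : ∀ {k ℓ ℓℓ} m → 9 ℕ.≤ m → 2 ℕ.^ (2 ℕ.+ m) ℕ.≤ k → ℓ IsLogOf ℕ→ℝ k → ℓℓ IsLogOf ℓ →
    ∃[ N ] (∀ n → N ℕ.≤ n → h m ≤ seq ℓℓ n)
  loglog-≥ {k} {ℓ} {ℓℓ} m 9≤m 2^≤k isLog (_ , ℓ≤expℓℓ) = from (log-≥ {k} {ℓ} m 2^≤k isLog) (ℓ≤expℓℓ ½ 0<½)
    where
    open ≤-Reasoning
    B : ℚ
    B = fromℕ (3 ℕ.+ m) * inv 2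
    2≤B : 1ℚ + 1ℚ ≤ B
    2≤B = ≤-trans (≤-reflexive (solve 0 (con 1ℚ :+ con 1ℚ := con (fromℕ 6) :* con (inv 2)) refl))
      (monoʳ (inv 2) (<⇒≤ (0<inv 2)) (fromℕ-mono (ℕ.+-monoʳ-≤ 3 (ℕ.≤-trans (ℕ.m≤m+n 3 6) 9≤m))))
    exp-h≤B : ∀ n → expSum (h m) n ≤ B
    exp-h≤B n = ≤-recip 3 (expSum-h m n)
    B+1≤ : B + 1ℚ ≤ fromℕ (suc m) * ½
    B+1≤ with ℕ.m≤n⇒∃[o]m+o≡n 9≤m
    ... | o , refl = begin
      fromℕ (12 ℕ.+ o) * inv 2 + 1ℚ
        ≡⟨ cong (λ z → z * inv 2 + 1ℚ) (fromℕ-+ 12 o) ⟩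
      (fromℕ 12 + fromℕ o) * inv 2 + 1ℚ
        -- The surplus coefficient is 1/2 - 1/3 = 1/6, that is, `inv 5`.
        ≤⟨ ≤+ʳ _ (0≤* (0≤fromℕ o) (<⇒≤ (0<inv 5))) ⟩
      (fromℕ 12 + fromℕ o) * inv 2 + 1ℚ + fromℕ o * inv 5
        ≡⟨ solve 1 (λ x → (con (fromℕ 12) :+ x) :* con (inv 2) :+ con 1ℚ :+ x :* con (inv 5) := (con (fromℕ 10) :+ x) :* con ½) refl (fromℕ o) ⟩
      (fromℕ 10 + fromℕ o) * ½
        ≡⟨ cong (_* ½) (fromℕ-+ 10 o) ⟨
      fromℕ (10 ℕ.+ o) * ½ ∎
    from : ∃[ N ] (∀ n → N ℕ.≤ n → fromℕ (suc m) * ½ ≤ seq ℓ n) →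
      ∃[ N ] (∀ n → N ℕ.≤ n → seq ℓ n ≤ expSum (seq ℓℓ n) n + ½) → ∃[ N ] (∀ n → N ℕ.≤ n → h m ≤ seq ℓℓ n)
    from (N₁ , lower) (N₂ , upper) = eventually-≥ {seq ℓℓ} (cauchy ℓℓ) (0≤h m) 2≤B exp-h≤B
      (N₁ ℕ.⊔ N₂ , λ n N≤n → <-from-½ (≤-trans B+1≤ (≤-trans (lower n (ℕ.m⊔n≤o⇒m≤o N₁ N₂ N≤n)) (upper n (ℕ.m⊔n≤o⇒n≤o N₁ N₂ N≤n)))))

  bound≤ : ∀ k L r → bound k L r ℕ.≤ k ℕ.* k ℕ.* (8 ℕ.* suc (r ℕ.+ L) ℕ.^ suc r)
  bound≤ k L r = ℕ.*-monoʳ-≤ (k ℕ.* k) (ℕ.≤-trans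
    (ℕ.+-mono-≤ (ℕ.*-monoʳ-≤ 4 (ℕ.≤-trans (ℕ.*-monoʳ-≤ (V ℕ.^ r) (ℕ.s≤s (ℕ.m≤m+n r L))) (ℕ.≤-reflexive (ℕ.*-comm (V ℕ.^ r) V))))
      (ℕ.*-mono-≤ {2} {4} {1} (ℕ.s≤s (ℕ.s≤s ℕ.z≤n)) (ℕ.m^n>0 V (suc r))))
    (ℕ.≤-reflexive (sym (ℕ.*-distribʳ-+ (V ℕ.^ suc r) 4 4))))
    where
    V : ℕ
    V = suc (r ℕ.+ L)

  -- Monotonicity of the partial sums in both length and nonnegative argument carries the bound from
  -- the rational y to the approximations of ln ln k.
  exp-bound : ∀ {T k b y ε} {ℓℓ : ℝ} → 0ℚ ≤ y → 0ℚ ≤ ε → T ℕ.≤ k ℕ.* k ℕ.* b → fromℕ b ≲exp (1ℚ + ε) * (y * y) →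
    ∃[ N ] (∀ n → N ℕ.≤ n → y ≤ seq ℓℓ n) →
    ℕ→ℝ T ≤ℝ ℕ→ℝ k *ℝ ℕ→ℝ k *ℝ exp ((ℕ→ℝ 1 +ℝ fromℚ ε) *ℝ (ℓℓ *ℝ ℓℓ))
  exp-bound {T} {k} {b} {y} {ε} {ℓℓ} 0≤y 0≤ε T≤ (n₀ , b≤) (N , y≤) δ 0<δ = N ℕ.⊔ n₀ , final
    where
    open ≤-Reasoning
    0≤u : 0ℚ ≤ (1ℚ + ε) * (y * y)
    0≤u = 0≤* (0≤+ 0≤1 0≤ε) (0≤* 0≤y 0≤y)
    final : ∀ n → N ℕ.⊔ n₀ ℕ.≤ n → fromℕ T ≤ fromℕ k * fromℕ k * expSum ((1ℚ + ε) * (seq ℓℓ n * seq ℓℓ n)) n + δ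
    final n ≤n = begin
      fromℕ T
        ≤⟨ fromℕ-mono T≤ ⟩
      fromℕ (k ℕ.* k ℕ.* b)
        ≡⟨ trans (fromℕ-* (k ℕ.* k) b) (cong (_* fromℕ b) (fromℕ-* k k)) ⟩
      fromℕ k * fromℕ k * fromℕ b
        ≤⟨ monoˡ (fromℕ k * fromℕ k) (0≤* (0≤fromℕ k) (0≤fromℕ k)) (≤-trans b≤ (≤-trans
             (expSum-monoʳ 0≤u (ℕ.m⊔n≤o⇒n≤o N n₀ ≤n))
             (expSum-mono 0≤u (monoˡ (1ℚ + ε) (0≤+ 0≤1 0≤ε) (*-mono-≤ 0≤y (≤-trans 0≤y y≤n) y≤n y≤n)) n))) ⟩
      fromℕ k * fromℕ k * expSum ((1ℚ + ε) * (seq ℓℓ n * seq ℓℓ n)) n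
        ≤⟨ ≤+ʳ _ (<⇒≤ 0<δ) ⟩
      fromℕ k * fromℕ k * expSum ((1ℚ + ε) * (seq ℓℓ n * seq ℓℓ n)) n + δ ∎
      where
      y≤n : y ≤ seq ℓℓ n
      y≤n = y≤ n (ℕ.m⊔n≤o⇒m≤o N n₀ ≤n)

  abstract
    -- The inner power gives G ≤ h m through `h-unbounded`, and 9 is the requirement of `loglog-≥`.
    threshold : ℕ → ℕ
    threshold q = 2 ℕ.^ (2 ℕ.+ (2 ℕ.^ (2 ℕ.* (Parameters.G q ℕ.+ 2)) ℕ.⊔ 9))

    beyond-threshold : ∀ q k → threshold q ℕ.≤ k →
      ∃[ m ] (2 ℕ.^ (2 ℕ.* (Parameters.G q ℕ.+ 2)) ℕ.≤ m × 9 ℕ.≤ m × 2 ℕ.^ (2 ℕ.+ m) ℕ.≤ k × k ℕ.< 2 ℕ.^ (3 ℕ.+ m))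
    beyond-threshold q k ≤k = m , ℕ.≤-trans (ℕ.m≤m⊔n b 9) m₀≤m , ℕ.≤-trans (ℕ.m≤n⊔m b 9) m₀≤m ,
      subst (λ z → 2 ℕ.^ z ℕ.≤ k) (sym 2+m≡) (2^lg≤ k {{ℕ.>-nonZero (ℕ.≤-trans (ℕ.m^n>0 2 (2 ℕ.+ m₀)) ≤k)}}) ,
      subst (λ z → k ℕ.< 2 ℕ.^ suc z) (sym 2+m≡) (<2^1+lg k)
      where
      b m₀ m : ℕ
      b = 2 ℕ.^ (2 ℕ.* (Parameters.G q ℕ.+ 2))
      m₀ = b ℕ.⊔ 9
      -- Then L = m + 3 = lg k + 1 is the least exponent with k < 2^L.
      m = lg k ℕ.∸ 2
      2+m₀≤ : 2 ℕ.+ m₀ ℕ.≤ lg k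
      2+m₀≤ = 2^-cancel-≤ (ℕ.≤-<-trans ≤k (<2^1+lg k))
      2+m≡ : 2 ℕ.+ m ≡ lg k
      2+m≡ = ℕ.m+[n∸m]≡n (ℕ.≤-trans (ℕ.m≤m+n 2 m₀) 2+m₀≤)
      m₀≤m : m₀ ℕ.≤ m
      m₀≤m = ℕ.∸-monoˡ-≤ 2 2+m₀≤

  T-bound : ∀ q k → threshold q ℕ.≤ k → ∀ T → IsT k T → ∀ ℓ ℓℓ → ℓ IsLogOf ℕ→ℝ k → ℓℓ IsLogOf ℓ →
    ℕ→ℝ T ≤ℝ ℕ→ℝ k *ℝ ℕ→ℝ k *ℝ exp ((ℕ→ℝ 1 +ℝ fromℚ (inv q)) *ℝ (ℓℓ *ℝ ℓℓ))
  T-bound q k ≤k T (_ , least) ℓ ℓℓ isLog isLogLog = from (beyond-threshold q k ≤k)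
    where
    Goal : Set
    Goal = ℕ→ℝ T ≤ℝ ℕ→ℝ k *ℝ ℕ→ℝ k *ℝ exp ((ℕ→ℝ 1 +ℝ fromℚ (inv q)) *ℝ (ℓℓ *ℝ ℓℓ))
    from : ∃[ m ] (2 ℕ.^ (2 ℕ.* (Parameters.G q ℕ.+ 2)) ℕ.≤ m × 9 ℕ.≤ m × 2 ℕ.^ (2 ℕ.+ m) ℕ.≤ k × k ℕ.< 2 ℕ.^ (3 ℕ.+ m)) → Goal
    from (m , large , 9≤m , 2^≤k , k<2^) = choose (least-ℕ-above (meanΩ (2 ℕ.^ L)) (0≤meanΩ (2 ℕ.^ L)))
      where
      L : ℕ
      L = 3 ℕ.+ m
      choose : ∃[ r ] (meanΩ (2 ℕ.^ L) ≤ fromℕ r × fromℕ r ≤ meanΩ (2 ℕ.^ L) + 1ℚ) → Goal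
      choose (r , mean≤r , r≤) = exp-bound {T} {k} {8 ℕ.* suc (r ℕ.+ L) ℕ.^ suc r} {h m} {inv q} {ℓℓ}
        (0≤h m) (<⇒≤ (0<inv q))
        (ℕ.≤-trans (least (bound k L r) (forces-bound k L r {{ℕ.>-nonZero (ℕ.≤-trans (ℕ.m^n>0 2 (2 ℕ.+ m)) 2^≤k)}} k<2^ mean≤r))
          (bound≤ k L r))
        (Parameters.8*V^≲ q m r r≤ (h-unbounded (Parameters.G q) m large))
        (loglog-≥ {k} {ℓ} {ℓℓ} m 9≤m 2^≤k isLog isLogLog)

  -- Letting ε tend to 0.

  module Diagonal (K : ℕ → ℕ) where

    index-upTo : ℕ → ℕ → ℕ
    index-upTo k zero    = 0
    index-upTo k (suc b) with K (suc b) ℕ.≤? k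
    ... | yes _ = suc b
    ... | no  _ = index-upTo k b

    -- `T-bound` has a fixed q and its own threshold. Using the largest q ≤ k whose threshold k has
    -- passed turns the constants `inv q` into one function of k.
    index : ℕ → ℕ
    index k = index-upTo k k

    K-index≤ : ∀ k b → K 0 ℕ.≤ k → K (index-upTo k b) ℕ.≤ k
    K-index≤ k zero    K0≤k = K0≤k
    K-index≤ k (suc b) K0≤k with K (suc b) ℕ.≤? k
    ... | yes K≤k = K≤k
    ... | no  _   = K-index≤ k b K0≤k

    ≤-index : ∀ q k b → q ℕ.≤ b → K q ℕ.≤ k → q ℕ.≤ index-upTo k b
    ≤-index zero    k b       q≤b K≤k = ℕ.z≤n
    ≤-index (suc q) k (suc b) q≤b K≤k with K (suc b) ℕ.≤? k
    ... | yes _   = q≤b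
    ... | no  K≰k with ℕ.m≤n⇒m<n∨m≡n q≤b
    ...   | inj₁ q<b  = ≤-index (suc q) k b (ℕ.s≤s⁻¹ q<b) K≤k
    ...   | inj₂ refl = contradiction K≤k K≰k

    inv-index→0 : TendsToZero (λ k → fromℚ (inv (index k)))
    inv-index→0 δ 0<δ = from (inv-small δ 0<δ)
      where
      constant : ∀ {a b} → a ≤ b → fromℚ a ≤ℝ fromℚ b
      constant {a} {b} a≤b η 0<η = 0 , λ _ _ → ≤-trans a≤b (≤+ʳ b (<⇒≤ 0<η))
      from : ∃[ N ] (∀ n → N ℕ.≤ n → inv n ≤ δ) →
        ∃[ K′ ] (∀ k → K′ ℕ.≤ k → fromℚ (- δ) ≤ℝ fromℚ (inv (index k)) × fromℚ (inv (index k)) ≤ℝ fromℚ δ)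
      -- k ≥ N puts N within the range searched, and k ≥ K N makes it admissible.
      from (N , small) = N ℕ.⊔ K N , λ k ≤k →
        constant (≤-trans (neg-antimono-≤ (<⇒≤ 0<δ)) (<⇒≤ (0<inv (index k)))) ,
        constant (small (index k) (≤-index N k k (ℕ.m⊔n≤o⇒m≤o N (K N) ≤k) (ℕ.m⊔n≤o⇒n≤o N (K N) ≤k)))

open import Data.Nat.Base using (_≤_)
open import Defs
open PrimeFactors using (lg; <2^1+lg)
open Mertens using (meanΩ; bound; forces-bound)
open Comparison using (threshold; T-bound; module Diagonal)
open Diagonal threshold

theorem1 : (∀ k → 3 ≤ k → ∃[ t ] ForcesRainbowAP k t) ×
    (∃[ ε ] (TendsToZero ε ×
    ∃[ K ] (∀ k → K ≤ k → 3 ≤ k → ∀ T → IsT k T →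
    ∀ ℓ ℓℓ → ℓ IsLogOf ℕ→ℝ k → ℓℓ IsLogOf ℓ →
    ℕ→ℝ T ≤ℝ ℕ→ℝ k *ℝ ℕ→ℝ k *ℝ exp ((ℕ→ℝ 1 +ℝ ε k) *ℝ (ℓℓ *ℝ ℓℓ)))))
-- From `threshold 0` on, the default index 0 is itself admissible, so `T-bound` applies at the
-- chosen index.
theorem1 = exists , (λ k → fromℚ (inv (index k))) , inv-index→0 , threshold 0 ,
  λ k K≤k _ → T-bound (index k) k (K-index≤ k k K≤k)
  where
  -- Makes T_k the minimum of a nonempty set; any r above the mean serves.
  exists : ∀ k → 3 ≤ k → ∃[ t ] ForcesRainbowAP k t
  exists k 3≤k = from (≤-fromℕ (meanΩ (2 ℕ.^ suc (lg k))))
    where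
    from : ∃[ r ] meanΩ (2 ℕ.^ suc (lg k)) ℚ.≤ fromℕ r → ∃[ t ] ForcesRainbowAP k t
    from (r , mean≤r) = bound k (suc (lg k)) r ,
      forces-bound k (suc (lg k)) r {{ℕ.>-nonZero (ℕ.≤-trans (ℕ.s≤s ℕ.z≤n) 3≤k)}} (<2^1+lg k) mean≤r
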